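{- Let $q$ be a power of an odd prime with $q\equiv 3\pmod 4$, let $d\ge 3$ be odd, and let $A\subset\mathbb{F}_q$ with $|A|\gg q^{1/2}$. Then at least one of the following holds: (1) $|A+A|\ge\min\{q^{\frac{d+1}{2d}},\,|A|^{\frac{d+1}{d}}\}$; (2) $|dA^2|\gg \dfrac{|A|^d}{q^{\frac{d-1}{2}}}$.
   Context: $A+A=\{a+b: a,b\in A\}$, $A^2=\{a^2: a\in A\}$, and $dA^2=\{a_1+\cdots+a_d : a_i\in A^2\}$. $X\ll Y$ means $X\le CY$ for an absolute constant $C>0$ (the hypothesis $|A|\gg q^{1/2}$ means $|A|\ge c\,q^{1/2}$ for a suitable absolute constant $c>0$). -}

module Defs where

open import Level using (Level; _⊔_) renaming (suc to lsuc)
open import Algebra.Bundles using (CommutativeRing)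
open import Algebra.Definitions using (Invertible)
open import Data.Fin.Base using (Fin)
import Data.Fin.Properties as Fin
open import Data.Integer.Base using (+_)
open import Data.List.Base using (List; []; _∷_; map; length; cartesianProductWith; deduplicate)
open import Data.Nat.Base using (ℕ; zero; suc)
open import Data.Rational.Base using (ℚ; _/_)
open import Function.Bundles using (Inverse; Injection)
open import Function.Properties.Inverse using (Inverse⇒Injection)
open import Relation.Binary.Definitions using (Decidable)
import Relation.Binary.PropositionalEquality as ≡
open import Relation.Nullary.Decidable using (via-injection)
open import Relation.Nullary.Negation using (¬_)

⟦_⟧ : ℕ → ℚ
⟦ n ⟧ = + n / 1

record FiniteField (a ℓ : Level) (q : ℕ) : Set (lsuc (a ⊔ ℓ)) where
  field
    commutativeRing : CommutativeRing a ℓ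

  open CommutativeRing commutativeRing public

  field
    1≉0         : ¬ (1# ≈ 0#)
    ≉0⇒inverse  : ∀ {x} → ¬ (x ≈ 0#) → Invertible _≈_ 1# _*_ x
    enumeration : Inverse setoid (≡.setoid (Fin q))

  _≟_ : Decidable _≈_
  _≟_ = via-injection (Inverse⇒Injection enumeration) Fin._≟_

  -- A list stands for the set of its entries: order and repetitions are
  -- irrelevant, and the cardinality counts the distinct entries only.
  card : List Carrier → ℕ
  card A = length (deduplicate _≟_ A)

  infixl 6 _⊕_
  _⊕_ : List Carrier → List Carrier → List Carrier
  A ⊕ B = cartesianProductWith _+_ A B

  -- A² = { a² : a ∈ A }, not the product set A · A.
  squares : List Carrier → List Carrier
  squares = map (λ a → a * a)

  -- The d-fold sumset X + ⋯ + X, not the dilate { d x : x ∈ X }.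
  infixr 7 _-fold_
  _-fold_ : ℕ → List Carrier → List Carrier
  zero  -fold X = 0# ∷ []
  suc d -fold X = X ⊕ d -fold X

{-# OPTIONS --safe #-}
-- Write d = 2k + 1, ‖v‖ = v₁² + ⋯ + v_d², Z = (A + A)ᵈ and T = dA².  For x, y ∈ Aᵈ the point
-- z = x + y ∈ Z lies on the sphere ‖z - y‖ = t with centre y ∈ Aᵈ and radius t = ‖x‖ ∈ T, so there
-- are at least |A|^{2d} incidences between Z and the set S = Aᵈ × T of spheres.  Conversely, call t
-- good if η((-1)ᵏ t) = -1 for the quadratic character η.  Two distinct spheres, one of them of good
-- radius, meet in at most q^{d-2} + q^{(d-3)/2} points: apart from one hyperplane, the pencil they
-- span consists of spheres, whose sizes are given by η, and η of a quadratic polynomial with leading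
-- coefficient t has a sum of favourable sign.  The second moment of the number of incidences of a
-- point, with Cauchy–Schwarz, then bounds the incidences of Z with the spheres of good radius by
-- |Z||S|/q plus the square root of |Z|(3 q^{(d-3)/2}|S|² + q^{d-1}|S|), which contradicts the
-- failure of both alternatives.  A positive proportion of x ∈ Aᵈ has ‖x‖ good as soon as |A|² ≥ 64 q,
-- by the orthogonality of the translates of η.
--
-- Everything is a count: sums are ℤ-valued, sets are 0/1-valued functions, and η t is the number of
-- square roots of t minus one, so no additive characters are needed.
module Submission where

open import Algebra.Bundles using (CommutativeRing; RawRing)
open import Algebra.Core using (Op₁; Op₂)
open import Algebra.Morphism.Structures using (IsRingMonomorphism)
import Algebra.Morphism.RingMonomorphism as RingMonomorphism
import Algebra.Solver.Ring
import Algebra.Solver.Ring.AlmostCommutativeRing as ACR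
open import Algebra.Structures using (IsCommutativeRing)
open import Data.Fin.Base as Fin using (Fin; zero; suc)
import Data.Fin.Properties as Fin
open import Data.Integer.Base as ℤ using (ℤ; +_; -[1+_])
import Data.Integer.Properties as ℤ
open import Data.Integer.Tactic.RingSolver using (solve-∀)
open import Data.List.Base as List using (List; []; _∷_; _++_; allFin; cartesianProductWith; deduplicate; length)
import Data.List.Membership.DecSetoid as DecSetoidMembership
open import Data.List.Membership.Setoid.Properties using (∈-deduplicate⁺; ∈-deduplicate⁻; ∈-cartesianProductWith⁺; ∈-map⁺; ∈-resp-≈; All[≉]⇒∉)
import Data.List.Properties as List
import Data.List.Relation.Unary.AllPairs as AllPairs
open import Data.List.Relation.Unary.Any using (here; there)
open import Data.List.Relation.Unary.Unique.DecSetoid.Properties using (deduplicate-!)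
import Data.List.Relation.Unary.Unique.Setoid as UniqueSetoid
open import Data.Maybe.Base as Maybe using (Maybe)
open import Data.Nat.Base as ℕ using (ℕ; zero; suc)
import Data.Nat.Coprimality as ℕ
import Data.Nat.DivMod as ℕ
import Data.Nat.Properties as ℕ
import Data.Rational.Base as ℚ
import Data.Rational.Properties as ℚ
open import Data.Sum.Base using (_⊎_; inj₁; inj₂)
open import Data.Vec.Base as Vec using (Vec; []; _∷_; zipWith)
import Data.Vec.Properties as Vec
open import Defs
open import Function.Base using (_∘_; id)
open import Function.Bundles using (Inverse)
open import Level using (0ℓ)
open import Relation.Binary.Bundles using (DecSetoid)
open import Relation.Binary.Consequences using (dec⇒weaklyDec)
open import Relation.Binary.Definitions using (tri<; tri≈; tri>)
import Relation.Binary.PropositionalEquality as ≡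
open import Relation.Nullary using (Dec; yes; no; ¬_; contradiction)

-- The sign in `good` is forced by the intersection bound. For t′ ≠ 0 the sum of η over the pencil
-- is η t′ (q [D = 0] - 1), with D the discriminant of the quadratic polynomial. When D = 0 its size
-- is q - 1; for a radius of the opposite sign it would add about q^((d-1)/2) common points, an
-- error larger by a factor q. For a good radius the same term only removes points.
--
-- The congruence on q enters as η(-1) = -1: then x² + y² vanishes only at the origin, spheres are
-- counted by adding two coordinates at a time, and η((-1)ᵏ) = (-1)ᵏ.
--
-- All spheres of good radius have the same size, so the mean number of incidences is known exactly
-- and the leading terms of the second moment cancel; upper bounds for the intersections then
-- suffice.
--
-- Failure of (1) is used through both entries of the minimum: |A+A|^d ≤ q^((d+1)/2) controls the
-- expected number of incidences and the first error term, |A+A|^d ≤ |A|^(d+1) the second error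
-- term. Failure of (2) bounds |S| in each of them.

module IntegerCoefficients {a ℓ} (R : CommutativeRing a ℓ) where

  open CommutativeRing R
  open import Algebra.Properties.Ring ring
  open import Algebra.Properties.AbelianGroup +-abelianGroup using (⁻¹-∙-comm)
  open import Algebra.Properties.Semiring.Mult.TCOptimised semiring
  open import Relation.Binary.Reasoning.Setoid setoid

  -- Coefficients of the ring solver are taken in ℤ, where they normalise by evaluation, and are
  -- interpreted in `R` only afterwards; the constants of an abstract ring do not reduce.
  fromℤ : ℤ → Carrier
  fromℤ (+ n) = n × 1#
  fromℤ -[1+ n ] = - (suc n × 1#)

  fromℤ-neg : ∀ i → fromℤ (ℤ.- i) ≈ - fromℤ i
  fromℤ-neg (+ zero) = sym -0#≈0#
  fromℤ-neg (+ suc n) = refl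
  fromℤ-neg -[1+ n ] = sym (-‿involutive _)

  1+-×1 : ∀ n → suc n × 1# ≈ 1# + n × 1#
  1+-×1 n = ×-homo-+ 1# 1 n

  fromℤ-⊖ : ∀ m n → fromℤ (m ℤ.⊖ n) ≈ m × 1# - n × 1#
  fromℤ-⊖ zero zero = sym (-‿inverseʳ 0#)
  fromℤ-⊖ zero (suc n) = sym (+-identityˡ _)
  fromℤ-⊖ (suc m) zero = sym (trans (+-congˡ -0#≈0#) (+-identityʳ _))
  fromℤ-⊖ (suc m) (suc n) = begin
    fromℤ (suc m ℤ.⊖ suc n)            ≡⟨ ≡.cong fromℤ (ℤ.[1+m]⊖[1+n]≡m⊖n m n) ⟩
    fromℤ (m ℤ.⊖ n)                    ≈⟨ fromℤ-⊖ m n ⟩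
    m × 1# - n × 1#                    ≈⟨ +-congʳ (x≈z//y _ _ _ (+-comm (m × 1#) 1#)) ⟩
    1# + m × 1# - 1# - n × 1#          ≈⟨ +-assoc _ _ _ ⟩
    1# + m × 1# + (- 1# - n × 1#)      ≈⟨ +-cong (1+-×1 m) (trans (-‿cong (1+-×1 n)) (sym (⁻¹-∙-comm _ _))) ⟨
    suc m × 1# - suc n × 1#            ∎

  fromℤ-+ : ∀ i j → fromℤ (i ℤ.+ j) ≈ fromℤ i + fromℤ j
  fromℤ-+ (+ m) (+ n) = ×-homo-+ 1# m n
  fromℤ-+ (+ m) -[1+ n ] = fromℤ-⊖ m (suc n)
  fromℤ-+ -[1+ m ] (+ n) = trans (fromℤ-⊖ n (suc m)) (+-comm _ _)
  fromℤ-+ -[1+ m ] -[1+ n ] = begin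
    - (suc (suc (m ℕ.+ n)) × 1#)       ≈⟨ -‿cong (1+-×1 (suc m ℕ.+ n)) ⟩
    - (1# + (suc m ℕ.+ n) × 1#)        ≈⟨ -‿cong (+-congˡ (×-homo-+ 1# (suc m) n)) ⟩
    - (1# + (suc m × 1# + n × 1#))     ≈⟨ -‿cong (trans (+-congˡ (+-comm _ _)) (sym (+-assoc _ _ _))) ⟩
    - (1# + n × 1# + suc m × 1#)       ≈⟨ -‿cong (+-congʳ (1+-×1 n)) ⟨
    - (suc n × 1# + suc m × 1#)        ≈⟨ ⁻¹-∙-comm _ _ ⟨
    - (suc n × 1#) - suc m × 1#        ≈⟨ +-comm _ _ ⟩
    - (suc m × 1#) - suc n × 1#        ∎

  fromℤ-pos-* : ∀ m n → fromℤ (+ m ℤ.* + n) ≈ m × 1# * n × 1#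
  fromℤ-pos-* m n = trans (reflexive (≡.cong fromℤ (≡.sym (ℤ.pos-* m n)))) (×1-homo-* m n)

  fromℤ-neg-* : ∀ m j → fromℤ (+ suc m ℤ.* j) ≈ suc m × 1# * fromℤ j → fromℤ (-[1+ m ] ℤ.* j) ≈ fromℤ -[1+ m ] * fromℤ j
  fromℤ-neg-* m j e = begin
    fromℤ (-[1+ m ] ℤ.* j)         ≡⟨ ≡.cong fromℤ (ℤ.neg-distribˡ-* (+ suc m) j) ⟨
    fromℤ (ℤ.- (+ suc m ℤ.* j))    ≈⟨ fromℤ-neg (+ suc m ℤ.* j) ⟩
    - fromℤ (+ suc m ℤ.* j)        ≈⟨ -‿cong e ⟩
    - (suc m × 1# * fromℤ j)       ≈⟨ -‿distribˡ-* _ _ ⟩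
    - (suc m × 1#) * fromℤ j       ∎

  fromℤ-* : ∀ i j → fromℤ (i ℤ.* j) ≈ fromℤ i * fromℤ j
  fromℤ-* (+ m) (+ n) = fromℤ-pos-* m n
  fromℤ-* (+ m) -[1+ n ] = begin
    fromℤ (+ m ℤ.* -[1+ n ])       ≡⟨ ≡.cong fromℤ (ℤ.*-comm (+ m) -[1+ n ]) ⟩
    fromℤ (-[1+ n ] ℤ.* + m)       ≈⟨ fromℤ-neg-* n (+ m) (fromℤ-pos-* (suc n) m) ⟩
    - (suc n × 1#) * m × 1#        ≈⟨ *-comm _ _ ⟩
    m × 1# * - (suc n × 1#)        ∎
  fromℤ-* -[1+ m ] (+ n) = fromℤ-neg-* m (+ n) (fromℤ-pos-* (suc m) n)
  fromℤ-* -[1+ m ] -[1+ n ] = fromℤ-neg-* m -[1+ n ] (fromℤ-* (+ suc m) -[1+ n ])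

  homomorphism : ℤ.+-*-rawRing ACR.-Raw-AlmostCommutative⟶ ACR.fromCommutativeRing R
  homomorphism = record
    { ⟦_⟧ = fromℤ ; +-homo = fromℤ-+ ; *-homo = fromℤ-* ; -‿homo = fromℤ-neg ; 0-homo = refl ; 1-homo = refl }

  fromℤ-≟ : ∀ i j → Maybe (fromℤ i ≈ fromℤ j)
  fromℤ-≟ i j = Maybe.map (λ e → reflexive (≡.cong fromℤ e)) (dec⇒weaklyDec ℤ._≟_ i j)

  open Algebra.Solver.Ring _ _ homomorphism fromℤ-≟ public

module Counting where

  open import Data.Product.Base using (_×_; _,_; ∃-syntax)
  open import Data.Integer.Base hiding (suc; NonZero; _%_; _/_)
  open import Data.Integer.Properties hiding (_≟_; _<?_)
  open import Data.Nat.Base using (_%_; _/_)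
  open import Data.Nat.DivMod using (m≡m%n+[m/n]*n)
  open import Relation.Binary.PropositionalEquality hiding (J)

  -- Ordered arithmetic of ℤ, Iverson brackets and finite sums.

  *-monoˡ : ∀ {a b c} → 0ℤ ≤ c → a ≤ b → c * a ≤ c * b
  *-monoˡ {c = c} 0≤c a≤b = *-monoˡ-≤-nonNeg c {{nonNegative 0≤c}} a≤b

  *-monoʳ : ∀ {a b c} → 0ℤ ≤ c → a ≤ b → a * c ≤ b * c
  *-monoʳ {c = c} 0≤c a≤b = *-monoʳ-≤-nonNeg c {{nonNegative 0≤c}} a≤b

  *-mono : ∀ {a b c d} → 0ℤ ≤ a → 0ℤ ≤ d → a ≤ b → c ≤ d → a * c ≤ b * d
  *-mono 0≤a 0≤d a≤b c≤d = ≤-trans (*-monoˡ 0≤a c≤d) (*-monoʳ 0≤d a≤b)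

  *-nonneg : ∀ {a b} → 0ℤ ≤ a → 0ℤ ≤ b → 0ℤ ≤ a * b
  *-nonneg {a} 0≤a 0≤b = ≤-trans (≤-reflexive (sym (*-zeroʳ a))) (*-monoˡ 0≤a 0≤b)

  +-nonneg : ∀ {a b} → 0ℤ ≤ a → 0ℤ ≤ b → 0ℤ ≤ a + b
  +-nonneg = +-mono-≤

  sq-nonneg : ∀ a → 0ℤ ≤ a * a
  sq-nonneg (+ n) = *-nonneg {+ n} {+ n} (+≤+ ℕ.z≤n) (+≤+ ℕ.z≤n)
  sq-nonneg -[1+ n ] = +≤+ ℕ.z≤n

  0≤1 : 0ℤ ≤ 1ℤ
  0≤1 = +≤+ ℕ.z≤n

  sq-cancel-≤ : ∀ {a b} → 0ℤ ≤ b → a * a ≤ b * b → a ≤ b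
  sq-cancel-≤ {a} {b} 0≤b aa≤bb with a ≤? b
  ... | yes a≤b = a≤b
  ... | no a≰b = contradiction (<-≤-trans (≤-<-trans (*-monoˡ 0≤b (<⇒≤ b<a)) (*-monoʳ-<-pos a {{positive (≤-<-trans 0≤b b<a)}} b<a)) aa≤bb) (<-irrefl refl)
    where
    b<a = ≰⇒> a≰b

  odd≢even : ∀ m n → + 2 * m + 1ℤ ≢ + 2 * n
  odd≢even m n e with ∣ n - m ∣ | trans (sym (abs-* (+ 2) (n - m))) (cong ∣_∣ half)
    where
    distribute : ∀ m n → + 2 * (n - m) ≡ + 2 * n - + 2 * m
    distribute = solve-∀
    cancel : ∀ m → + 2 * m + 1ℤ - + 2 * m ≡ 1ℤ
    cancel = solve-∀
    half : + 2 * (n - m) ≡ 1ℤ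
    half = trans (distribute m n) (trans (cong (_- + 2 * m) (sym e)) (cancel m))
  ... | zero | ()
  ... | suc j | 2j≡1 = contradiction (trans (sym (ℕ.*-suc 2 j)) 2j≡1) λ ()

  ⟨_⟩ : ∀ {p} {P : Set p} → Dec P → ℤ
  ⟨ yes _ ⟩ = 1ℤ
  ⟨ no _ ⟩ = 0ℤ

  ⟨⟩-true : ∀ {p} {P : Set p} (P? : Dec P) → P → ⟨ P? ⟩ ≡ 1ℤ
  ⟨⟩-true (yes _) _ = refl
  ⟨⟩-true (no ¬p) p = contradiction p ¬p

  ⟨⟩-false : ∀ {p} {P : Set p} (P? : Dec P) → ¬ P → ⟨ P? ⟩ ≡ 0ℤ
  ⟨⟩-false (yes p) ¬p = contradiction p ¬p
  ⟨⟩-false (no _) _ = refl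

  ⟨⟩-cong : ∀ {p r} {P : Set p} {R : Set r} (P? : Dec P) (R? : Dec R) → (P → R) → (R → P) → ⟨ P? ⟩ ≡ ⟨ R? ⟩
  ⟨⟩-cong (yes p) R? f g = sym (⟨⟩-true R? (f p))
  ⟨⟩-cong (no ¬p) R? f g = sym (⟨⟩-false R? λ r → ¬p (g r))

  ⟨⟩-nonneg : ∀ {p} {P : Set p} (P? : Dec P) → 0ℤ ≤ ⟨ P? ⟩
  ⟨⟩-nonneg (yes _) = 0≤1
  ⟨⟩-nonneg (no _) = ≤-refl

  ⟨⟩≤1 : ∀ {p} {P : Set p} (P? : Dec P) → ⟨ P? ⟩ ≤ 1ℤ
  ⟨⟩≤1 (yes _) = ≤-refl
  ⟨⟩≤1 (no _) = 0≤1

  ⟨⟩-*-≤ : ∀ {a b c} {A : Set a} {B : Set b} {C : Set c} (A? : Dec A) (B? : Dec B) (C? : Dec C) → (A → B → C) → ⟨ A? ⟩ * ⟨ B? ⟩ ≤ ⟨ C? ⟩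
  ⟨⟩-*-≤ (yes a) (yes b) C? f = ≤-reflexive (sym (⟨⟩-true C? (f a b)))
  ⟨⟩-*-≤ (yes _) (no _) C? f = ⟨⟩-nonneg C?
  ⟨⟩-*-≤ (no _) _ C? f = ⟨⟩-nonneg C?

  ⟨⟩-idem : ∀ {a} {A : Set a} (A? : Dec A) → ⟨ A? ⟩ * ⟨ A? ⟩ ≡ ⟨ A? ⟩
  ⟨⟩-idem (yes _) = refl
  ⟨⟩-idem (no _) = refl

  ∑ : ∀ {X : Set} → List X → (X → ℤ) → ℤ
  ∑ [] f = 0ℤ
  ∑ (x ∷ xs) f = f x + ∑ xs f

  module _ {X : Set} where

    ∑-cong : ∀ (xs : List X) {f g} → (∀ x → f x ≡ g x) → ∑ xs f ≡ ∑ xs g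
    ∑-cong [] e = refl
    ∑-cong (x ∷ xs) e = cong₂ _+_ (e x) (∑-cong xs e)

    ∑-mono : ∀ (xs : List X) {f g} → (∀ x → f x ≤ g x) → ∑ xs f ≤ ∑ xs g
    ∑-mono [] e = ≤-refl
    ∑-mono (x ∷ xs) e = +-mono-≤ (e x) (∑-mono xs e)

    ∑-+ : ∀ (xs : List X) f g → ∑ xs (λ x → f x + g x) ≡ ∑ xs f + ∑ xs g
    ∑-+ [] f g = refl
    ∑-+ (x ∷ xs) f g = trans (cong (_+_ (f x + g x)) (∑-+ xs f g)) (lemma (f x) (g x) _ _)
      where
      lemma : ∀ a b c d → a + b + (c + d) ≡ a + c + (b + d)
      lemma = solve-∀

    ∑-*ˡ : ∀ (xs : List X) c f → ∑ xs (λ x → c * f x) ≡ c * ∑ xs f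
    ∑-*ˡ [] c f = sym (*-zeroʳ c)
    ∑-*ˡ (x ∷ xs) c f = trans (cong (_+_ (c * f x)) (∑-*ˡ xs c f)) (sym (*-distribˡ-+ c _ _))

    ∑-*ʳ : ∀ (xs : List X) f c → ∑ xs (λ x → f x * c) ≡ ∑ xs f * c
    ∑-*ʳ xs f c = trans (∑-cong xs λ x → *-comm (f x) c) (trans (∑-*ˡ xs c f) (*-comm c _))

    ∑-neg : ∀ (xs : List X) f → ∑ xs (λ x → - f x) ≡ - ∑ xs f
    ∑-neg [] f = refl
    ∑-neg (x ∷ xs) f = trans (cong (_+_ (- f x)) (∑-neg xs f)) (sym (neg-distrib-+ (f x) _))

    ∑-- : ∀ (xs : List X) f g → ∑ xs (λ x → f x - g x) ≡ ∑ xs f - ∑ xs g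
    ∑-- xs f g = trans (∑-+ xs f (λ x → - g x)) (cong (_+_ (∑ xs f)) (∑-neg xs g))

    ∑-0 : ∀ (xs : List X) → ∑ xs (λ _ → 0ℤ) ≡ 0ℤ
    ∑-0 [] = refl
    ∑-0 (x ∷ xs) = trans (+-identityˡ _) (∑-0 xs)

    ∑-nonneg : ∀ (xs : List X) {f} → (∀ x → 0ℤ ≤ f x) → 0ℤ ≤ ∑ xs f
    ∑-nonneg xs e = ≤-trans (≤-reflexive (sym (∑-0 xs))) (∑-mono xs e)

    ∑-const : ∀ (xs : List X) c → ∑ xs (λ _ → c) ≡ ∑ xs (λ _ → 1ℤ) * c
    ∑-const xs c = trans (∑-cong xs λ _ → sym (*-identityˡ c)) (∑-*ʳ xs (λ _ → 1ℤ) c)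

    ∑-++ : ∀ (xs ys : List X) f → ∑ (xs ++ ys) f ≡ ∑ xs f + ∑ ys f
    ∑-++ [] ys f = sym (+-identityˡ _)
    ∑-++ (x ∷ xs) ys f = trans (cong (_+_ (f x)) (∑-++ xs ys f)) (sym (+-assoc (f x) _ _))

  ∑-swap : ∀ {X Y : Set} (xs : List X) (ys : List Y) (f : X → Y → ℤ) →
    ∑ xs (λ x → ∑ ys (f x)) ≡ ∑ ys (λ y → ∑ xs (λ x → f x y))
  ∑-swap [] ys f = sym (∑-0 ys)
  ∑-swap (x ∷ xs) ys f = trans (cong (_+_ (∑ ys (f x))) (∑-swap xs ys f)) (sym (∑-+ ys (f x) _))

  ∑-map : ∀ {X Y : Set} (xs : List X) (φ : X → Y) f → ∑ (List.map φ xs) f ≡ ∑ xs (λ x → f (φ x))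
  ∑-map [] φ f = refl
  ∑-map (x ∷ xs) φ f = cong (_+_ (f (φ x))) (∑-map xs φ f)

  ∑-cartesianProductWith : ∀ {X Y Z : Set} (c : X → Y → Z) xs ys f →
    ∑ (cartesianProductWith c xs ys) f ≡ ∑ xs (λ x → ∑ ys (λ y → f (c x y)))
  ∑-cartesianProductWith c [] ys f = refl
  ∑-cartesianProductWith c (x ∷ xs) ys f =
    trans (∑-++ (List.map (c x) ys) _ f) (cong₂ _+_ (∑-map ys (c x) f) (∑-cartesianProductWith c xs ys f))

  ∑-*-∑ : ∀ {X Y : Set} (xs : List X) (ys : List Y) f g →
    ∑ xs f * ∑ ys g ≡ ∑ xs (λ x → ∑ ys (λ y → f x * g y))
  ∑-*-∑ xs ys f g = trans (sym (∑-*ʳ xs f (∑ ys g))) (∑-cong xs λ x → sym (∑-*ˡ ys (f x) g))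

  -- From Σ_{x,y} w x w y (f x - f y)² ≥ 0.
  cauchy-schwarz : ∀ {X : Set} (xs : List X) (w f : X → ℤ) → (∀ x → 0ℤ ≤ w x) →
    ∑ xs (λ x → w x * f x) * ∑ xs (λ x → w x * f x) ≤ ∑ xs w * ∑ xs (λ x → w x * (f x * f x))
  cauchy-schwarz xs w f 0≤w = *-cancelˡ-≤-pos (L * L) (W * Q) (+ 2) (0≤i-j⇒j≤i (≤-trans nonneg (≤-reflexive expand)))
    where
    W = ∑ xs w
    L = ∑ xs (λ x → w x * f x)
    Q = ∑ xs (λ x → w x * (f x * f x))
    nonneg : 0ℤ ≤ ∑ xs (λ x → ∑ xs (λ y → w x * w y * ((f x - f y) * (f x - f y))))
    nonneg = ∑-nonneg xs λ x → ∑-nonneg xs λ y → *-nonneg (*-nonneg (0≤w x) (0≤w y)) (sq-nonneg (f x - f y))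
    pointwise : ∀ a b s t → a * b * ((s - t) * (s - t)) ≡ a * (s * s) * b + a * (b * (t * t)) - + 2 * (a * s * (b * t))
    pointwise = solve-∀
    final : ∀ W L Q → Q * W + W * Q - + 2 * (L * L) ≡ + 2 * (W * Q) - + 2 * (L * L)
    final = solve-∀
    expand : ∑ xs (λ x → ∑ xs (λ y → w x * w y * ((f x - f y) * (f x - f y)))) ≡ + 2 * (W * Q) - + 2 * (L * L)
    expand = begin
      _ ≡⟨ (∑-cong xs λ x → ∑-cong xs λ y → pointwise (w x) (w y) (f x) (f y)) ⟩
      _ ≡⟨ (∑-cong xs λ x → trans (∑-- xs _ _) (cong₂ _-_ (∑-+ xs _ _) (∑-*ˡ xs (+ 2) _))) ⟩
      _ ≡⟨ trans (∑-- xs _ _) (cong₂ _-_ (∑-+ xs _ _) (∑-*ˡ xs (+ 2) _)) ⟩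
      _ ≡⟨ cong₂ _-_ (cong₂ _+_ (sym (∑-*-∑ xs xs (λ x → w x * (f x * f x)) w)) (sym (∑-*-∑ xs xs w (λ x → w x * (f x * f x)))))
             (cong (+ 2 *_) (sym (∑-*-∑ xs xs (λ x → w x * f x) (λ x → w x * f x)))) ⟩
      Q * W + W * Q - + 2 * (L * L) ≡⟨ final W L Q ⟩
      + 2 * (W * Q) - + 2 * (L * L) ∎
      where open ≡-Reasoning

  -- Sums over `Fin n`: point masses, bijections, involutions.

  ∑ᶠ : ∀ {n} → (Fin n → ℤ) → ℤ
  ∑ᶠ {n} = ∑ (allFin n)

  allFin-suc : ∀ n → allFin (suc n) ≡ zero ∷ List.map suc (allFin n)
  allFin-suc n = cong (zero ∷_) (sym (List.map-tabulate id suc))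

  ∑ᶠ-suc : ∀ {n} (f : Fin (suc n) → ℤ) → ∑ᶠ f ≡ f zero + ∑ᶠ (f ∘ suc)
  ∑ᶠ-suc {n} f = trans (cong (λ xs → ∑ xs f) (allFin-suc n)) (cong (_+_ (f zero)) (∑-map (allFin n) suc f))

  ∑ᶠ-1 : ∀ n → ∑ᶠ {n} (λ _ → 1ℤ) ≡ + n
  ∑ᶠ-1 zero = refl
  ∑ᶠ-1 (suc n) = trans (∑ᶠ-suc {n} (λ _ → 1ℤ)) (cong (_+_ 1ℤ) (∑ᶠ-1 n))

  ∑ᶠ-const : ∀ n c → ∑ᶠ {n} (λ _ → c) ≡ + n * c
  ∑ᶠ-const n c = trans (∑-const (allFin n) c) (cong (_* c) (∑ᶠ-1 n))

  ∑ᶠ-single : ∀ {n} (a : Fin n) {f} → (∀ x → x ≢ a → f x ≡ 0ℤ) → ∑ᶠ f ≡ f a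
  ∑ᶠ-single {suc n} zero {f} e = begin
    ∑ᶠ f                      ≡⟨ ∑ᶠ-suc f ⟩
    f zero + ∑ᶠ (f ∘ suc)     ≡⟨ cong (_+_ (f zero)) (trans (∑-cong (allFin n) λ x → e (suc x) λ ()) (∑-0 (allFin n))) ⟩
    f zero + 0ℤ               ≡⟨ +-identityʳ _ ⟩
    f zero                    ∎
    where open ≡-Reasoning
  ∑ᶠ-single {suc n} (suc a) {f} e = begin
    ∑ᶠ f                      ≡⟨ ∑ᶠ-suc f ⟩
    f zero + ∑ᶠ (f ∘ suc)     ≡⟨ cong₂ _+_ (e zero λ ()) (∑ᶠ-single a λ x x≢a → e (suc x) (x≢a ∘ Fin.suc-injective)) ⟩
    0ℤ + f (suc a)            ≡⟨ +-identityˡ _ ⟩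
    f (suc a)                 ∎
    where open ≡-Reasoning

  module _ {n : ℕ} where

    ∑ᶠ-unique : ∀ {p} {P : Fin n → Set p} (P? : ∀ x → Dec (P x)) a → P a → (∀ x → P x → x ≡ a) → ∑ᶠ (λ x → ⟨ P? x ⟩) ≡ 1ℤ
    ∑ᶠ-unique P? a pa unique = trans (∑ᶠ-single a λ x x≢a → ⟨⟩-false (P? x) (x≢a ∘ unique x)) (⟨⟩-true (P? a) pa)

    ∑ᶠ-δ : ∀ (a : Fin n) (f : Fin n → ℤ) → ∑ᶠ (λ x → ⟨ x Fin.≟ a ⟩ * f x) ≡ f a
    ∑ᶠ-δ a f = trans (∑ᶠ-single a {λ x → ⟨ x Fin.≟ a ⟩ * f x} λ x x≢a → cong (_* f x) (⟨⟩-false (x Fin.≟ a) x≢a))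
      (trans (cong (_* f a) (⟨⟩-true (a Fin.≟ a) refl)) (*-identityˡ (f a)))

    ∑ᶠ-bijection : ∀ (φ ψ : Fin n → Fin n) → (∀ x → ψ (φ x) ≡ x) → (∀ y → φ (ψ y) ≡ y) → ∀ f → ∑ᶠ (f ∘ φ) ≡ ∑ᶠ f
    ∑ᶠ-bijection φ ψ ψφ φψ f = begin
      ∑ᶠ (λ x → f (φ x))                               ≡⟨ (∑-cong (allFin n) λ x → ∑ᶠ-δ (φ x) f) ⟨
      ∑ᶠ (λ x → ∑ᶠ (λ y → ⟨ y Fin.≟ φ x ⟩ * f y))      ≡⟨ ∑-swap (allFin n) (allFin n) _ ⟩
      ∑ᶠ (λ y → ∑ᶠ (λ x → ⟨ y Fin.≟ φ x ⟩ * f y))      ≡⟨ (∑-cong (allFin n) λ y → trans (∑-*ʳ (allFin n) _ (f y)) (cong (_* f y) (once y))) ⟩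
      ∑ᶠ (λ y → 1ℤ * f y)                              ≡⟨ (∑-cong (allFin n) λ y → *-identityˡ (f y)) ⟩
      ∑ᶠ f                                             ∎
      where
      open ≡-Reasoning
      once : ∀ y → ∑ᶠ (λ x → ⟨ y Fin.≟ φ x ⟩) ≡ 1ℤ
      once y = ∑ᶠ-unique (λ x → y Fin.≟ φ x) (ψ y) (sym (φψ y)) λ x e → trans (sym (ψφ x)) (cong ψ (sym e))

    -- Each orbit of size two is counted at its smaller element, so modulo 2 only the fixed points
    -- contribute. Both uses are parity arguments about q.
    ∑ᶠ-involution : ∀ (φ : Fin n → Fin n) → (∀ x → φ (φ x) ≡ x) → ∀ f → (∀ x → f (φ x) ≡ f x) →
      ∑ᶠ f ≡ ∑ᶠ (λ x → ⟨ φ x Fin.≟ x ⟩ * f x) + + 2 * ∑ᶠ (λ x → ⟨ x Fin.<? φ x ⟩ * f x)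
    ∑ᶠ-involution φ φφ f fφ = begin
      ∑ᶠ f               ≡⟨ ∑-cong (allFin n) split ⟩
      ∑ᶠ (λ x → ⟨ φ x Fin.≟ x ⟩ * f x + (⟨ x Fin.<? φ x ⟩ * f x + ⟨ φ x Fin.<? x ⟩ * f x))
        ≡⟨ trans (∑-+ (allFin n) _ _) (cong (_+_ S) (∑-+ (allFin n) _ _)) ⟩
      S + (L + ∑ᶠ (λ x → ⟨ φ x Fin.<? x ⟩ * f x))
        ≡⟨ cong (λ z → S + (L + z)) (trans (sym (∑ᶠ-bijection φ φ φφ φφ _)) (∑-cong (allFin n) reflect)) ⟩
      S + (L + L)        ≡⟨ double S L ⟩
      S + + 2 * L        ∎
      where
      open ≡-Reasoning
      S = ∑ᶠ (λ x → ⟨ φ x Fin.≟ x ⟩ * f x)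
      L = ∑ᶠ (λ x → ⟨ x Fin.<? φ x ⟩ * f x)
      double : ∀ a b → a + (b + b) ≡ a + + 2 * b
      double = solve-∀
      reflect : ∀ x → ⟨ φ (φ x) Fin.<? φ x ⟩ * f (φ x) ≡ ⟨ x Fin.<? φ x ⟩ * f x
      reflect x = cong₂ _*_ (cong (λ y → ⟨ y Fin.<? φ x ⟩) (φφ x)) (fφ x)
      eval₁ : ∀ a → a ≡ 1ℤ * a + (0ℤ * a + 0ℤ * a)
      eval₁ = solve-∀
      eval₂ : ∀ a → a ≡ 0ℤ * a + (1ℤ * a + 0ℤ * a)
      eval₂ = solve-∀
      eval₃ : ∀ a → a ≡ 0ℤ * a + (0ℤ * a + 1ℤ * a)
      eval₃ = solve-∀
      combine : ∀ {a b c a′ b′ c′} y → a ≡ a′ → b ≡ b′ → c ≡ c′ → a′ * y + (b′ * y + c′ * y) ≡ a * y + (b * y + c * y)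
      combine y refl refl refl = refl
      split : ∀ x → f x ≡ ⟨ φ x Fin.≟ x ⟩ * f x + (⟨ x Fin.<? φ x ⟩ * f x + ⟨ φ x Fin.<? x ⟩ * f x)
      split x with Fin.<-cmp x (φ x)
      ... | tri< l ¬e ¬g = trans (eval₂ (f x)) (combine (f x) (⟨⟩-false (φ x Fin.≟ x) (¬e ∘ sym)) (⟨⟩-true (x Fin.<? φ x) l) (⟨⟩-false (φ x Fin.<? x) ¬g))
      ... | tri≈ ¬l e ¬g = trans (eval₁ (f x)) (combine (f x) (⟨⟩-true (φ x Fin.≟ x) (sym e)) (⟨⟩-false (x Fin.<? φ x) ¬l) (⟨⟩-false (φ x Fin.<? x) ¬g))
      ... | tri> ¬l ¬e g = trans (eval₃ (f x)) (combine (f x) (⟨⟩-false (φ x Fin.≟ x) (¬e ∘ sym)) (⟨⟩-false (x Fin.<? φ x) ¬l) (⟨⟩-true (φ x Fin.<? x) g))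

    ∑ᶠ-nonneg-zero : ∀ (f : Fin n → ℤ) → (∀ x → 0ℤ ≤ f x) → ∑ᶠ f ≤ 0ℤ → ∀ x → f x ≡ 0ℤ
    ∑ᶠ-nonneg-zero f 0≤f ∑≤0 a = ≤-antisym (≤-trans (≤-reflexive (sym (∑ᶠ-δ a f))) (≤-trans (∑-mono (allFin n) below) ∑≤0)) (0≤f a)
      where
      below : ∀ x → ⟨ x Fin.≟ a ⟩ * f x ≤ f x
      below x = ≤-trans (*-monoʳ (0≤f x) (⟨⟩≤1 (x Fin.≟ a))) (≤-reflexive (*-identityˡ (f x)))

  -- Finite fields with q ≡ 3 mod 4.

  record FieldOnFin (q : ℕ) : Set where
    infix 8 ⊟_
    infixl 7 _·_
    infixl 6 _⊹_
    field
      _⊹_ _·_           : Op₂ (Fin q)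
      ⊟_                : Op₁ (Fin q)
      𝟘 𝟙               : Fin q
      isCommutativeRing : IsCommutativeRing _≡_ _⊹_ _·_ ⊟_ 𝟘 𝟙
      𝟙≢𝟘               : 𝟙 ≢ 𝟘
      inverse           : ∀ x → x ≢ 𝟘 → ∃[ y ] y · x ≡ 𝟙

  module Field {q : ℕ} (K : FieldOnFin q) (q%4≡3 : q % 4 ≡ 3) where

    open FieldOnFin K public

    F : Set
    F = Fin q

    infixl 6 _⊟_
    infix 4 _≟_

    commutativeRing : CommutativeRing 0ℓ 0ℓ
    commutativeRing = record { isCommutativeRing = isCommutativeRing }

    open IntegerCoefficients commutativeRing using (solve; _:=_; _:+_; _:*_; _:-_; :-_; con)

    _⊟_ : Op₂ F
    x ⊟ y = x ⊹ ⊟ y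

    sq : Op₁ F
    sq x = x · x

    _≟_ : (x y : F) → Dec (x ≡ y)
    _≟_ = Fin._≟_

    Fs : List F
    Fs = allFin q

    ·-zeroˡ : ∀ x → 𝟘 · x ≡ 𝟘
    ·-zeroˡ = solve 1 (λ x → con 0ℤ :* x := con 0ℤ) refl

    ·-zeroʳ : ∀ x → x · 𝟘 ≡ 𝟘
    ·-zeroʳ = solve 1 (λ x → x :* con 0ℤ := con 0ℤ) refl

    ·-identityˡ : ∀ x → 𝟙 · x ≡ x
    ·-identityˡ = solve 1 (λ x → con 1ℤ :* x := x) refl

    ·-cancelˡ : ∀ {a x y} → a ≢ 𝟘 → a · x ≡ a · y → x ≡ y
    ·-cancelˡ {a} {x} {y} a≢0 e with b , ba≡1 ← inverse a a≢0 = begin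
      x             ≡⟨ back x ⟩
      b · (a · x)   ≡⟨ cong (b ·_) e ⟩
      b · (a · y)   ≡⟨ back y ⟨
      y             ∎
      where
      open ≡-Reasoning
      back : ∀ z → z ≡ b · (a · z)
      back z = trans (sym (·-identityˡ z)) (trans (cong (_· z) (sym ba≡1)) (solve 3 (λ a b z → b :* a :* z := b :* (a :* z)) refl a b z))

    ·≢𝟘 : ∀ {a b} → a ≢ 𝟘 → b ≢ 𝟘 → a · b ≢ 𝟘
    ·≢𝟘 {a} a≢0 b≢0 e = b≢0 (·-cancelˡ a≢0 (trans e (sym (·-zeroʳ a))))

    sq≢𝟘 : ∀ {a} → a ≢ 𝟘 → sq a ≢ 𝟘
    sq≢𝟘 a≢0 = ·≢𝟘 a≢0 a≢0

    ⊟≡𝟘 : ∀ {x y} → x ⊟ y ≡ 𝟘 → x ≡ y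
    ⊟≡𝟘 {x} {y} e = begin
      x             ≡⟨ solve 2 (λ x y → x := x :- y :+ y) refl x y ⟩
      x ⊟ y ⊹ y     ≡⟨ cong (_⊹ y) e ⟩
      𝟘 ⊹ y         ≡⟨ solve 1 (λ y → con 0ℤ :+ y := y) refl y ⟩
      y             ∎
      where open ≡-Reasoning

    ⊟-self : ∀ {x y} → x ≡ y → x ⊟ y ≡ 𝟘
    ⊟-self {x} refl = solve 1 (λ x → x :- x := con 0ℤ) refl x

    ⊟-involutive : ∀ x → ⊟ ⊟ x ≡ x
    ⊟-involutive = solve 1 (λ x → :- (:- x) := x) refl

    ∑-affine : ∀ κ b → κ ≢ 𝟘 → ∀ (f : F → ℤ) → ∑ᶠ (λ x → f (κ · x ⊹ b)) ≡ ∑ᶠ f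
    ∑-affine κ b κ≢0 with μ , μκ≡1 ← inverse κ κ≢0 =
      ∑ᶠ-bijection (λ x → κ · x ⊹ b) (λ y → μ · (y ⊟ b)) left right
      where
      left : ∀ x → μ · (κ · x ⊹ b ⊟ b) ≡ x
      left x = trans (solve 4 (λ κ b μ x → μ :* (κ :* x :+ b :- b) := μ :* κ :* x) refl κ b μ x) (trans (cong (_· x) μκ≡1) (·-identityˡ x))
      right : ∀ y → κ · (μ · (y ⊟ b)) ⊹ b ≡ y
      right y = trans (solve 4 (λ κ b μ y → κ :* (μ :* (y :- b)) :+ b := μ :* κ :* (y :- b) :+ b) refl κ b μ y)
        (trans (cong (λ z → z · (y ⊟ b) ⊹ b) μκ≡1) (solve 2 (λ y b → con 1ℤ :* (y :- b) :+ b := y) refl y b))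

    ∑-translate : ∀ b (f : F → ℤ) → ∑ᶠ (λ x → f (x ⊹ b)) ≡ ∑ᶠ f
    ∑-translate b f = trans (∑-cong Fs λ x → cong (λ z → f (z ⊹ b)) (sym (·-identityˡ x))) (∑-affine 𝟙 b 𝟙≢𝟘 f)

    ∑-linear : ∀ κ b c → κ ≢ 𝟘 → ∑ᶠ (λ x → ⟨ κ · x ⊹ b ≟ c ⟩) ≡ 1ℤ
    ∑-linear κ b c κ≢0 = trans (∑-affine κ b κ≢0 (λ y → ⟨ y ≟ c ⟩)) (∑ᶠ-unique (λ y → y ≟ c) c refl λ _ e → e)

    q≡3+4[q/4] : + q ≡ + 3 + + 4 * + (q / 4)
    q≡3+4[q/4] = begin
      + q                              ≡⟨ cong +_ (m≡m%n+[m/n]*n q 4) ⟩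
      + (q % 4 ℕ.+ q / 4 ℕ.* 4)        ≡⟨ cong (λ r → + (r ℕ.+ q / 4 ℕ.* 4)) q%4≡3 ⟩
      + 3 + + (q / 4 ℕ.* 4)            ≡⟨ cong (_+_ (+ 3)) (trans (pos-* (q / 4) 4) (*-comm (+ (q / 4)) (+ 4))) ⟩
      + 3 + + 4 * + (q / 4)            ∎
      where open ≡-Reasoning

    -- Otherwise x ↦ x + 1 is a fixed-point-free involution, so q is even.
    𝟚≢𝟘 : 𝟙 ⊹ 𝟙 ≢ 𝟘
    𝟚≢𝟘 2≡0 = odd≢even (1ℤ + + 2 * + (q / 4)) L (trans (trans (arith (+ (q / 4))) (sym q≡3+4[q/4])) even)
      where
      L = ∑ᶠ (λ x → ⟨ x Fin.<? x ⊹ 𝟙 ⟩ * 1ℤ)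
      arith : ∀ k → + 2 * (1ℤ + + 2 * k) + 1ℤ ≡ + 3 + + 4 * k
      arith = solve-∀
      fixed-point-free : ∀ x → x ⊹ 𝟙 ≢ x
      fixed-point-free x e = 𝟙≢𝟘 (trans (solve 2 (λ x u → u := x :+ u :- x) refl x 𝟙) (⊟-self e))
      involutive : ∀ x → x ⊹ 𝟙 ⊹ 𝟙 ≡ x
      involutive x = trans (solve 2 (λ x u → x :+ u :+ u := x :+ (u :+ u)) refl x 𝟙) (trans (cong (x ⊹_) 2≡0) (solve 1 (λ x → x :+ con 0ℤ := x) refl x))
      even : + q ≡ + 2 * L
      even = begin
        + q                   ≡⟨ ∑ᶠ-1 q ⟨
        ∑ᶠ {q} (λ _ → 1ℤ)     ≡⟨ ∑ᶠ-involution (_⊹ 𝟙) involutive (λ _ → 1ℤ) (λ _ → refl) ⟩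
        ∑ᶠ (λ x → ⟨ x ⊹ 𝟙 ≟ x ⟩ * 1ℤ) + + 2 * L
          ≡⟨ cong (_+ + 2 * L) (trans (∑-cong Fs λ x → cong (_* 1ℤ) (⟨⟩-false (x ⊹ 𝟙 ≟ x) (fixed-point-free x))) (∑-0 Fs)) ⟩
        0ℤ + + 2 * L          ≡⟨ +-identityˡ _ ⟩
        + 2 * L               ∎
        where open ≡-Reasoning

    double≢𝟘 : ∀ {x} → x ≢ 𝟘 → x ⊹ x ≢ 𝟘
    double≢𝟘 {x} x≢0 e = ·≢𝟘 𝟚≢𝟘 x≢0 (trans (solve 1 (λ x → (con 1ℤ :+ con 1ℤ) :* x := x :+ x) refl x) e)

    ⊟≢self : ∀ {x} → x ≢ 𝟘 → ⊟ x ≢ x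
    ⊟≢self {x} x≢0 e = double≢𝟘 x≢0 (trans (cong (x ⊹_) (sym e)) (⊟-self {x} refl))

    -- The quadratic character.

    η : F → ℤ
    η t = ∑ᶠ (λ x → ⟨ sq x ≟ t ⟩) - 1ℤ

    -- Pairs the kind of `t`, with a square root where there is one, with the value of η, so that a
    -- single case split yields both.
    data Quadratic (t : F) : Set where
      isZero    : t ≡ 𝟘 → η t ≡ 0ℤ → Quadratic t
      square    : ∀ c → c ≢ 𝟘 → sq c ≡ t → η t ≡ 1ℤ → Quadratic t
      nonsquare : t ≢ 𝟘 → η t ≡ -1ℤ → Quadratic t

    sq≡sq : ∀ {x a} → sq x ≡ sq a → x ≢ a → x ≡ ⊟ a
    sq≡sq {x} {a} e x≢a = ⊟≡𝟘 (trans (cong (x ⊹_) (⊟-involutive a))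
      (·-cancelˡ (x≢a ∘ ⊟≡𝟘) (trans (solve 2 (λ x a → (x :- a) :* (x :+ a) := x :* x :- a :* a) refl x a) (trans (⊟-self e) (sym (·-zeroʳ (x ⊟ a)))))))

    η-zero : η 𝟘 ≡ 0ℤ
    η-zero = cong (_- 1ℤ) (∑ᶠ-unique (λ x → sq x ≟ 𝟘) 𝟘 (·-zeroˡ 𝟘) unique)
      where
      unique : ∀ x → sq x ≡ 𝟘 → x ≡ 𝟘
      unique x e with x ≟ 𝟘
      ... | yes p = p
      ... | no x≢0 = contradiction e (sq≢𝟘 x≢0)

    η-sq : ∀ a → a ≢ 𝟘 → η (sq a) ≡ 1ℤ
    η-sq a a≢0 = cong (_- 1ℤ) (begin
      ∑ᶠ (λ x → ⟨ sq x ≟ sq a ⟩)                           ≡⟨ ∑-cong Fs split ⟩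
      ∑ᶠ (λ x → ⟨ x ≟ a ⟩ + ⟨ x ≟ ⊟ a ⟩)                   ≡⟨ ∑-+ Fs _ _ ⟩
      ∑ᶠ (λ x → ⟨ x ≟ a ⟩) + ∑ᶠ (λ x → ⟨ x ≟ ⊟ a ⟩)        ≡⟨ cong₂ _+_ (∑ᶠ-unique (_≟ a) a refl λ _ e → e) (∑ᶠ-unique (_≟ ⊟ a) (⊟ a) refl λ _ e → e) ⟩
      + 2                                                  ∎)
      where
      open ≡-Reasoning
      split : ∀ x → ⟨ sq x ≟ sq a ⟩ ≡ ⟨ x ≟ a ⟩ + ⟨ x ≟ ⊟ a ⟩
      split x with x ≟ a
      ... | yes refl = trans (⟨⟩-true (sq x ≟ sq x) refl) (cong (_+_ 1ℤ) (sym (⟨⟩-false (x ≟ ⊟ x) (⊟≢self a≢0 ∘ sym))))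
      ... | no x≢a = trans (⟨⟩-cong (sq x ≟ sq a) (x ≟ ⊟ a) (λ e → sq≡sq e x≢a)
              (λ e → trans (cong sq e) (solve 1 (λ a → :- a :* :- a := a :* a) refl a))) (sym (+-identityˡ _))

    quadratic? : ∀ t → Quadratic t
    quadratic? t with t ≟ 𝟘 | Fin.any? (λ x → sq x ≟ t)
    ... | yes refl | _ = isZero refl η-zero
    ... | no t≢0 | yes (c , refl) = square c c≢0 refl (η-sq c c≢0)
      where
      c≢0 : c ≢ 𝟘
      c≢0 refl = t≢0 (·-zeroˡ 𝟘)
    ... | no t≢0 | no none = nonsquare t≢0 (cong (_- 1ℤ) (trans (∑-cong Fs λ x → ⟨⟩-false (sq x ≟ t) λ e → none (x , e)) (∑-0 Fs)))

    η≤1 : ∀ t → η t ≤ 1ℤ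
    η≤1 t with quadratic? t
    ... | isZero _ e = ≤-trans (≤-reflexive e) 0≤1
    ... | square _ _ _ e = ≤-reflexive e
    ... | nonsquare _ e = ≤-trans (≤-reflexive e) -≤+

    -- By the definition of η, the squaring map takes the value t exactly 1 + η t times.
    ∑-sq : ∀ (g : F → ℤ) → ∑ᶠ (λ x → g (sq x)) ≡ ∑ᶠ (λ t → (1ℤ + η t) * g t)
    ∑-sq g = begin
      ∑ᶠ (λ x → g (sq x))                                ≡⟨ (∑-cong Fs λ x → ∑ᶠ-δ (sq x) g) ⟨
      ∑ᶠ (λ x → ∑ᶠ (λ t → ⟨ t ≟ sq x ⟩ * g t))           ≡⟨ ∑-swap Fs Fs _ ⟩
      ∑ᶠ (λ t → ∑ᶠ (λ x → ⟨ t ≟ sq x ⟩ * g t))           ≡⟨ (∑-cong Fs λ t → trans (∑-*ʳ Fs _ (g t)) (cong (_* g t) (count t))) ⟩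
      ∑ᶠ (λ t → (1ℤ + η t) * g t)                        ∎
      where
      open ≡-Reasoning
      add-sub : ∀ a → a ≡ 1ℤ + (a - 1ℤ)
      add-sub = solve-∀
      count : ∀ t → ∑ᶠ (λ x → ⟨ t ≟ sq x ⟩) ≡ 1ℤ + η t
      count t = trans (∑-cong Fs λ x → ⟨⟩-cong (t ≟ sq x) (sq x ≟ t) sym sym) (add-sub _)

    -- `∑-sq` for the constant 1 equates q with the sum of 1 + η t.
    ∑-η : ∑ᶠ η ≡ 0ℤ
    ∑-η = begin
      ∑ᶠ η                                               ≡⟨ ∑-cong Fs (λ t → expand (η t)) ⟩
      ∑ᶠ (λ t → (1ℤ + η t) * 1ℤ - 1ℤ)                    ≡⟨ ∑-- Fs _ _ ⟩
      ∑ᶠ (λ t → (1ℤ + η t) * 1ℤ) - ∑ᶠ {q} (λ _ → 1ℤ)     ≡⟨ cong (_- ∑ᶠ {q} (λ _ → 1ℤ)) (sym (∑-sq (λ _ → 1ℤ))) ⟩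
      ∑ᶠ {q} (λ _ → 1ℤ) - ∑ᶠ {q} (λ _ → 1ℤ)              ≡⟨ +-inverseʳ (∑ᶠ {q} (λ _ → 1ℤ)) ⟩
      0ℤ                                                 ∎
      where
      open ≡-Reasoning
      expand : ∀ a → a ≡ (1ℤ + a) * 1ℤ - 1ℤ
      expand = solve-∀

    -- The map x ↦ c x carries the square roots of b to those of c² b.
    η-sq-* : ∀ c b → c ≢ 𝟘 → η (sq c · b) ≡ η b
    η-sq-* c b c≢0 = cong (_- 1ℤ) (begin
      ∑ᶠ (λ x → ⟨ sq x ≟ sq c · b ⟩)             ≡⟨ ∑-affine c 𝟘 c≢0 (λ x → ⟨ sq x ≟ sq c · b ⟩) ⟨
      ∑ᶠ (λ x → ⟨ sq (c · x ⊹ 𝟘) ≟ sq c · b ⟩)   ≡⟨ (∑-cong Fs λ x → ⟨⟩-cong (sq (c · x ⊹ 𝟘) ≟ sq c · b) (sq x ≟ b)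
                                                      (λ e → ·-cancelˡ (sq≢𝟘 c≢0) (trans (sym (expand x)) e)) (λ e → trans (expand x) (cong (sq c ·_) e))) ⟩
      ∑ᶠ (λ x → ⟨ sq x ≟ b ⟩)                    ∎)
      where
      open ≡-Reasoning
      expand : ∀ x → sq (c · x ⊹ 𝟘) ≡ sq c · sq x
      expand = solve 2 (λ c x → (c :* x :+ con 0ℤ) :* (c :* x :+ con 0ℤ) := c :* c :* (x :* x)) refl c

    -- b ↦ - η b - η (a b) is nonnegative and sums to 0.
    η-nonsquare-* : ∀ a → a ≢ 𝟘 → η a ≡ -1ℤ → ∀ b → η (a · b) ≡ - η b
    η-nonsquare-* a a≢0 ηa b = trans (rearrange (η (a · b)) (η b)) (trans (cong (λ z → - z - η b) (∑ᶠ-nonneg-zero defect defect-nonneg (≤-reflexive ∑-defect) b)) (neg-zero (η b)))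
      where
      defect : F → ℤ
      defect b = - η b - η (a · b)
      rearrange : ∀ x y → x ≡ - (- y - x) - y
      rearrange = solve-∀
      neg-zero : ∀ y → - 0ℤ - y ≡ - y
      neg-zero = solve-∀
      ∑-defect : ∑ᶠ defect ≡ 0ℤ
      ∑-defect = begin
        ∑ᶠ defect                               ≡⟨ trans (∑-- Fs (λ b → - η b) (λ b → η (a · b))) (cong (_- ∑ᶠ (λ b → η (a · b))) (∑-neg Fs η)) ⟩
        - ∑ᶠ η - ∑ᶠ (λ b → η (a · b))           ≡⟨ cong₂ (λ x y → - x - y) ∑-η (trans scaled ∑-η) ⟩
        0ℤ                                      ∎
        where
        open ≡-Reasoning
        scaled : ∑ᶠ (λ b → η (a · b)) ≡ ∑ᶠ η
        scaled = trans (∑-cong Fs λ b → cong η (solve 1 (λ z → z := z :+ con 0ℤ) refl (a · b))) (∑-affine a 𝟘 a≢0 η)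
      bound : ∀ {x y} → x ≤ 1ℤ → y ≡ -1ℤ → 0ℤ ≤ - y - x
      bound x≤1 refl = i≤j⇒0≤j-i x≤1
      -- For b = c² ≠ 0, `η-sq-*` gives η (a c²) = η a = -1, so the defect vanishes. For a nonsquare
      -- b it is 1 - η (a b), and η ≤ 1 is all that has to be known.
      defect-nonneg : ∀ b → 0ℤ ≤ defect b
      defect-nonneg b with quadratic? b
      ... | isZero refl _ = ≤-reflexive (sym (cong₂ (λ x y → - x - y) η-zero (trans (cong η (·-zeroʳ a)) η-zero)))
      ... | square c c≢0 refl ηb = ≤-reflexive (sym (cong₂ (λ x y → - x - y) ηb (trans (cong η (solve 2 (λ a d → a :* d := d :* a) refl a (sq c))) (trans (η-sq-* c a c≢0) ηa))))
      ... | nonsquare _ ηb = bound (η≤1 (a · b)) ηb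

    η-* : ∀ a b → η (a · b) ≡ η a * η b
    η-* a b with quadratic? a
    ... | isZero refl ηa = trans (cong η (·-zeroˡ b)) (trans η-zero (sym (cong (_* η b) ηa)))
    ... | square c c≢0 refl ηa = trans (η-sq-* c b c≢0) (sym (trans (cong (_* η b) ηa) (*-identityˡ (η b))))
    ... | nonsquare a≢0 ηa = trans (η-nonsquare-* a a≢0 ηa b) (sym (trans (cong (_* η b) ηa) (-1*i≡-i (η b))))

    -- Substituting y = x - s turns y² = x² - D into 2 x s = s² + D, which is linear in x.
    ∑-η-sq⊟ : ∀ D → ∑ᶠ (λ x → η (sq x ⊟ D)) ≡ + q * ⟨ D ≟ 𝟘 ⟩ - 1ℤ
    ∑-η-sq⊟ D = begin
      ∑ᶠ (λ x → η (sq x ⊟ D))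
        ≡⟨ ∑-- Fs _ (λ _ → 1ℤ) ⟩
      ∑ᶠ (λ x → ∑ᶠ (λ y → ⟨ sq y ≟ sq x ⊟ D ⟩)) - ∑ᶠ {q} (λ _ → 1ℤ)
        ≡⟨ cong₂ _-_ (∑-cong Fs λ x → sym (∑-affine (⊟ 𝟙) x ⊟𝟙≢𝟘 (λ y → ⟨ sq y ≟ sq x ⊟ D ⟩))) (∑ᶠ-1 q) ⟩
      ∑ᶠ (λ x → ∑ᶠ (λ s → ⟨ sq (⊟ 𝟙 · s ⊹ x) ≟ sq x ⊟ D ⟩)) - + q
        ≡⟨ cong (_- + q) (trans (∑-swap Fs Fs _) (∑-cong Fs inner)) ⟩
      ∑ᶠ (λ s → 1ℤ + ⟨ s ≟ 𝟘 ⟩ * (+ q * ⟨ D ≟ 𝟘 ⟩ - 1ℤ)) - + q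
        ≡⟨ cong (_- + q) (trans (∑-+ Fs _ _) (cong₂ _+_ (∑ᶠ-1 q) (∑ᶠ-δ 𝟘 (λ _ → + q * ⟨ D ≟ 𝟘 ⟩ - 1ℤ)))) ⟩
      + q + (+ q * ⟨ D ≟ 𝟘 ⟩ - 1ℤ) - + q
        ≡⟨ cancel (+ q) _ ⟩
      + q * ⟨ D ≟ 𝟘 ⟩ - 1ℤ ∎
      where
      open ≡-Reasoning
      cancel : ∀ a b → a + b - a ≡ b
      cancel = solve-∀
      eval₀ : ∀ a → a ≡ 1ℤ + 1ℤ * (a - 1ℤ)
      eval₀ = solve-∀
      ⊟𝟙≢𝟘 : ⊟ 𝟙 ≢ 𝟘
      ⊟𝟙≢𝟘 e = 𝟙≢𝟘 (trans (sym (⊟-involutive 𝟙)) (trans (cong ⊟_ e) (solve 0 (:- con 0ℤ := con 0ℤ) refl)))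
      eq₀ : ∀ x → sq (⊟ 𝟙 · 𝟘 ⊹ x) ≡ sq x
      eq₀ = solve 1 (λ x → (:- con 1ℤ :* con 0ℤ :+ x) :* (:- con 1ℤ :* con 0ℤ :+ x) := x :* x) refl
      difference : ∀ s x → sq (⊟ 𝟙 · s ⊹ x) ⊟ (sq x ⊟ D) ≡ (sq s ⊹ D) ⊟ (s ⊹ s) · x
      difference s x = solve 3 (λ s x D → (:- con 1ℤ :* s :+ x) :* (:- con 1ℤ :* s :+ x) :- (x :* x :- D) := (s :* s :+ D) :- (s :+ s) :* x) refl s x D
      inner : ∀ s → ∑ᶠ (λ x → ⟨ sq (⊟ 𝟙 · s ⊹ x) ≟ sq x ⊟ D ⟩) ≡ 1ℤ + ⟨ s ≟ 𝟘 ⟩ * (+ q * ⟨ D ≟ 𝟘 ⟩ - 1ℤ)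
      inner s with s ≟ 𝟘
      -- For s = 0 the condition on x degenerates to D = 0, which holds for all x or for none: this
      -- is the origin of the term q [D = 0].
      ... | yes refl = trans (∑-cong Fs λ x → ⟨⟩-cong (sq (⊟ 𝟙 · 𝟘 ⊹ x) ≟ sq x ⊟ D) (D ≟ 𝟘)
                          (λ e → trans (solve 2 (λ x D → D := x :- (x :- D)) refl (sq x) D) (⊟-self (trans (sym (eq₀ x)) e)))
                          (λ { refl → trans (eq₀ x) (solve 1 (λ x → x := x :- con 0ℤ) refl (sq x)) }))
                        (trans (∑ᶠ-const q ⟨ D ≟ 𝟘 ⟩) (eval₀ _))
      ... | no s≢0 = trans (∑-cong Fs λ x → ⟨⟩-cong (sq (⊟ 𝟙 · s ⊹ x) ≟ sq x ⊟ D) ((s ⊹ s) · x ⊹ 𝟘 ≟ sq s ⊹ D)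
                          (λ e → trans (solve 1 (λ z → z :+ con 0ℤ := z) refl ((s ⊹ s) · x)) (sym (⊟≡𝟘 (trans (sym (difference s x)) (⊟-self e)))))
                          (λ e → ⊟≡𝟘 (trans (difference s x) (⊟-self (trans (sym e) (solve 1 (λ z → z :+ con 0ℤ := z) refl ((s ⊹ s) · x)))))))
                        (∑-linear (s ⊹ s) 𝟘 (sq s ⊹ D) (double≢𝟘 s≢0))

    -- If -1 were a square, x ↦ - x would preserve the set of nonzero squares, whose cardinality (q - 1) / 2 is odd.
    η-⊟𝟙 : η (⊟ 𝟙) ≡ -1ℤ
    η-⊟𝟙 with quadratic? (⊟ 𝟙)
    ... | nonsquare _ e = e
    ... | isZero ⊟1≡0 _ = contradiction (trans (sym (⊟-involutive 𝟙)) (trans (cong ⊟_ ⊟1≡0) (solve 0 (:- con 0ℤ := con 0ℤ) refl))) 𝟙≢𝟘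
    ... | square i _ ii≡⊟1 η⊟1 = contradiction parity (odd≢even (+ (q / 4)) (∑ᶠ (λ x → ⟨ x Fin.<? ⊟ x ⟩ * isSquare x)))
      where
      open ≡-Reasoning
      isSquare : F → ℤ
      isSquare t with quadratic? t
      ... | isZero _ _ = 0ℤ
      ... | square _ _ _ _ = 1ℤ
      ... | nonsquare _ _ = 0ℤ
      isSquare-η : ∀ t → + 2 * isSquare t + ⟨ t ≟ 𝟘 ⟩ ≡ 1ℤ + η t
      isSquare-η t with quadratic? t
      ... | isZero refl e = trans (cong (_+_ 0ℤ) (⟨⟩-true (𝟘 ≟ 𝟘) refl)) (cong (_+_ 1ℤ) (sym e))
      ... | square c c≢0 refl e = trans (cong (_+_ (+ 2)) (⟨⟩-false (sq c ≟ 𝟘) (sq≢𝟘 c≢0))) (cong (_+_ 1ℤ) (sym e))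
      ... | nonsquare t≢0 e = trans (cong (_+_ 0ℤ) (⟨⟩-false (t ≟ 𝟘) t≢0)) (cong (_+_ 1ℤ) (sym e))
      η-⊟ : ∀ t → η (⊟ t) ≡ η t
      η-⊟ t = trans (cong η (solve 1 (λ t → :- t := :- con 1ℤ :* t) refl t)) (trans (η-* (⊟ 𝟙) t) (trans (cong (_* η t) η⊟1) (*-identityˡ (η t))))
      isSquare-⊟ : ∀ t → isSquare (⊟ t) ≡ isSquare t
      isSquare-⊟ t = *-cancelˡ-≡ (+ 2) _ _ (+-cancelʳ (trans (isSquare-η (⊟ t)) (trans (cong (_+_ 1ℤ) (η-⊟ t)) (trans (sym (isSquare-η t)) (cong (_+_ (+ 2 * isSquare t)) (⟨⟩-cong (t ≟ 𝟘) (⊟ t ≟ 𝟘) (λ { refl → solve 0 (:- con 0ℤ := con 0ℤ) refl }) λ e → trans (sym (⊟-involutive t)) (trans (cong ⊟_ e) (solve 0 (:- con 0ℤ := con 0ℤ) refl))))))))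
        where
        +-cancelʳ : ∀ {a b c} → a + c ≡ b + c → a ≡ b
        +-cancelʳ {a} {b} {c} e = trans (shift a c) (trans (cong (_- c) e) (sym (shift b c)))
          where
          shift : ∀ a c → a ≡ a + c - c
          shift = solve-∀
      isSquare-𝟘 : isSquare 𝟘 ≡ 0ℤ
      isSquare-𝟘 with quadratic? 𝟘
      ... | isZero _ _ = refl
      ... | square c c≢0 e _ = contradiction e (sq≢𝟘 c≢0)
      ... | nonsquare _ _ = refl
      ⟨⊟≟⟩-isSquare : ∀ t → ⟨ ⊟ t ≟ t ⟩ * isSquare t ≡ 0ℤ
      ⟨⊟≟⟩-isSquare t = go (t ≟ 𝟘)
        where
        go : Dec (t ≡ 𝟘) → ⟨ ⊟ t ≟ t ⟩ * isSquare t ≡ 0ℤ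
        go (yes refl) = trans (cong (⟨ ⊟ 𝟘 ≟ 𝟘 ⟩ *_) isSquare-𝟘) (*-zeroʳ ⟨ ⊟ 𝟘 ≟ 𝟘 ⟩)
        go (no t≢0) = cong (_* isSquare t) (⟨⟩-false (⊟ t ≟ t) (⊟≢self t≢0))
      L = ∑ᶠ (λ x → ⟨ x Fin.<? ⊟ x ⟩ * isSquare x)
      even : ∑ᶠ isSquare ≡ + 2 * L
      even = trans (∑ᶠ-involution ⊟_ ⊟-involutive isSquare isSquare-⊟) (trans (cong (_+ + 2 * L) (trans (∑-cong Fs ⟨⊟≟⟩-isSquare) (∑-0 Fs))) (+-identityˡ _))
      doubled : + 2 * ∑ᶠ isSquare + 1ℤ ≡ + q
      doubled = begin
        + 2 * ∑ᶠ isSquare + 1ℤ                              ≡⟨ cong₂ _+_ (∑-*ˡ Fs (+ 2) isSquare) (∑ᶠ-unique (_≟ 𝟘) 𝟘 refl λ _ e → e) ⟨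
        ∑ᶠ (λ t → + 2 * isSquare t) + ∑ᶠ (λ t → ⟨ t ≟ 𝟘 ⟩)  ≡⟨ ∑-+ Fs _ _ ⟨
        ∑ᶠ (λ t → + 2 * isSquare t + ⟨ t ≟ 𝟘 ⟩)             ≡⟨ ∑-cong Fs isSquare-η ⟩
        ∑ᶠ (λ t → 1ℤ + η t)                                 ≡⟨ trans (∑-+ Fs _ _) (cong₂ _+_ (∑ᶠ-1 q) ∑-η) ⟩
        + q + 0ℤ                                            ≡⟨ +-identityʳ (+ q) ⟩
        + q                                                 ∎
      parity : + 2 * + (q / 4) + 1ℤ ≡ + 2 * L
      parity = trans (*-cancelˡ-≡ (+ 2) _ _ (begin
        + 2 * (+ 2 * + (q / 4) + 1ℤ)      ≡⟨ arith (+ (q / 4)) ⟩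
        + 3 + + 4 * + (q / 4) - 1ℤ        ≡⟨ cong (_- 1ℤ) (trans (sym q≡3+4[q/4]) (sym doubled)) ⟩
        + 2 * ∑ᶠ isSquare + 1ℤ - 1ℤ       ≡⟨ cancel (∑ᶠ isSquare) ⟩
        + 2 * ∑ᶠ isSquare                 ∎)) even
        where
        arith : ∀ k → + 2 * (+ 2 * k + 1ℤ) ≡ + 3 + + 4 * k - 1ℤ
        arith = solve-∀
        cancel : ∀ a → + 2 * a + 1ℤ - 1ℤ ≡ + 2 * a
        cancel = solve-∀

  -- The odd number 2k + 1, in a form that unfolds two coordinates at a time, as the induction in
  -- `sphere` needs.
  dim : ℕ → ℕ
  dim zero = 1
  dim (suc k) = suc (suc (dim k))

  ^-dim : ∀ a k → a ^ dim k ≡ a * (a ^ k * a ^ k)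
  ^-dim a zero = refl
  ^-dim a (suc k) = trans (cong (λ z → a * (a * z)) (^-dim a k)) (arith a (a ^ k))
    where
    arith : ∀ a b → a * (a * (a * (b * b))) ≡ a * (a * b * (a * b))
    arith = solve-∀

  -- The sign (-1)ᵏ. Since η(-1) = -1 it is also η((-1)ᵏ), so `σ k * η t` is η((-1)ᵏ t).
  σ : ℕ → ℤ
  σ zero = 1ℤ
  σ (suc k) = - σ k

  σ-cases : ∀ k → σ k ≡ 1ℤ ⊎ σ k ≡ -1ℤ
  σ-cases zero = inj₁ refl
  σ-cases (suc k) with σ-cases k
  ... | inj₁ e = inj₂ (cong -_ e)
  ... | inj₂ e = inj₁ (cong -_ e)

  -- Point counts of spheres and bisecting hyperplanes.

  module Spheres {q : ℕ} (K : FieldOnFin q) (q%4≡3 : q % 4 ≡ 3) where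

    open Field K q%4≡3
    open IntegerCoefficients commutativeRing using (solve; _:=_; _:+_; _:*_; _:-_; :-_; con)

    Q : ℤ
    Q = + q

    vecs : ∀ n → List (Vec F n)
    vecs zero = [] ∷ []
    vecs (suc n) = cartesianProductWith _∷_ Fs (vecs n)

    ∑ᵛ : ∀ n → (Vec F n → ℤ) → ℤ
    ∑ᵛ n = ∑ (vecs n)

    ∑ᵛ-suc : ∀ n (f : Vec F (suc n) → ℤ) → ∑ᵛ (suc n) f ≡ ∑ᶠ (λ x → ∑ᵛ n (λ v → f (x ∷ v)))
    ∑ᵛ-suc n f = ∑-cartesianProductWith _∷_ Fs (vecs n) f

    ∑ᵛ-suc′ : ∀ n (f : Vec F (suc n) → ℤ) → ∑ᵛ (suc n) f ≡ ∑ᵛ n (λ v → ∑ᶠ (λ x → f (x ∷ v)))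
    ∑ᵛ-suc′ n f = trans (∑ᵛ-suc n f) (∑-swap Fs (vecs n) _)

    ∑ᵛ-1 : ∀ n → ∑ᵛ n (λ _ → 1ℤ) ≡ Q ^ n
    ∑ᵛ-1 zero = refl
    ∑ᵛ-1 (suc n) = trans (∑ᵛ-suc n _) (trans (∑ᶠ-const q (∑ᵛ n (λ _ → 1ℤ))) (cong (Q *_) (∑ᵛ-1 n)))

    ‖_‖ : ∀ {n} → Vec F n → F
    ‖ [] ‖ = 𝟘
    ‖ x ∷ v ‖ = sq x ⊹ ‖ v ‖

    infixl 6 _⊟ᵛ_
    _⊟ᵛ_ : ∀ {n} → Vec F n → Vec F n → Vec F n
    _⊟ᵛ_ = zipWith _⊟_

    ∑ᵛ-translate : ∀ {n} (y : Vec F n) f → ∑ᵛ n (λ z → f (z ⊟ᵛ y)) ≡ ∑ᵛ n f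
    ∑ᵛ-translate [] f = refl
    ∑ᵛ-translate {suc n} (a ∷ y) f = begin
      ∑ᵛ (suc n) (λ z → f (z ⊟ᵛ (a ∷ y)))                  ≡⟨ ∑ᵛ-suc n _ ⟩
      ∑ᶠ (λ x → ∑ᵛ n (λ z → f (x ⊟ a ∷ (z ⊟ᵛ y))))         ≡⟨ (∑-cong Fs λ x → ∑ᵛ-translate y (λ z → f (x ⊟ a ∷ z))) ⟩
      ∑ᶠ (λ x → ∑ᵛ n (λ z → f (x ⊟ a ∷ z)))                ≡⟨ ∑-translate (⊟ a) (λ x → ∑ᵛ n (λ z → f (x ∷ z))) ⟩
      ∑ᶠ (λ x → ∑ᵛ n (λ z → f (x ∷ z)))                    ≡⟨ ∑ᵛ-suc n f ⟨
      ∑ᵛ (suc n) f                                         ∎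
      where open ≡-Reasoning

    0≤q : 0ℤ ≤ Q
    0≤q = +≤+ ℕ.z≤n

    q≢0 : Q ≢ 0ℤ
    q≢0 e = contradiction (trans (sym q%4≡3) (cong (_% 4) (+-injective e))) λ ()

    instance
      q-nonZero : ℤ.NonZero Q
      q-nonZero = ≢-nonZero q≢0

    q^-nonneg : ∀ n → 0ℤ ≤ Q ^ n
    q^-nonneg zero = 0≤1
    q^-nonneg (suc n) = *-nonneg 0≤q (q^-nonneg n)

    -- With D = r - w, the equation y² = -(x² - D) has 1 - η(x² - D) solutions y, because η(-1) =
    -- -1; the sum over x is `∑-η-sq⊟`. Thus x² + y² = D has q + 1 solutions for D ≠ 0 and only the
    -- origin for D = 0.
    circle : ∀ w r → ∑ᶠ (λ x → ∑ᶠ (λ y → ⟨ sq x ⊹ (sq y ⊹ w) ≟ r ⟩)) ≡ Q + 1ℤ - Q * ⟨ w ≟ r ⟩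
    circle w r = begin
      ∑ᶠ (λ x → ∑ᶠ (λ y → ⟨ sq x ⊹ (sq y ⊹ w) ≟ r ⟩))
        ≡⟨ (∑-cong Fs λ x → trans (∑-cong Fs λ y → move x y) (add-sub _)) ⟩
      ∑ᶠ (λ x → 1ℤ + η (⊟ 𝟙 · (sq x ⊟ D)))
        ≡⟨ (∑-cong Fs λ x → cong (_+_ 1ℤ) (trans (η-* (⊟ 𝟙) _) (cong (_* η (sq x ⊟ D)) η-⊟𝟙))) ⟩
      ∑ᶠ (λ x → 1ℤ + -1ℤ * η (sq x ⊟ D))
        ≡⟨ trans (∑-+ Fs _ _) (cong₂ _+_ (∑ᶠ-1 q) (trans (∑-*ˡ Fs -1ℤ _) (cong (-1ℤ *_) (∑-η-sq⊟ D)))) ⟩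
      Q + -1ℤ * (Q * ⟨ D ≟ 𝟘 ⟩ - 1ℤ)
        ≡⟨ arith (Q) ⟨ D ≟ 𝟘 ⟩ ⟩
      Q + 1ℤ - Q * ⟨ D ≟ 𝟘 ⟩
        ≡⟨ cong (λ i → Q + 1ℤ - Q * i) (⟨⟩-cong (D ≟ 𝟘) (w ≟ r) (sym ∘ ⊟≡𝟘) (⊟-self ∘ sym)) ⟩
      Q + 1ℤ - Q * ⟨ w ≟ r ⟩ ∎
      where
      open ≡-Reasoning
      D = r ⊟ w
      arith : ∀ a i → a + -1ℤ * (a * i - 1ℤ) ≡ a + 1ℤ - a * i
      arith = solve-∀
      add-sub : ∀ a → a ≡ 1ℤ + (a - 1ℤ)
      add-sub = solve-∀
      difference : ∀ x y → sq y ⊟ ⊟ 𝟙 · (sq x ⊟ D) ≡ sq x ⊹ (sq y ⊹ w) ⊟ r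
      difference x y = solve 4 (λ x y r w → y :- :- con 1ℤ :* (x :- (r :- w)) := x :+ (y :+ w) :- r) refl (sq x) (sq y) r w
      move : ∀ x y → ⟨ sq x ⊹ (sq y ⊹ w) ≟ r ⟩ ≡ ⟨ sq y ≟ ⊟ 𝟙 · (sq x ⊟ D) ⟩
      move x y = ⟨⟩-cong (sq x ⊹ (sq y ⊹ w) ≟ r) (sq y ≟ ⊟ 𝟙 · (sq x ⊟ D))
        (λ e → ⊟≡𝟘 (trans (difference x y) (⊟-self e))) (λ e → ⊟≡𝟘 (trans (sym (difference x y)) (⊟-self e)))

    -- By `circle`, a vector v in dimension `dim k` extends by two coordinates to a point of the
    -- sphere in q + 1 ways, or in one way if ‖v‖ = r already. The count for k is therefore
    -- subtracted, which turns σ k into - σ k.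
    sphere : ∀ k r → ∑ᵛ (dim k) (λ z → ⟨ ‖ z ‖ ≟ r ⟩) ≡ Q ^ k * Q ^ k + σ k * Q ^ k * η r
    sphere zero r = begin
      ∑ᵛ 1 (λ z → ⟨ ‖ z ‖ ≟ r ⟩)           ≡⟨ ∑ᵛ-suc 0 _ ⟩
      ∑ᶠ (λ x → ⟨ sq x ⊹ 𝟘 ≟ r ⟩ + 0ℤ)     ≡⟨ (∑-cong Fs λ x → trans (+-identityʳ _) (cong (λ z → ⟨ z ≟ r ⟩) (solve 1 (λ x → x :+ con 0ℤ := x) refl (sq x)))) ⟩
      ∑ᶠ (λ x → ⟨ sq x ≟ r ⟩)              ≡⟨ arith _ ⟩
      1ℤ * 1ℤ + 1ℤ * 1ℤ * η r              ∎
      where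
      open ≡-Reasoning
      arith : ∀ a → a ≡ 1ℤ * 1ℤ + 1ℤ * 1ℤ * (a - 1ℤ)
      arith = solve-∀
    sphere (suc k) r = begin
      ∑ᵛ (dim (suc k)) (λ z → ⟨ ‖ z ‖ ≟ r ⟩)
        ≡⟨ trans (∑ᵛ-suc′ (suc (dim k)) _) (∑ᵛ-suc′ (dim k) _) ⟩
      ∑ᵛ (dim k) (λ v → ∑ᶠ (λ y → ∑ᶠ (λ x → ⟨ sq x ⊹ (sq y ⊹ ‖ v ‖) ≟ r ⟩)))
        ≡⟨ (∑-cong (vecs (dim k)) λ v → trans (∑-swap Fs Fs _) (circle ‖ v ‖ r)) ⟩
      ∑ᵛ (dim k) (λ v → Q + 1ℤ - Q * ⟨ ‖ v ‖ ≟ r ⟩)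
        ≡⟨ trans (∑-- (vecs (dim k)) _ _) (cong₂ _-_ (trans (∑-const (vecs (dim k)) (Q + 1ℤ)) (cong (_* (Q + 1ℤ)) (trans (∑ᵛ-1 (dim k)) (^-dim Q k))))
             (trans (∑-*ˡ (vecs (dim k)) (Q) _) (cong (Q *_) (sphere k r)))) ⟩
      Q * (U * U) * (Q + 1ℤ) - Q * (U * U + σ k * U * η r)
        ≡⟨ arith (Q) U (σ k) (η r) ⟩
      Q * U * (Q * U) + - σ k * (Q * U) * η r ∎
      where
      open ≡-Reasoning
      U = Q ^ k
      arith : ∀ a u s e → a * (u * u) * (a + 1ℤ) - a * (u * u + s * u * e) ≡ a * u * (a * u) + - s * (a * u) * e
      arith = solve-∀

    sphere-at : ∀ k c r → ∑ᵛ (dim k) (λ z → ⟨ ‖ z ⊟ᵛ c ‖ ≟ r ⟩) ≡ Q ^ k * Q ^ k + σ k * Q ^ k * η r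
    sphere-at k c r = trans (∑ᵛ-translate c (λ z → ⟨ ‖ z ‖ ≟ r ⟩)) (sphere k r)

    -- The squares of the coordinates of z cancel, which leaves an affine equation. Its coefficient
    -- is nonzero at the first coordinate where y and y′ differ, because 2 ≠ 0, and that coordinate
    -- is determined by the others. The factor `Q` avoids the exponent n - 1.
    bisector : ∀ {n} (y y′ : Vec F n) e → y ≢ y′ → Q * ∑ᵛ n (λ z → ⟨ ‖ z ⊟ᵛ y ‖ ≟ ‖ z ⊟ᵛ y′ ‖ ⊹ e ⟩) ≡ Q ^ n
    bisector [] [] e ≢ = contradiction refl ≢
    bisector {suc n} (a ∷ y) (a′ ∷ y′) e y≢y′ with a ≟ a′
    ... | yes refl = cong (Q *_) (begin
      ∑ᵛ (suc n) (λ z → ⟨ ‖ z ⊟ᵛ (a ∷ y) ‖ ≟ ‖ z ⊟ᵛ (a ∷ y′) ‖ ⊹ e ⟩)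
        ≡⟨ ∑ᵛ-suc n _ ⟩
      ∑ᶠ (λ x → ∑ᵛ n (λ z → ⟨ sq (x ⊟ a) ⊹ ‖ z ⊟ᵛ y ‖ ≟ sq (x ⊟ a) ⊹ ‖ z ⊟ᵛ y′ ‖ ⊹ e ⟩))
        ≡⟨ (∑-cong Fs λ x → ∑-cong (vecs n) λ z → cancel (sq (x ⊟ a)) ‖ z ⊟ᵛ y ‖ ‖ z ⊟ᵛ y′ ‖) ⟩
      ∑ᶠ {q} (λ _ → ∑ᵛ n (λ z → ⟨ ‖ z ⊟ᵛ y ‖ ≟ ‖ z ⊟ᵛ y′ ‖ ⊹ e ⟩))
        ≡⟨ ∑ᶠ-const q _ ⟩
      Q * ∑ᵛ n (λ z → ⟨ ‖ z ⊟ᵛ y ‖ ≟ ‖ z ⊟ᵛ y′ ‖ ⊹ e ⟩)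
        ≡⟨ bisector y y′ e (y≢y′ ∘ cong (a ∷_)) ⟩
      Q ^ n ∎)
      where
      open ≡-Reasoning
      cancel : ∀ s A B → ⟨ s ⊹ A ≟ s ⊹ B ⊹ e ⟩ ≡ ⟨ A ≟ B ⊹ e ⟩
      cancel s A B = ⟨⟩-cong (s ⊹ A ≟ s ⊹ B ⊹ e) (A ≟ B ⊹ e)
        (λ p → ⊟≡𝟘 (trans (solve 4 (λ s A B e → A :- (B :+ e) := s :+ A :- (s :+ B :+ e)) refl s A B e) (⊟-self p)))
        (λ p → ⊟≡𝟘 (trans (solve 4 (λ s A B e → s :+ A :- (s :+ B :+ e) := A :- (B :+ e)) refl s A B e) (⊟-self p)))
    ... | no a≢a′ = cong (Q *_) (begin
      ∑ᵛ (suc n) (λ z → ⟨ ‖ z ⊟ᵛ (a ∷ y) ‖ ≟ ‖ z ⊟ᵛ (a′ ∷ y′) ‖ ⊹ e ⟩)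
        ≡⟨ ∑ᵛ-suc′ n _ ⟩
      ∑ᵛ n (λ z → ∑ᶠ (λ x → ⟨ sq (x ⊟ a) ⊹ ‖ z ⊟ᵛ y ‖ ≟ sq (x ⊟ a′) ⊹ ‖ z ⊟ᵛ y′ ‖ ⊹ e ⟩))
        ≡⟨ (∑-cong (vecs n) λ z → trans (∑-cong Fs λ x → linear x ‖ z ⊟ᵛ y ‖ ‖ z ⊟ᵛ y′ ‖)
              (∑-linear κ (sq a ⊟ sq a′) (‖ z ⊟ᵛ y′ ‖ ⊹ e ⊟ ‖ z ⊟ᵛ y ‖) (double≢𝟘 (a≢a′ ∘ sym ∘ ⊟≡𝟘)))) ⟩
      ∑ᵛ n (λ z → 1ℤ)
        ≡⟨ ∑ᵛ-1 n ⟩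
      Q ^ n ∎)
      where
      open ≡-Reasoning
      κ = (a′ ⊟ a) ⊹ (a′ ⊟ a)
      difference : ∀ x A B → κ · x ⊹ (sq a ⊟ sq a′) ⊟ (B ⊹ e ⊟ A) ≡ sq (x ⊟ a) ⊹ A ⊟ (sq (x ⊟ a′) ⊹ B ⊹ e)
      difference x A B = solve 6 (λ x a a′ A B e →
        (a′ :- a :+ (a′ :- a)) :* x :+ (a :* a :- a′ :* a′) :- (B :+ e :- A) := (x :- a) :* (x :- a) :+ A :- ((x :- a′) :* (x :- a′) :+ B :+ e)) refl x a a′ A B e
      linear : ∀ x A B → ⟨ sq (x ⊟ a) ⊹ A ≟ sq (x ⊟ a′) ⊹ B ⊹ e ⟩ ≡ ⟨ κ · x ⊹ (sq a ⊟ sq a′) ≟ B ⊹ e ⊟ A ⟩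
      linear x A B = ⟨⟩-cong (sq (x ⊟ a) ⊹ A ≟ sq (x ⊟ a′) ⊹ B ⊹ e) (κ · x ⊹ (sq a ⊟ sq a′) ≟ B ⊹ e ⊟ A)
        (λ p → ⊟≡𝟘 (trans (difference x A B) (⊟-self p))) (λ p → ⊟≡𝟘 (trans (sym (difference x A B)) (⊟-self p)))

    -- With μ the inverse of 1 + ν, the new centre is the barycentre of y and y′ with weights 1 and
    -- ν. Hence every member of the pencil except ν = -1 is again a sphere.
    complete-square : ∀ {n} ν μ → μ · (𝟙 ⊹ ν) ≡ 𝟙 → (z y y′ : Vec F n) →
      ‖ z ⊟ᵛ y ‖ ⊹ ν · ‖ z ⊟ᵛ y′ ‖ ≡ (𝟙 ⊹ ν) · ‖ z ⊟ᵛ zipWith (λ a b → μ · (a ⊹ ν · b)) y y′ ‖ ⊹ μ · ν · ‖ y ⊟ᵛ y′ ‖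
    complete-square ν μ μκ≡1 [] [] [] = solve 2 (λ ν μ → con 0ℤ :+ ν :* con 0ℤ := (con 1ℤ :+ ν) :* con 0ℤ :+ μ :* ν :* con 0ℤ) refl ν μ
    complete-square ν μ μκ≡1 (z ∷ zs) (y ∷ ys) (y′ ∷ ys′) = begin
      sq (z ⊟ y) ⊹ A ⊹ ν · (sq (z ⊟ y′) ⊹ B)
        ≡⟨ solve 5 (λ a A ν b B → a :+ A :+ ν :* (b :+ B) := a :+ ν :* b :+ (A :+ ν :* B)) refl (sq (z ⊟ y)) A ν (sq (z ⊟ y′)) B ⟩
      sq (z ⊟ y) ⊹ ν · sq (z ⊟ y′) ⊹ (A ⊹ ν · B)
        ≡⟨ cong₂ _⊹_ coordinate (complete-square ν μ μκ≡1 zs ys ys′) ⟩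
      (𝟙 ⊹ ν) · sq (z ⊟ c) ⊹ μ · ν · sq (y ⊟ y′) ⊹ ((𝟙 ⊹ ν) · C ⊹ μ · ν · E)
        ≡⟨ solve 6 (λ κ a ρ b C E → κ :* a :+ ρ :* b :+ (κ :* C :+ ρ :* E) := κ :* (a :+ C) :+ ρ :* (b :+ E)) refl (𝟙 ⊹ ν) (sq (z ⊟ c)) (μ · ν) (sq (y ⊟ y′)) C E ⟩
      (𝟙 ⊹ ν) · (sq (z ⊟ c) ⊹ C) ⊹ μ · ν · (sq (y ⊟ y′) ⊹ E) ∎
      where
      open ≡-Reasoning
      c = μ · (y ⊹ ν · y′)
      A = ‖ zs ⊟ᵛ ys ‖
      B = ‖ zs ⊟ᵛ ys′ ‖
      C = ‖ zs ⊟ᵛ zipWith (λ a b → μ · (a ⊹ ν · b)) ys ys′ ‖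
      E = ‖ ys ⊟ᵛ ys′ ‖
      s = y ⊹ ν · y′
      coordinate : sq (z ⊟ y) ⊹ ν · sq (z ⊟ y′) ≡ (𝟙 ⊹ ν) · sq (z ⊟ c) ⊹ μ · ν · sq (y ⊟ y′)
      coordinate = begin
        sq (z ⊟ y) ⊹ ν · sq (z ⊟ y′)
          -- The identity holds only modulo μ (1 + ν) = 1, which the solver cannot use. The explicit
          -- cofactor `rest` of μ (1 + ν) - 1 makes it an identity of polynomials; that multiple is
          -- then removed by `μκ≡1`.
          ≡⟨ solve 5 (λ z y y′ ν μ → (z :- y) :* (z :- y) :+ ν :* ((z :- y′) :* (z :- y′)) :=
               (con 1ℤ :+ ν) :* ((z :- μ :* (y :+ ν :* y′)) :* (z :- μ :* (y :+ ν :* y′))) :+ μ :* ν :* ((y :- y′) :* (y :- y′))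
               :- (μ :* (con 1ℤ :+ ν) :- con 1ℤ) :* (μ :* ((y :+ ν :* y′) :* (y :+ ν :* y′)) :+ y :* y :+ ν :* (y′ :* y′) :- (z :+ z) :* (y :+ ν :* y′))) refl z y y′ ν μ ⟩
        (𝟙 ⊹ ν) · sq (z ⊟ c) ⊹ μ · ν · sq (y ⊟ y′) ⊟ (μ · (𝟙 ⊹ ν) ⊟ 𝟙) · rest
          ≡⟨ cong (λ m → (𝟙 ⊹ ν) · sq (z ⊟ c) ⊹ μ · ν · sq (y ⊟ y′) ⊟ m · rest) (⊟-self μκ≡1) ⟩
        (𝟙 ⊹ ν) · sq (z ⊟ c) ⊹ μ · ν · sq (y ⊟ y′) ⊟ 𝟘 · rest
          ≡⟨ solve 2 (λ x r → x :- con 0ℤ :* r := x) refl _ rest ⟩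
        (𝟙 ⊹ ν) · sq (z ⊟ c) ⊹ μ · ν · sq (y ⊟ y′) ∎
        where
        rest = μ · sq s ⊹ sq y ⊹ ν · sq y′ ⊟ (z ⊹ z) · s

    -- The term `⟨ p₂ ≟ 𝟘 ⟩` is the member at ν = ∞. A nonzero pair selects one point of the
    -- projective line; the zero pair is annihilated by all q + 1.
    pencil : ∀ p₁ p₂ → ∑ᶠ (λ ν → ⟨ p₁ ⊹ ν · p₂ ≟ 𝟘 ⟩) + ⟨ p₂ ≟ 𝟘 ⟩ ≡ 1ℤ + Q * (⟨ p₁ ≟ 𝟘 ⟩ * ⟨ p₂ ≟ 𝟘 ⟩)
    pencil p₁ p₂ with p₂ ≟ 𝟘
    ... | yes refl = trans (cong (_+ 1ℤ) (trans (∑-cong Fs λ ν → cong (λ z → ⟨ z ≟ 𝟘 ⟩) (solve 2 (λ p ν → p :+ ν :* con 0ℤ := p) refl p₁ ν)) (∑ᶠ-const q ⟨ p₁ ≟ 𝟘 ⟩))) (arith (Q) ⟨ p₁ ≟ 𝟘 ⟩)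
      where
      arith : ∀ a i → a * i + 1ℤ ≡ 1ℤ + a * (i * 1ℤ)
      arith = solve-∀
    ... | no p₂≢0 = trans (cong (_+ 0ℤ) (trans (∑-cong Fs λ ν → cong (λ z → ⟨ z ≟ 𝟘 ⟩) (solve 3 (λ p ν r → p :+ ν :* r := r :* ν :+ p) refl p₁ ν p₂)) (∑-linear p₂ p₁ 𝟘 p₂≢0))) (arith (Q) ⟨ p₁ ≟ 𝟘 ⟩)
      where
      arith : ∀ a i → 1ℤ + 0ℤ ≡ 1ℤ + a * (i * 0ℤ)
      arith = solve-∀

  -- Intersection of two spheres through their pencil.

  module Intersections {q : ℕ} (K : FieldOnFin q) (q%4≡3 : q % 4 ≡ 3) where

    open Field K q%4≡3
    open Spheres K q%4≡3
    open IntegerCoefficients commutativeRing using (solve; _:=_; _:+_; _:*_; _:-_; :-_; con)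

    -- (1 + ν)² times the radius of the sphere at ν in the pencil, where w is the squared distance
    -- of the centres. The square factor is invisible to η and clears the denominators; the result
    -- is a polynomial in ν with leading coefficient t′.
    quad : (t t′ w ν : F) → F
    quad t t′ w ν = (𝟙 ⊹ ν) · (t ⊹ ν · t′) ⊟ ν · w

    -- Multiplication by 4 t′ completes the square: 4 t′ `quad` is (2 t′ ν + b)² - D with D the
    -- discriminant. The sum is then evaluated by `∑-η-sq⊟`, and q [D = 0] is dropped.
    ∑-η-quad : ∀ t t′ w → t′ ≢ 𝟘 → -1ℤ ≤ η t′ * ∑ᶠ (λ ν → η (quad t t′ w ν))
    ∑-η-quad t t′ w t′≢0 = ≤-trans (bound (*-nonneg 0≤q (⟨⟩-nonneg (D ≟ 𝟘)))) (≤-reflexive (sym (begin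
      η t′ * ∑ᶠ (λ ν → η (quad t t′ w ν))        ≡⟨ ∑-*ˡ Fs (η t′) _ ⟨
      ∑ᶠ (λ ν → η t′ * η (quad t t′ w ν))        ≡⟨ ∑-cong Fs pointwise ⟩
      ∑ᶠ (λ ν → η (sq (κ · ν ⊹ b) ⊟ D))          ≡⟨ ∑-affine κ b (double≢𝟘 t′≢0) (λ x → η (sq x ⊟ D)) ⟩
      ∑ᶠ (λ x → η (sq x ⊟ D))                    ≡⟨ ∑-η-sq⊟ D ⟩
      Q * ⟨ D ≟ 𝟘 ⟩ - 1ℤ                         ∎)))
      where
      open ≡-Reasoning
      κ = t′ ⊹ t′
      b = t ⊹ t′ ⊟ w
      D = sq b ⊟ sq (𝟙 ⊹ 𝟙) · (t · t′)
      bound : ∀ {a} → 0ℤ ≤ a → -1ℤ ≤ a - 1ℤ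
      bound 0≤a = +-monoˡ-≤ -1ℤ 0≤a
      pointwise : ∀ ν → η t′ * η (quad t t′ w ν) ≡ η (sq (κ · ν ⊹ b) ⊟ D)
      pointwise ν = begin
        η t′ * η (quad t t′ w ν)                   ≡⟨ η-* t′ (quad t t′ w ν) ⟨
        η (t′ · quad t t′ w ν)                     ≡⟨ η-sq-* (𝟙 ⊹ 𝟙) (t′ · quad t t′ w ν) 𝟚≢𝟘 ⟨
        η (sq (𝟙 ⊹ 𝟙) · (t′ · quad t t′ w ν))      ≡⟨ cong η (solve 4 (λ t t′ w ν →
          (con 1ℤ :+ con 1ℤ) :* (con 1ℤ :+ con 1ℤ) :* (t′ :* ((con 1ℤ :+ ν) :* (t :+ ν :* t′) :- ν :* w)) :=
          ((t′ :+ t′) :* ν :+ (t :+ t′ :- w)) :* ((t′ :+ t′) :* ν :+ (t :+ t′ :- w))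
            :- ((t :+ t′ :- w) :* (t :+ t′ :- w) :- (con 1ℤ :+ con 1ℤ) :* (con 1ℤ :+ con 1ℤ) :* (t :* t′))) refl t t′ w ν) ⟩
        η (sq (κ · ν ⊹ b) ⊟ D)                     ∎

    η-abs : ∀ {s} → s ≡ 1ℤ ⊎ s ≡ -1ℤ → ∀ t → - (s * η t) ≤ 1ℤ
    η-abs (inj₁ refl) t with quadratic? t
    ... | isZero _ e = ≤-trans (≤-reflexive (cong (λ x → - (1ℤ * x)) e)) 0≤1
    ... | square _ _ _ e = ≤-trans (≤-reflexive (cong (λ x → - (1ℤ * x)) e)) -≤+
    ... | nonsquare _ e = ≤-reflexive (cong (λ x → - (1ℤ * x)) e)
    η-abs (inj₂ refl) t = ≤-trans (≤-reflexive (negate (η t))) (η≤1 t)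
      where
      negate : ∀ a → - (-1ℤ * a) ≡ a
      negate = solve-∀

    module _ (k : ℕ) (y y′ : Vec F (dim k)) (y≢y′ : y ≢ y′) (t t′ : F) where

      private
        U = Q ^ k
        w = ‖ y ⊟ᵛ y′ ‖
        p p′ : Vec F (dim k) → F
        p z = ‖ z ⊟ᵛ y ‖ ⊟ t
        p′ z = ‖ z ⊟ᵛ y′ ‖ ⊟ t′

      -- At ν = -1 the member is a hyperplane with exactly `U * U` points, whereas `quad` takes the
      -- value w there; the bracket removes that spurious η w, so one formula serves all finite ν.
      pencil-member : ∀ ν → ∑ᵛ (dim k) (λ z → ⟨ p z ⊹ ν · p′ z ≟ 𝟘 ⟩) ≡ U * U + σ k * U * (η (quad t t′ w ν) - ⟨ ν ≟ ⊟ 𝟙 ⟩ * η w)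
      pencil-member ν with ν ≟ ⊟ 𝟙
      ... | yes refl = *-cancelˡ-≡ Q _ _ (begin
        Q * ∑ᵛ (dim k) (λ z → ⟨ p z ⊹ ⊟ 𝟙 · p′ z ≟ 𝟘 ⟩)
          ≡⟨ cong (Q *_) (∑-cong (vecs (dim k)) λ z → ⟨⟩-cong (p z ⊹ ⊟ 𝟙 · p′ z ≟ 𝟘) (‖ z ⊟ᵛ y ‖ ≟ ‖ z ⊟ᵛ y′ ‖ ⊹ (t ⊟ t′))
               (λ e → ⊟≡𝟘 (trans (sym (difference ‖ z ⊟ᵛ y ‖ ‖ z ⊟ᵛ y′ ‖)) e)) (λ e → trans (difference ‖ z ⊟ᵛ y ‖ ‖ z ⊟ᵛ y′ ‖) (⊟-self e))) ⟩
        Q * ∑ᵛ (dim k) (λ z → ⟨ ‖ z ⊟ᵛ y ‖ ≟ ‖ z ⊟ᵛ y′ ‖ ⊹ (t ⊟ t′) ⟩)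
          ≡⟨ trans (bisector y y′ (t ⊟ t′) y≢y′) (^-dim Q k) ⟩
        Q * (U * U)
          ≡⟨ cong (Q *_) (sym (trans (cong (λ e → U * U + σ k * U * (e - 1ℤ * η w)) (cong η at-⊟𝟙)) (arith U (σ k) (η w)))) ⟩
        Q * (U * U + σ k * U * (η (quad t t′ w (⊟ 𝟙)) - 1ℤ * η w)) ∎)
        where
        open ≡-Reasoning
        difference : ∀ A B → A ⊟ t ⊹ ⊟ 𝟙 · (B ⊟ t′) ≡ A ⊟ (B ⊹ (t ⊟ t′))
        difference A B = solve 4 (λ A B t t′ → A :- t :+ :- con 1ℤ :* (B :- t′) := A :- (B :+ (t :- t′))) refl A B t t′
        at-⊟𝟙 : quad t t′ w (⊟ 𝟙) ≡ w
        at-⊟𝟙 = solve 3 (λ t t′ w → (con 1ℤ :+ :- con 1ℤ) :* (t :+ :- con 1ℤ :* t′) :- :- con 1ℤ :* w := w) refl t t′ w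
        arith : ∀ u s e → u * u + s * u * (e - 1ℤ * e) ≡ u * u
        arith = solve-∀
      ... | no ν≢⊟𝟙 with inverse (𝟙 ⊹ ν) (λ e → ν≢⊟𝟙 (trans (solve 1 (λ ν → ν := :- con 1ℤ :+ (con 1ℤ :+ ν)) refl ν) (trans (cong (⊟ 𝟙 ⊹_) e) (solve 0 (:- con 1ℤ :+ con 0ℤ := :- con 1ℤ) refl))))
      ... | μ , μκ≡1 = begin
        ∑ᵛ (dim k) (λ z → ⟨ p z ⊹ ν · p′ z ≟ 𝟘 ⟩)   ≡⟨ ∑-cong (vecs (dim k)) member ⟩
        ∑ᵛ (dim k) (λ z → ⟨ ‖ z ⊟ᵛ c ‖ ≟ ρ ⟩)       ≡⟨ sphere-at k c ρ ⟩
        U * U + σ k * U * η ρ                       ≡⟨ cong (λ e → U * U + σ k * U * e) (trans (sym (η-sq-* κ ρ κ≢0)) (trans (cong η scaled) (minus-zero (η (quad t t′ w ν)) (η w)))) ⟩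
        U * U + σ k * U * (η (quad t t′ w ν) - 0ℤ * η w) ∎
        where
        open ≡-Reasoning
        κ = 𝟙 ⊹ ν
        c = zipWith (λ a b → μ · (a ⊹ ν · b)) y y′
        ρ = μ · (t ⊹ ν · t′ ⊟ μ · ν · w)
        minus-zero : ∀ a b → a ≡ a - 0ℤ * b
        minus-zero = solve-∀
        κ≢0 : κ ≢ 𝟘
        κ≢0 e = 𝟙≢𝟘 (trans (sym μκ≡1) (trans (cong (μ ·_) e) (·-zeroʳ μ)))
        κμ≡1 : κ · μ ≡ 𝟙
        κμ≡1 = trans (solve 2 (λ a b → a :* b := b :* a) refl κ μ) μκ≡1
        scaled : sq κ · ρ ≡ quad t t′ w ν
        scaled = begin
          sq κ · ρ                                                           ≡⟨ solve 5 (λ κ μ s ν w → κ :* κ :* (μ :* (s :- μ :* ν :* w)) := μ :* κ :* (κ :* s :- μ :* κ :* (ν :* w))) refl κ μ (t ⊹ ν · t′) ν w ⟩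
          μ · κ · (κ · (t ⊹ ν · t′) ⊟ μ · κ · (ν · w))                       ≡⟨ cong (λ m → m · (κ · (t ⊹ ν · t′) ⊟ m · (ν · w))) μκ≡1 ⟩
          𝟙 · (κ · (t ⊹ ν · t′) ⊟ 𝟙 · (ν · w))                               ≡⟨ solve 2 (λ a b → con 1ℤ :* (a :- con 1ℤ :* b) := a :- b) refl (κ · (t ⊹ ν · t′)) (ν · w) ⟩
          κ · (t ⊹ ν · t′) ⊟ ν · w                                           ∎
        factor : ∀ z → p z ⊹ ν · p′ z ≡ κ · (‖ z ⊟ᵛ c ‖ ⊟ ρ)
        factor z = begin
          p z ⊹ ν · p′ z
            ≡⟨ solve 5 (λ A B ν t t′ → A :- t :+ ν :* (B :- t′) := A :+ ν :* B :- (t :+ ν :* t′)) refl (‖ z ⊟ᵛ y ‖) (‖ z ⊟ᵛ y′ ‖) ν t t′ ⟩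
          ‖ z ⊟ᵛ y ‖ ⊹ ν · ‖ z ⊟ᵛ y′ ‖ ⊟ (t ⊹ ν · t′)
            ≡⟨ cong (_⊟ (t ⊹ ν · t′)) (complete-square ν μ μκ≡1 z y y′) ⟩
          κ · ‖ z ⊟ᵛ c ‖ ⊹ μ · ν · w ⊟ (t ⊹ ν · t′)
            ≡⟨ solve 4 (λ κ C e s → κ :* C :+ e :- s := κ :* C :- con 1ℤ :* (s :- e)) refl κ ‖ z ⊟ᵛ c ‖ (μ · ν · w) (t ⊹ ν · t′) ⟩
          κ · ‖ z ⊟ᵛ c ‖ ⊟ 𝟙 · (t ⊹ ν · t′ ⊟ μ · ν · w)
            ≡⟨ cong (λ m → κ · ‖ z ⊟ᵛ c ‖ ⊟ m · (t ⊹ ν · t′ ⊟ μ · ν · w)) (sym κμ≡1) ⟩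
          κ · ‖ z ⊟ᵛ c ‖ ⊟ κ · μ · (t ⊹ ν · t′ ⊟ μ · ν · w)
            ≡⟨ solve 4 (λ κ C μ e → κ :* C :- κ :* μ :* e := κ :* (C :- μ :* e)) refl κ ‖ z ⊟ᵛ c ‖ μ (t ⊹ ν · t′ ⊟ μ · ν · w) ⟩
          κ · (‖ z ⊟ᵛ c ‖ ⊟ ρ) ∎
        member : ∀ z → ⟨ p z ⊹ ν · p′ z ≟ 𝟘 ⟩ ≡ ⟨ ‖ z ⊟ᵛ c ‖ ≟ ρ ⟩
        member z = ⟨⟩-cong (p z ⊹ ν · p′ z ≟ 𝟘) (‖ z ⊟ᵛ c ‖ ≟ ρ)
          (λ e → ⊟≡𝟘 (·-cancelˡ κ≢0 (trans (sym (factor z)) (trans e (sym (·-zeroʳ κ))))))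
          (λ e → trans (factor z) (trans (cong (κ ·_) (⊟-self e)) (·-zeroʳ κ)))

      -- Every point lies on exactly one quadric of the pencil p + ν p′, ν ∈ P¹, except that the points of the intersection lie on all q + 1.
      intersection : σ k * η t′ ≡ -1ℤ → Q * ∑ᵛ (dim k) (λ z → ⟨ ‖ z ⊟ᵛ y ‖ ≟ t ⟩ * ⟨ ‖ z ⊟ᵛ y′ ‖ ≟ t′ ⟩) ≤ U * U + U
      intersection good = ≤-trans (≤-reflexive (isolate (Q * J) Q U (σ k) (η t′) H (η w) good double-count))
        (+-monoʳ-≤ (U * U) (≤-trans (*-monoˡ (q^-nonneg k) bracket) (≤-reflexive (*-identityʳ U))))
        where
        V = vecs (dim k)
        J = ∑ᵛ (dim k) (λ z → ⟨ ‖ z ⊟ᵛ y ‖ ≟ t ⟩ * ⟨ ‖ z ⊟ᵛ y′ ‖ ≟ t′ ⟩)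
        H = ∑ᶠ (λ ν → η (quad t t′ w ν))
        on : ∀ A r → ⟨ A ⊟ r ≟ 𝟘 ⟩ ≡ ⟨ A ≟ r ⟩
        on A r = ⟨⟩-cong (A ⊟ r ≟ 𝟘) (A ≟ r) ⊟≡𝟘 ⊟-self
        members : ∑ᵛ (dim k) (λ z → ∑ᶠ (λ ν → ⟨ p z ⊹ ν · p′ z ≟ 𝟘 ⟩)) ≡ Q * (U * U) + σ k * U * (H - η w)
        members = begin
          ∑ᵛ (dim k) (λ z → ∑ᶠ (λ ν → ⟨ p z ⊹ ν · p′ z ≟ 𝟘 ⟩))                          ≡⟨ ∑-swap V Fs _ ⟩
          ∑ᶠ (λ ν → ∑ᵛ (dim k) (λ z → ⟨ p z ⊹ ν · p′ z ≟ 𝟘 ⟩))                          ≡⟨ ∑-cong Fs pencil-member ⟩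
          ∑ᶠ (λ ν → U * U + σ k * U * (η (quad t t′ w ν) - ⟨ ν ≟ ⊟ 𝟙 ⟩ * η w))          ≡⟨ ∑-+ Fs _ _ ⟩
          ∑ᶠ {q} (λ _ → U * U) + ∑ᶠ (λ ν → σ k * U * (η (quad t t′ w ν) - ⟨ ν ≟ ⊟ 𝟙 ⟩ * η w))
            ≡⟨ cong₂ _+_ (∑ᶠ-const q (U * U)) (trans (∑-*ˡ Fs (σ k * U) _) (cong (σ k * U *_) (trans (∑-- Fs _ _) (cong (_-_ H) (∑ᶠ-δ (⊟ 𝟙) (λ _ → η w)))))) ⟩
          Q * (U * U) + σ k * U * (H - η w) ∎
          where open ≡-Reasoning
        double-count : Q * (U * U) + σ k * U * (H - η w) + (U * U + σ k * U * η t′) ≡ Q * (U * U) + Q * J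
        double-count = begin
          Q * (U * U) + σ k * U * (H - η w) + (U * U + σ k * U * η t′)
            ≡⟨ cong₂ _+_ members (trans (∑-cong V λ z → on ‖ z ⊟ᵛ y′ ‖ t′) (sphere-at k y′ t′)) ⟨
          ∑ᵛ (dim k) (λ z → ∑ᶠ (λ ν → ⟨ p z ⊹ ν · p′ z ≟ 𝟘 ⟩)) + ∑ᵛ (dim k) (λ z → ⟨ p′ z ≟ 𝟘 ⟩)
            ≡⟨ ∑-+ V _ _ ⟨
          ∑ᵛ (dim k) (λ z → ∑ᶠ (λ ν → ⟨ p z ⊹ ν · p′ z ≟ 𝟘 ⟩) + ⟨ p′ z ≟ 𝟘 ⟩)
            ≡⟨ (∑-cong V λ z → trans (pencil (p z) (p′ z)) (cong₂ (λ a b → 1ℤ + Q * (a * b)) (on ‖ z ⊟ᵛ y ‖ t) (on ‖ z ⊟ᵛ y′ ‖ t′))) ⟩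
          ∑ᵛ (dim k) (λ z → 1ℤ + Q * (⟨ ‖ z ⊟ᵛ y ‖ ≟ t ⟩ * ⟨ ‖ z ⊟ᵛ y′ ‖ ≟ t′ ⟩))
            ≡⟨ trans (∑-+ V _ _) (cong₂ _+_ (trans (∑ᵛ-1 (dim k)) (^-dim Q k)) (∑-*ˡ V Q _)) ⟩
          Q * (U * U) + Q * J ∎
          where open ≡-Reasoning
        isolate : ∀ J Q U s e H w → s * e ≡ -1ℤ → Q * (U * U) + s * U * (H - w) + (U * U + s * U * e) ≡ Q * (U * U) + J → J ≡ U * U + U * (s * H - s * w - 1ℤ)
        isolate J Q U s e H w se eq = begin
          J                                                                                  ≡⟨ cancel (Q * (U * U)) J ⟩
          Q * (U * U) + J - Q * (U * U)                                                      ≡⟨ cong (_- Q * (U * U)) eq ⟨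
          Q * (U * U) + s * U * (H - w) + (U * U + s * U * e) - Q * (U * U)                  ≡⟨ regroup (Q * (U * U)) U s e H w ⟩
          U * U + U * (s * H - s * w + s * e)                                                ≡⟨ cong (λ x → U * U + U * (s * H - s * w + x)) se ⟩
          U * U + U * (s * H - s * w - 1ℤ)                                                   ∎
          where
          open ≡-Reasoning
          cancel : ∀ a b → b ≡ a + b - a
          cancel = solve-∀
          regroup : ∀ a U s e H w → a + s * U * (H - w) + (U * U + s * U * e) - a ≡ U * U + U * (s * H - s * w + s * e)
          regroup = solve-∀
        t′≢0 : t′ ≢ 𝟘
        t′≢0 refl = contradiction (trans (sym good) (trans (cong (σ k *_) η-zero) (*-zeroʳ (σ k)))) λ ()
        η-t′ : η t′ ≡ - σ k
        η-t′ with σ-cases k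
        ... | inj₁ e = trans (sym (*-identityˡ (η t′))) (trans (cong (_* η t′) (sym e)) (trans good (cong -_ (sym e))))
        ... | inj₂ e = trans (double-neg (η t′)) (trans (cong (λ s → - (s * η t′)) (sym e)) (trans (cong -_ good) (cong -_ (sym e))))
          where
          double-neg : ∀ a → a ≡ - (-1ℤ * a)
          double-neg = solve-∀
        -- Goodness says η t′ = - σ k, so the lower bound of `∑-η-quad` becomes an upper bound. This
        -- is where the sign of the radius matters.
        sH≤1 : σ k * H ≤ 1ℤ
        sH≤1 = neg-cancel-≤ (≤-trans (∑-η-quad t t′ w t′≢0) (≤-reflexive (trans (cong (_* H) η-t′) (sym (neg-distribˡ-* (σ k) H)))))
        -- The three terms are the sum over finite ν, the correction for the hyperplane, and the
        -- good sphere at ν = ∞, which contributes -1.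
        bracket : σ k * H - σ k * η w - 1ℤ ≤ 1ℤ
        bracket = +-monoˡ-≤ -1ℤ (+-mono-≤ sH≤1 (η-abs (σ-cases k) w))

  -- Second moment of the incidence count.

  module Incidences {q : ℕ} (K : FieldOnFin q) (q%4≡3 : q % 4 ≡ 3) where

    open Field K q%4≡3
    open Spheres K q%4≡3
    open Intersections K q%4≡3

    infix 4 _≟ᵛ_
    _≟ᵛ_ : ∀ {n} (u v : Vec F n) → Dec (u ≡ v)
    _≟ᵛ_ = Vec.≡-dec _≟_

    ∑ᵛ-δ : ∀ {n} (a : Vec F n) (f : Vec F n → ℤ) → ∑ᵛ n (λ v → ⟨ v ≟ᵛ a ⟩ * f v) ≡ f a
    ∑ᵛ-δ [] f = trans (+-identityʳ _) (*-identityˡ (f []))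
    ∑ᵛ-δ {suc n} (a ∷ as) f = begin
      ∑ᵛ (suc n) (λ v → ⟨ v ≟ᵛ a ∷ as ⟩ * f v)                             ≡⟨ ∑ᵛ-suc n _ ⟩
      ∑ᶠ (λ x → ∑ᵛ n (λ v → ⟨ x ∷ v ≟ᵛ a ∷ as ⟩ * f (x ∷ v)))              ≡⟨ (∑-cong Fs λ x → trans (∑-cong (vecs n) λ v → trans (cong (_* f (x ∷ v)) (split x v)) (*-assoc ⟨ x ≟ a ⟩ _ _)) (∑-*ˡ (vecs n) ⟨ x ≟ a ⟩ _)) ⟩
      ∑ᶠ (λ x → ⟨ x ≟ a ⟩ * ∑ᵛ n (λ v → ⟨ v ≟ᵛ as ⟩ * f (x ∷ v)))          ≡⟨ ∑ᶠ-δ a _ ⟩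
      ∑ᵛ n (λ v → ⟨ v ≟ᵛ as ⟩ * f (a ∷ v))                                 ≡⟨ ∑ᵛ-δ as (λ v → f (a ∷ v)) ⟩
      f (a ∷ as)                                                           ∎
      where
      open ≡-Reasoning
      split : ∀ x v → ⟨ x ∷ v ≟ᵛ a ∷ as ⟩ ≡ ⟨ x ≟ a ⟩ * ⟨ v ≟ᵛ as ⟩
      split x v with x ≟ a | v ≟ᵛ as
      ... | yes refl | yes refl = refl
      ... | yes refl | no _ = refl
      ... | no _ | yes _ = refl
      ... | no _ | no _ = refl

    module _ (k : ℕ) where

      Sphere = Vec F (dim k) × F

      allSpheres : List Sphere
      allSpheres = cartesianProductWith _,_ (vecs (dim k)) Fs

      isOn : Vec F (dim k) → Sphere → ℤ
      isOn z (y , t) = ⟨ ‖ z ⊟ᵛ y ‖ ≟ t ⟩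

      isSame : Sphere → Sphere → ℤ
      isSame (y , t) (y′ , t′) = ⟨ y′ ≟ᵛ y ⟩ * ⟨ t′ ≟ t ⟩

    module _ (k : ℕ) (e : Vec F (dim k) → ℤ) (τ : F → ℤ) where

      weight : Sphere k → ℤ
      weight (y , t) = e y * τ t

      incidences : Vec F (dim k) → ℤ
      incidences z = ∑ (allSpheres k) (λ s → weight s * isOn k z s)

      totalWeight : ℤ
      totalWeight = ∑ (allSpheres k) weight

      private
        V = vecs (dim k)

      totalWeight-product : totalWeight ≡ ∑ V e * ∑ᶠ τ
      totalWeight-product = trans (∑-cartesianProductWith _,_ V Fs weight) (sym (∑-*-∑ V Fs e τ))

      incidences-sum : ∀ z → incidences z ≡ ∑ᵛ (dim k) (λ y → e y * τ ‖ z ⊟ᵛ y ‖)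
      incidences-sum z = trans (∑-cartesianProductWith _,_ V Fs _) (∑-cong V λ y → begin
        ∑ᶠ (λ t → e y * τ t * ⟨ ‖ z ⊟ᵛ y ‖ ≟ t ⟩)     ≡⟨ (∑-cong Fs λ t → trans (cong (e y * τ t *_) (⟨⟩-cong (‖ z ⊟ᵛ y ‖ ≟ t) (t ≟ ‖ z ⊟ᵛ y ‖) sym sym)) (*-comm (e y * τ t) _)) ⟩
        ∑ᶠ (λ t → ⟨ t ≟ ‖ z ⊟ᵛ y ‖ ⟩ * (e y * τ t))   ≡⟨ ∑ᶠ-δ ‖ z ⊟ᵛ y ‖ (λ t → e y * τ t) ⟩
        e y * τ ‖ z ⊟ᵛ y ‖                            ∎)
        where open ≡-Reasoning

      ∑-isSame : ∀ s → ∑ (allSpheres k) (λ s′ → isSame k s s′ * weight s′) ≡ weight s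
      ∑-isSame (y , t) = trans (∑-cartesianProductWith _,_ V Fs _) (begin
        ∑ V (λ y′ → ∑ᶠ (λ t′ → ⟨ y′ ≟ᵛ y ⟩ * ⟨ t′ ≟ t ⟩ * (e y′ * τ t′)))
          ≡⟨ (∑-cong V λ y′ → trans (∑-cong Fs λ t′ → *-assoc ⟨ y′ ≟ᵛ y ⟩ ⟨ t′ ≟ t ⟩ _) (trans (∑-*ˡ Fs ⟨ y′ ≟ᵛ y ⟩ _) (cong (⟨ y′ ≟ᵛ y ⟩ *_) (∑ᶠ-δ t (λ t′ → e y′ * τ t′))))) ⟩
        ∑ V (λ y′ → ⟨ y′ ≟ᵛ y ⟩ * (e y′ * τ t))
          ≡⟨ ∑ᵛ-δ y (λ y′ → e y′ * τ t) ⟩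
        e y * τ t ∎)
        where open ≡-Reasoning

    module _ (k : ℕ) (e : Vec F (dim k) → ℤ) (τ : F → ℤ)
      (0≤e : ∀ y → 0ℤ ≤ e y) (e≤1 : ∀ y → e y ≤ 1ℤ) (0≤τ : ∀ t → 0ℤ ≤ τ t) (τ≤1 : ∀ t → τ t ≤ 1ℤ)
      (τ-good : ∀ t → τ t ≡ 0ℤ ⊎ σ k * η t ≡ -1ℤ) where

      private
        U = Q ^ k
        V = vecs (dim k)
        0≤U = q^-nonneg k
        spheres = allSpheres k
        on = isOn k
        same = isSame k
        ω = weight k e τ
        N = incidences k e τ
        S = totalWeight k e τ

      0≤ω : ∀ s → 0ℤ ≤ ω s
      0≤ω (y , t) = *-nonneg (0≤e y) (0≤τ t)

      ω≤1 : ∀ s → ω s ≤ 1ℤ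
      ω≤1 (y , t) = *-mono {b = 1ℤ} {d = 1ℤ} (0≤e y) 0≤1 (e≤1 y) (τ≤1 t)

      sphere-size : ∀ y t → σ k * η t ≡ -1ℤ → ∑ V (λ z → on z (y , t)) ≡ U * U - U
      sphere-size y t good = trans (sphere-at k y t) (trans (swap U (σ k) (η t)) (trans (cong (λ x → U * U + x * U) good) (negate U)))
        where
        swap : ∀ u s e → u * u + s * u * e ≡ u * u + s * e * u
        swap = solve-∀
        negate : ∀ u → u * u + -1ℤ * u ≡ u * u - u
        negate = solve-∀

      ω-sphere-size : ∀ s → ω s * ∑ V (λ z → on z s) ≡ ω s * (U * U - U)
      ω-sphere-size (y , t) with τ-good t
      ... | inj₁ τ≡0 = trans (vanish _) (sym (vanish (U * U - U)))
        where
        vanish : ∀ x → e y * τ t * x ≡ 0ℤ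
        vanish x = trans (cong (λ r → e y * r * x) τ≡0) (cong (_* x) (*-zeroʳ (e y)))
      ... | inj₂ good = cong (e y * τ t *_) (sphere-size y t good)

      -- Distinct centres are the case of `intersection`; concentric spheres of different radius are
      -- disjoint; for equal spheres the size is absorbed by the term with `same`. The factor `ω s′`
      -- discards radii that are not good, and goodness of one of the two spheres is enough.
      intersect : ∀ s s′ → ω s′ * (Q * ∑ V (λ z → on z s * on z s′)) ≤ ω s′ * (U * U + U + Q * (U * U) * same s s′)
      intersect (y , t) (y′ , t′) with τ-good t′
      ... | inj₁ τ≡0 = ≤-reflexive (trans (vanish _) (sym (vanish (U * U + U + Q * (U * U) * same (y , t) (y′ , t′)))))
        where
        vanish : ∀ x → e y′ * τ t′ * x ≡ 0ℤ
        vanish x = trans (cong (λ r → e y′ * r * x) τ≡0) (cong (_* x) (*-zeroʳ (e y′)))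
      ... | inj₂ good = *-monoˡ (0≤ω (y′ , t′)) (cases (y′ ≟ᵛ y) (t′ ≟ t))
        where
        0≤UU+U = +-nonneg (*-nonneg 0≤U 0≤U) 0≤U
        tail : ∀ (y? : Dec (y′ ≡ y)) (t? : Dec (t′ ≡ t)) → 0ℤ ≤ Q * (U * U) * (⟨ y? ⟩ * ⟨ t? ⟩)
        tail y? t? = *-nonneg (*-nonneg 0≤q (*-nonneg 0≤U 0≤U)) (*-nonneg (⟨⟩-nonneg y?) (⟨⟩-nonneg t?))
        cases : (y? : Dec (y′ ≡ y)) (t? : Dec (t′ ≡ t)) → Q * ∑ V (λ z → on z (y , t) * on z (y′ , t′)) ≤ U * U + U + Q * (U * U) * (⟨ y? ⟩ * ⟨ t? ⟩)
        cases y?@(no y′≢y) t? = ≤-trans (intersection k y y′ (y′≢y ∘ sym) t t′ good)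
          (≤-trans (≤-reflexive (sym (+-identityʳ (U * U + U)))) (+-monoʳ-≤ (U * U + U) (tail y? t?)))
        cases y?@(yes refl) t?@(no t′≢t) = ≤-trans (≤-reflexive (trans (cong (Q *_) (trans (∑-cong V disjoint) (∑-0 V))) (*-zeroʳ Q)))
          (+-nonneg 0≤UU+U (tail y? t?))
          where
          disjoint : ∀ z → on z (y , t) * on z (y , t′) ≡ 0ℤ
          disjoint z with ‖ z ⊟ᵛ y ‖ ≟ t | ‖ z ⊟ᵛ y ‖ ≟ t′
          ... | yes e | yes e′ = contradiction (trans (sym e′) e) t′≢t
          ... | yes _ | no _ = refl
          ... | no _ | _ = refl
        cases (yes refl) (yes refl) = ≤-trans (*-monoˡ 0≤q (≤-trans (≤-reflexive (trans (∑-cong V λ z → ⟨⟩-idem (‖ z ⊟ᵛ y ‖ ≟ t)) (sphere-size y t good))) UU-U≤UU))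
          (≤-trans (≤-reflexive (pad Q U)) (+-monoˡ-≤ (Q * (U * U) * 1ℤ) 0≤UU+U))
          where
          UU-U≤UU : U * U - U ≤ U * U
          UU-U≤UU = ≤-trans (+-monoʳ-≤ (U * U) (neg-mono-≤ 0≤U)) (≤-reflexive (+-identityʳ (U * U)))
          pad : ∀ a u → a * (u * u) ≡ 0ℤ + a * (u * u) * 1ℤ
          pad = solve-∀

      -- Every sphere of nonzero weight has exactly `U * U - U` points. Equality is essential, as
      -- this sum enters the second moment with a negative sign.
      ∑-N : ∑ V N ≡ S * (U * U - U)
      ∑-N = begin
        ∑ V (λ z → ∑ spheres (λ s → ω s * on z s))      ≡⟨ ∑-swap V spheres _ ⟩
        ∑ spheres (λ s → ∑ V (λ z → ω s * on z s))      ≡⟨ (∑-cong spheres λ s → trans (∑-*ˡ V (ω s) _) (ω-sphere-size s)) ⟩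
        ∑ spheres (λ s → ω s * (U * U - U))             ≡⟨ ∑-*ʳ spheres ω (U * U - U) ⟩
        S * (U * U - U)                                 ∎
        where open ≡-Reasoning

      -- Expand into pairs of spheres and apply `intersect` to each; on the diagonal, ω² ≤ ω since
      -- the weights lie between 0 and 1.
      ∑-N² : Q * ∑ V (λ z → N z * N z) ≤ S * S * (U * U + U) + Q * (U * U) * S
      ∑-N² = begin
        Q * ∑ V (λ z → N z * N z)
          ≡⟨ cong (Q *_) (trans (∑-cong V λ z → ∑-*-∑ spheres spheres _ _) (trans (∑-swap V spheres _) (∑-cong spheres λ s → ∑-swap V spheres _))) ⟩
        Q * ∑ spheres (λ s → ∑ spheres (λ s′ → ∑ V (λ z → ω s * on z s * (ω s′ * on z s′))))
          ≡⟨ trans (sym (∑-*ˡ spheres Q _)) (∑-cong spheres λ s → trans (sym (∑-*ˡ spheres Q _)) (trans (∑-cong spheres (gather s)) (∑-*ˡ spheres (ω s) _))) ⟩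
        ∑ spheres (λ s → ω s * ∑ spheres (λ s′ → ω s′ * (Q * ∑ V (λ z → on z s * on z s′))))
          ≤⟨ (∑-mono spheres λ s → *-monoˡ (0≤ω s) (∑-mono spheres (intersect s))) ⟩
        ∑ spheres (λ s → ω s * ∑ spheres (λ s′ → ω s′ * (U * U + U + Q * (U * U) * same s s′)))
          ≡⟨ (∑-cong spheres λ s → cong (ω s *_) (inner s)) ⟩
        ∑ spheres (λ s → ω s * (S * (U * U + U) + Q * (U * U) * ω s))
          ≤⟨ (∑-mono spheres λ s → ≤-trans (≤-reflexive (rearrange (ω s) (S * (U * U + U)) (Q * (U * U)))) (+-monoʳ-≤ (ω s * (S * (U * U + U)))
                (*-monoˡ (*-nonneg 0≤q (*-nonneg 0≤U 0≤U)) (≤-trans (*-monoˡ (0≤ω s) (ω≤1 s)) (≤-reflexive (*-identityʳ (ω s))))))) ⟩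
        ∑ spheres (λ s → ω s * (S * (U * U + U)) + Q * (U * U) * ω s)
          ≡⟨ trans (∑-+ spheres _ _) (cong₂ _+_ (trans (∑-*ʳ spheres ω _) (sym (*-assoc S S (U * U + U)))) (∑-*ˡ spheres (Q * (U * U)) ω)) ⟩
        S * S * (U * U + U) + Q * (U * U) * S ∎
        where
        open ≤-Reasoning
        rearrange : ∀ a b c → a * (b + c * a) ≡ a * b + c * (a * a)
        rearrange = solve-∀
        distribute : ∀ q a b x y → q * (a * x * (b * y)) ≡ a * (b * (q * (x * y)))
        distribute = solve-∀
        gather : ∀ s s′ → Q * ∑ V (λ z → ω s * on z s * (ω s′ * on z s′)) ≡ ω s * (ω s′ * (Q * ∑ V (λ z → on z s * on z s′)))
        gather s s′ = trans (sym (∑-*ˡ V Q _)) (trans (∑-cong V λ z → distribute Q (ω s) (ω s′) (on z s) (on z s′))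
          (trans (∑-*ˡ V (ω s) _) (cong (ω s *_) (trans (∑-*ˡ V (ω s′) _) (cong (ω s′ *_) (∑-*ˡ V Q _))))))
        spread : ∀ w a c i → w * (a + c * i) ≡ w * a + c * (i * w)
        spread = solve-∀
        inner : ∀ s → ∑ spheres (λ s′ → ω s′ * (U * U + U + Q * (U * U) * same s s′)) ≡ S * (U * U + U) + Q * (U * U) * ω s
        inner s = trans (∑-cong spheres λ s′ → spread (ω s′) (U * U + U) (Q * (U * U)) (same s s′))
          (trans (∑-+ spheres _ _) (cong₂ _+_ (∑-*ʳ spheres ω _) (trans (∑-*ˡ spheres (Q * (U * U)) _) (cong (Q * (U * U) *_) (∑-isSame k e τ s)))))

      -- The multiples of Q S² U² cancel as 1 - 2 + 1. Of Q S² U there remain one from the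
      -- intersections and two from the mean, which gives the factor 3; the last term is the
      -- diagonal.
      second-moment : ∑ V (λ z → (Q * N z - S) * (Q * N z - S)) ≤ + 3 * (Q * U) * (S * S) + Q * U * (Q * U) * S
      second-moment = begin
        ∑ V (λ z → (Q * N z - S) * (Q * N z - S))
          ≡⟨ (∑-cong V λ z → square-out Q (N z) S) ⟩
        ∑ V (λ z → Q * Q * (N z * N z) - + 2 * Q * S * N z + S * S)
          ≡⟨ trans (∑-+ V _ _) (cong₂ _+_ (trans (∑-- V _ _) (cong₂ _-_ (∑-*ˡ V (Q * Q) _) (trans (∑-*ˡ V (+ 2 * Q * S) N) (cong (+ 2 * Q * S *_) ∑-N))))
               (trans (∑-const V (S * S)) (cong (_* (S * S)) (trans (∑ᵛ-1 (dim k)) (^-dim Q k))))) ⟩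
        Q * Q * ∑ V (λ z → N z * N z) - + 2 * Q * S * (S * (U * U - U)) + Q * (U * U) * (S * S)
          ≡⟨ regroup Q S U (∑ V (λ z → N z * N z)) ⟩
        Q * (Q * ∑ V (λ z → N z * N z)) + (Q * (U * U) * (S * S) - + 2 * Q * S * (S * (U * U - U)))
          ≤⟨ +-monoˡ-≤ (Q * (U * U) * (S * S) - + 2 * Q * S * (S * (U * U - U))) (*-monoˡ 0≤q ∑-N²) ⟩
        Q * (S * S * (U * U + U) + Q * (U * U) * S) + (Q * (U * U) * (S * S) - + 2 * Q * S * (S * (U * U - U)))
          ≡⟨ total Q S U ⟩
        + 3 * (Q * U) * (S * S) + Q * U * (Q * U) * S ∎
        where
        open ≤-Reasoning
        square-out : ∀ q n s → (q * n - s) * (q * n - s) ≡ q * q * (n * n) - + 2 * q * s * n + s * s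
        square-out = solve-∀
        regroup : ∀ q s u n → q * q * n - + 2 * q * s * (s * (u * u - u)) + q * (u * u) * (s * s) ≡ q * (q * n) + (q * (u * u) * (s * s) - + 2 * q * s * (s * (u * u - u)))
        regroup = solve-∀
        total : ∀ q s u → q * (s * s * (u * u + u) + q * (u * u) * s) + (q * (u * u) * (s * s) - + 2 * q * s * (s * (u * u - u))) ≡ + 3 * (q * u) * (s * s) + q * u * (q * u) * s
        total = solve-∀

      -- Cauchy-Schwarz with weight ζ, after which ζ ≤ 1 lets the squared deviation be summed over
      -- the whole space.
      incidence : (ζ : Vec F (dim k) → ℤ) → (∀ z → 0ℤ ≤ ζ z) → (∀ z → ζ z ≤ 1ℤ) →
        let D = Q * ∑ V (λ z → ζ z * N z) - ∑ V ζ * S in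
        D * D ≤ ∑ V ζ * (+ 3 * (Q * U) * (S * S) + Q * U * (Q * U) * S)
      incidence ζ 0≤ζ ζ≤1 = begin
        D * D
          ≡⟨ cong (λ x → x * x) deviation ⟩
        ∑ V (λ z → ζ z * h z) * ∑ V (λ z → ζ z * h z)
          ≤⟨ cauchy-schwarz V ζ h 0≤ζ ⟩
        ∑ V ζ * ∑ V (λ z → ζ z * (h z * h z))
          ≤⟨ *-monoˡ (∑-nonneg V 0≤ζ) (∑-mono V λ z → ≤-trans (*-monoʳ (sq-nonneg (h z)) (ζ≤1 z)) (≤-reflexive (*-identityˡ (h z * h z)))) ⟩
        ∑ V ζ * ∑ V (λ z → h z * h z)
          ≤⟨ *-monoˡ (∑-nonneg V 0≤ζ) second-moment ⟩
        ∑ V ζ * (+ 3 * (Q * U) * (S * S) + Q * U * (Q * U) * S) ∎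
        where
        open ≤-Reasoning
        D = Q * ∑ V (λ z → ζ z * N z) - ∑ V ζ * S
        h : Vec F (dim k) → ℤ
        h z = Q * N z - S
        expand : ∀ q c n s → q * (c * n) - c * s ≡ c * (q * n - s)
        expand = solve-∀
        deviation : D ≡ ∑ V (λ z → ζ z * h z)
        deviation = trans (cong₂ _-_ (sym (∑-*ˡ V Q _)) (sym (∑-*ʳ V ζ S))) (trans (sym (∑-- V _ _)) (∑-cong V λ z → expand Q (ζ z) (N z) S))

  -- Vectors of good norm in a Cartesian power.

  module Weights {q : ℕ} (K : FieldOnFin q) (q%4≡3 : q % 4 ≡ 3) where

    open Field K q%4≡3
    open Spheres K q%4≡3
    open IntegerCoefficients commutativeRing using (solve; _:=_; _:+_; _:*_; _:-_; :-_; con)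

    -- Since 4 (u + s)(u + s′) = (2u + s + s′)² - (s - s′)², this is `∑-η-sq⊟` at D = (s - s′)².
    paley : ∀ s s′ → ∑ᶠ (λ u → η (u ⊹ s) * η (u ⊹ s′)) ≡ Q * ⟨ s ≟ s′ ⟩ - 1ℤ
    paley s s′ = begin
      ∑ᶠ (λ u → η (u ⊹ s) * η (u ⊹ s′))                        ≡⟨ ∑-cong Fs pointwise ⟩
      ∑ᶠ (λ u → η (sq (𝟚 · u ⊹ (s ⊹ s′)) ⊟ sq (s ⊟ s′)))       ≡⟨ ∑-affine 𝟚 (s ⊹ s′) 𝟚≢𝟘 (λ x → η (sq x ⊟ sq (s ⊟ s′))) ⟩
      ∑ᶠ (λ x → η (sq x ⊟ sq (s ⊟ s′)))                        ≡⟨ ∑-η-sq⊟ (sq (s ⊟ s′)) ⟩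
      Q * ⟨ sq (s ⊟ s′) ≟ 𝟘 ⟩ - 1ℤ                             ≡⟨ cong (λ i → Q * i - 1ℤ) (⟨⟩-cong (sq (s ⊟ s′) ≟ 𝟘) (s ≟ s′) zero-diff (λ e → trans (cong sq (⊟-self e)) (·-zeroˡ 𝟘))) ⟩
      Q * ⟨ s ≟ s′ ⟩ - 1ℤ                                      ∎
      where
      open ≡-Reasoning
      𝟚 = 𝟙 ⊹ 𝟙
      zero-diff : sq (s ⊟ s′) ≡ 𝟘 → s ≡ s′
      zero-diff e with s ≟ s′
      ... | yes p = p
      ... | no s≢s′ = contradiction e (sq≢𝟘 (s≢s′ ∘ ⊟≡𝟘))
      pointwise : ∀ u → η (u ⊹ s) * η (u ⊹ s′) ≡ η (sq (𝟚 · u ⊹ (s ⊹ s′)) ⊟ sq (s ⊟ s′))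
      pointwise u = begin
        η (u ⊹ s) * η (u ⊹ s′)                           ≡⟨ η-* (u ⊹ s) (u ⊹ s′) ⟨
        η ((u ⊹ s) · (u ⊹ s′))                           ≡⟨ η-sq-* 𝟚 _ 𝟚≢𝟘 ⟨
        η (sq 𝟚 · ((u ⊹ s) · (u ⊹ s′)))                  ≡⟨ cong η (solve 3 (λ u s s′ →
          (con 1ℤ :+ con 1ℤ) :* (con 1ℤ :+ con 1ℤ) :* ((u :+ s) :* (u :+ s′)) :=
          ((con 1ℤ :+ con 1ℤ) :* u :+ (s :+ s′)) :* ((con 1ℤ :+ con 1ℤ) :* u :+ (s :+ s′)) :- (s :- s′) :* (s :- s′)) refl u s s′) ⟩
        η (sq (𝟚 · u ⊹ (s ⊹ s′)) ⊟ sq (s ⊟ s′))          ∎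

    -- The indicator of Aⁿ if `α` is that of A.
    power : (F → ℤ) → ∀ {n} → Vec F n → ℤ
    power α [] = 1ℤ
    power α (x ∷ v) = α x * power α v

    good : ℕ → F → ℤ
    good k t = ⟨ σ k * η t ℤ.≟ -1ℤ ⟩

    -- Linearises `good`: counting good vectors becomes counting isotropic ones and estimating a sum
    -- of η.
    good-η : ∀ k t → + 2 * good k t ≡ 1ℤ - ⟨ t ≟ 𝟘 ⟩ - σ k * η t
    good-η k t = evaluate (σ-cases k) (quadratic? t)
      where
      Identity : ℤ → ℤ → Set
      Identity x i = + 2 * ⟨ x ℤ.≟ -1ℤ ⟩ ≡ 1ℤ - i - x
      at-0 : ∀ {x i} → x ≡ 0ℤ → i ≡ 1ℤ → Identity x i
      at-0 refl refl = refl
      at-1 : ∀ {x i} → x ≡ 1ℤ → i ≡ 0ℤ → Identity x i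
      at-1 refl refl = refl
      at-−1 : ∀ {x i} → x ≡ -1ℤ → i ≡ 0ℤ → Identity x i
      at-−1 refl refl = refl
      evaluate : σ k ≡ 1ℤ ⊎ σ k ≡ -1ℤ → Quadratic t → Identity (σ k * η t) ⟨ t ≟ 𝟘 ⟩
      evaluate _ (isZero refl e) = at-0 (trans (cong (σ k *_) e) (*-zeroʳ (σ k))) (⟨⟩-true (𝟘 ≟ 𝟘) refl)
      evaluate (inj₁ s) (square c c≢0 refl e) = at-1 (cong₂ _*_ s e) (⟨⟩-false (sq c ≟ 𝟘) (sq≢𝟘 c≢0))
      evaluate (inj₂ s) (square c c≢0 refl e) = at-−1 (cong₂ _*_ s e) (⟨⟩-false (sq c ≟ 𝟘) (sq≢𝟘 c≢0))
      evaluate (inj₁ s) (nonsquare t≢0 e) = at-−1 (cong₂ _*_ s e) (⟨⟩-false (t ≟ 𝟘) t≢0)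
      evaluate (inj₂ s) (nonsquare t≢0 e) = at-1 (cong₂ _*_ s e) (⟨⟩-false (t ≟ 𝟘) t≢0)

    module _ (α : F → ℤ) (0≤α : ∀ x → 0ℤ ≤ α x) (α≤1 : ∀ x → α x ≤ 1ℤ) where

      private
        a = ∑ᶠ α
        powerα : ∀ {n} → Vec F n → ℤ
        powerα = power α

      0≤power : ∀ {n} (v : Vec F n) → 0ℤ ≤ powerα v
      0≤power [] = 0≤1
      0≤power (x ∷ v) = *-nonneg (0≤α x) (0≤power v)

      power≤1 : ∀ {n} (v : Vec F n) → powerα v ≤ 1ℤ
      power≤1 [] = ≤-refl
      power≤1 (x ∷ v) = *-mono {b = 1ℤ} {d = 1ℤ} (0≤α x) 0≤1 (α≤1 x) (power≤1 v)

      ∑-power : ∀ n → ∑ᵛ n powerα ≡ a ^ n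
      ∑-power zero = refl
      ∑-power (suc n) = begin
        ∑ᵛ (suc n) powerα                              ≡⟨ ∑ᵛ-suc n powerα ⟩
        ∑ᶠ (λ x → ∑ᵛ n (λ v → α x * powerα v))         ≡⟨ ∑-*-∑ Fs (vecs n) α powerα ⟨
        a * ∑ᵛ n powerα                                ≡⟨ cong (a *_) (∑-power n) ⟩
        a * a ^ n                                     ∎
        where open ≡-Reasoning

      0≤a : 0ℤ ≤ a
      0≤a = ∑-nonneg Fs 0≤α

      0≤a^ : ∀ n → 0ℤ ≤ a ^ n
      0≤a^ n = ≤-trans (∑-nonneg (vecs n) 0≤power) (≤-reflexive (∑-power n))

      -- Once the other n coordinates are chosen, the square of the first is prescribed, which
      -- leaves at most two values for it.
      power-sphere : ∀ n r → ∑ᵛ (suc n) (λ v → powerα v * ⟨ ‖ v ‖ ≟ r ⟩) ≤ + 2 * a ^ n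
      power-sphere n r = begin
        ∑ᵛ (suc n) (λ v → powerα v * ⟨ ‖ v ‖ ≟ r ⟩)                                     ≡⟨ ∑ᵛ-suc′ n _ ⟩
        ∑ᵛ n (λ v → ∑ᶠ (λ x → α x * powerα v * ⟨ sq x ⊹ ‖ v ‖ ≟ r ⟩))                   ≤⟨ ∑-mono (vecs n) (λ v → ∑-mono Fs (drop v)) ⟩
        ∑ᵛ n (λ v → ∑ᶠ (λ x → powerα v * ⟨ sq x ≟ r ⊟ ‖ v ‖ ⟩))                         ≡⟨ (∑-cong (vecs n) λ v → ∑-*ˡ Fs (powerα v) _) ⟩
        ∑ᵛ n (λ v → powerα v * ∑ᶠ (λ x → ⟨ sq x ≟ r ⊟ ‖ v ‖ ⟩))                         ≤⟨ (∑-mono (vecs n) λ v → *-monoˡ (0≤power v) (two (r ⊟ ‖ v ‖))) ⟩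
        ∑ᵛ n (λ v → powerα v * + 2)                                                     ≡⟨ ∑-*ʳ (vecs n) powerα (+ 2) ⟩
        ∑ᵛ n powerα * + 2                                                               ≡⟨ trans (*-comm (∑ᵛ n powerα) (+ 2)) (cong (+ 2 *_) (∑-power n)) ⟩
        + 2 * a ^ n                                                                    ∎
        where
        open ≤-Reasoning
        two : ∀ t → ∑ᶠ (λ x → ⟨ sq x ≟ t ⟩) ≤ + 2
        two t = ≤-trans (≤-reflexive (add-sub _)) (+-monoˡ-≤ 1ℤ (η≤1 t))
          where
          add-sub : ∀ x → x ≡ x - 1ℤ + 1ℤ
          add-sub = solve-∀
        move : ∀ (v : Vec F n) x → ⟨ sq x ⊹ ‖ v ‖ ≟ r ⟩ ≡ ⟨ sq x ≟ r ⊟ ‖ v ‖ ⟩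
        move v x = ⟨⟩-cong (sq x ⊹ ‖ v ‖ ≟ r) (sq x ≟ r ⊟ ‖ v ‖) (λ e → ⊟≡𝟘 (trans (difference (sq x) ‖ v ‖) (⊟-self e))) (λ e → ⊟≡𝟘 (trans (sym (difference (sq x) ‖ v ‖)) (⊟-self e)))
          where
          difference : ∀ s w → s ⊟ (r ⊟ w) ≡ s ⊹ w ⊟ r
          difference s w = solve 3 (λ s w r → s :- (r :- w) := s :+ w :- r) refl s w r
        drop : ∀ v x → α x * powerα v * ⟨ sq x ⊹ ‖ v ‖ ≟ r ⟩ ≤ powerα v * ⟨ sq x ≟ r ⊟ ‖ v ‖ ⟩
        drop v x = ≤-trans (*-monoʳ (⟨⟩-nonneg (sq x ⊹ ‖ v ‖ ≟ r)) (≤-trans (*-monoʳ (0≤power v) (α≤1 x)) (≤-reflexive (*-identityˡ (powerα v)))))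
          (≤-reflexive (cong (powerα v *_) (move v x)))

      -- Cauchy–Schwarz in the first coordinate, then orthogonality of the translates of η.
      ∑-power-η : ∀ n → let X = ∑ᵛ (suc (suc n)) (λ v → powerα v * η ‖ v ‖) in X * X ≤ + 4 * Q * (a ^ suc n * a ^ suc n)
      ∑-power-η n = begin
        X * X                                                          ≡⟨ cong (λ x → x * x) unfold ⟩
        ∑ᶠ (λ x → α x * T (sq x)) * ∑ᶠ (λ x → α x * T (sq x))          ≤⟨ cauchy-schwarz Fs α (λ x → T (sq x)) 0≤α ⟩
        -- Enlarging the range from A to the whole field gives a complete sum; replacing x² by a
        -- free variable u costs at most the factor 1 + η u ≤ 2.
        a * ∑ᶠ (λ x → α x * (T (sq x) * T (sq x)))                     ≤⟨ *-monoˡ 0≤a (∑-mono Fs λ x → ≤-trans (*-monoʳ (sq-nonneg (T (sq x))) (α≤1 x)) (≤-reflexive (*-identityˡ (T (sq x) * T (sq x))))) ⟩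
        a * ∑ᶠ (λ x → T (sq x) * T (sq x))                             ≡⟨ cong (a *_) (∑-sq (λ u → T u * T u)) ⟩
        a * ∑ᶠ (λ u → (1ℤ + η u) * (T u * T u))                        ≤⟨ *-monoˡ 0≤a (∑-mono Fs λ u → *-monoʳ (sq-nonneg (T u)) (+-monoʳ-≤ 1ℤ (η≤1 u))) ⟩
        a * ∑ᶠ (λ u → + 2 * (T u * T u))                               ≡⟨ cong (a *_) (∑-*ˡ Fs (+ 2) _) ⟩
        a * (+ 2 * ∑ᶠ (λ u → T u * T u))                               ≤⟨ *-monoˡ 0≤a (*-monoˡ {c = + 2} (+≤+ ℕ.z≤n) ∑T²) ⟩
        a * (+ 2 * (a ^ suc n * (Q * (+ 2 * a ^ n))))                  ≡⟨ arith a (a ^ n) Q ⟩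
        + 4 * Q * (a ^ suc n * a ^ suc n)                              ∎
        where
        open ≤-Reasoning
        W = vecs (suc n)
        X = ∑ᵛ (suc (suc n)) (λ v → powerα v * η ‖ v ‖)
        T : F → ℤ
        T u = ∑ W (λ v → powerα v * η (u ⊹ ‖ v ‖))
        unfold : X ≡ ∑ᶠ (λ x → α x * T (sq x))
        unfold = trans (∑ᵛ-suc (suc n) _) (∑-cong Fs λ x → trans (∑-cong W λ v → *-assoc (α x) (powerα v) _) (∑-*ˡ W (α x) _))
        arith : ∀ a b q → a * (+ 2 * (a * b * (q * (+ 2 * b)))) ≡ + 4 * q * (a * b * (a * b))
        arith = solve-∀
        interchange : ∀ w x w′ x′ → w * x * (w′ * x′) ≡ w * (w′ * (x * x′))
        interchange = solve-∀
        orthogonal : ∑ᶠ (λ u → T u * T u) ≡ ∑ W (λ v → powerα v * ∑ W (λ v′ → powerα v′ * (Q * ⟨ ‖ v ‖ ≟ ‖ v′ ‖ ⟩ - 1ℤ)))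
        orthogonal = trans (∑-cong Fs λ u → trans (∑-*-∑ W W _ _) (∑-cong W λ v → ∑-cong W λ v′ → interchange (powerα v) (η (u ⊹ ‖ v ‖)) (powerα v′) (η (u ⊹ ‖ v′ ‖))))
          (trans (∑-swap Fs W _) (∑-cong W λ v → trans (∑-swap Fs W _) (trans (∑-cong W λ v′ →
            trans (∑-*ˡ Fs (powerα v) _) (cong (powerα v *_) (trans (∑-*ˡ Fs (powerα v′) _) (cong (powerα v′ *_) (paley ‖ v ‖ ‖ v′ ‖))))) (∑-*ˡ W (powerα v) _))))
        bound : ∀ v v′ → powerα v′ * (Q * ⟨ ‖ v ‖ ≟ ‖ v′ ‖ ⟩ - 1ℤ) ≤ Q * (powerα v′ * ⟨ ‖ v′ ‖ ≟ ‖ v ‖ ⟩)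
        bound v v′ = ≤-trans (*-monoˡ (0≤power v′) (i≤j⇒i-k≤j 1ℤ ≤-refl))
          (≤-reflexive (trans (cong (λ i → powerα v′ * (Q * i)) (⟨⟩-cong (‖ v ‖ ≟ ‖ v′ ‖) (‖ v′ ‖ ≟ ‖ v ‖) sym sym)) (pull (powerα v′) Q ⟨ ‖ v′ ‖ ≟ ‖ v ‖ ⟩)))
          where
          pull : ∀ w q i → w * (q * i) ≡ q * (w * i)
          pull = solve-∀
        ∑T² : ∑ᶠ (λ u → T u * T u) ≤ a ^ suc n * (Q * (+ 2 * a ^ n))
        ∑T² = begin
          ∑ᶠ (λ u → T u * T u)                                                                          ≡⟨ orthogonal ⟩
          ∑ W (λ v → powerα v * ∑ W (λ v′ → powerα v′ * (Q * ⟨ ‖ v ‖ ≟ ‖ v′ ‖ ⟩ - 1ℤ)))                    ≤⟨ (∑-mono W λ v → *-monoˡ (0≤power v) (∑-mono W (bound v))) ⟩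
          ∑ W (λ v → powerα v * ∑ W (λ v′ → Q * (powerα v′ * ⟨ ‖ v′ ‖ ≟ ‖ v ‖ ⟩)))                         ≤⟨ (∑-mono W λ v → *-monoˡ (0≤power v) (≤-trans (≤-reflexive (∑-*ˡ W Q _)) (*-monoˡ 0≤q (power-sphere n ‖ v ‖)))) ⟩
          ∑ W (λ v → powerα v * (Q * (+ 2 * a ^ n)))                                                     ≡⟨ trans (∑-*ʳ W powerα _) (cong (_* (Q * (+ 2 * a ^ n))) (∑-power (suc n))) ⟩
          a ^ suc n * (Q * (+ 2 * a ^ n))                                                               ∎

      -- By `good-η`, 2G = A - Z - s X, and Z and s X are each at most A / 4. For Z this needs a ≥ 4
      -- · 2, for s X it needs a² ≥ 16 · 4 q by `∑-power-η`; the constant 64 serves both.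
      many-good : ∀ k → + 64 * Q ≤ a * a → a ^ dim (suc k) ≤ + 4 * ∑ᵛ (dim (suc k)) (λ v → powerα v * good (suc k) ‖ v ‖)
      many-good k 64q≤aa = *-cancelˡ-≤-pos A (+ 4 * G) (+ 2) (begin
        + 2 * A                                              ≡⟨ arith₁ A ⟩
        + 4 * A - A - A                                      ≤⟨ +-mono-≤ (+-monoʳ-≤ (+ 4 * A) (neg-mono-≤ 4Z≤A)) (neg-mono-≤ 4sX≤A) ⟩
        + 4 * A - + 4 * Z - + 4 * (s * X)                    ≡⟨ arith₂ A Z (s * X) ⟩
        + 4 * (A - Z - s * X)                                ≡⟨ cong (+ 4 *_) 2G ⟨
        + 4 * (+ 2 * G)                                      ≡⟨ arith₃ G ⟩
        + 2 * (+ 4 * G)                                      ∎)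
        where
        open ≤-Reasoning
        n = dim k
        W = vecs (suc (suc n))
        s = σ (suc k)
        A = a ^ suc (suc n)
        G = ∑ W (λ v → powerα v * good (suc k) ‖ v ‖)
        X = ∑ W (λ v → powerα v * η ‖ v ‖)
        Z = ∑ W (λ v → powerα v * ⟨ ‖ v ‖ ≟ 𝟘 ⟩)
        arith₁ : ∀ x → + 2 * x ≡ + 4 * x - x - x
        arith₁ = solve-∀
        arith₂ : ∀ x y z → + 4 * x - + 4 * y - + 4 * z ≡ + 4 * (x - y - z)
        arith₂ = solve-∀
        arith₃ : ∀ x → + 4 * (+ 2 * x) ≡ + 2 * (+ 4 * x)
        arith₃ = solve-∀
        distribute : ∀ w i s e → w * (1ℤ - i - s * e) ≡ w - w * i - s * (w * e)
        distribute = solve-∀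
        pull : ∀ w x → + 2 * (w * x) ≡ w * (+ 2 * x)
        pull = solve-∀
        2G : + 2 * G ≡ A - Z - s * X
        2G = trans (sym (∑-*ˡ W (+ 2) _)) (trans (∑-cong W λ v → trans (pull (powerα v) (good (suc k) ‖ v ‖)) (trans (cong (powerα v *_) (good-η (suc k) ‖ v ‖)) (distribute (powerα v) ⟨ ‖ v ‖ ≟ 𝟘 ⟩ s (η ‖ v ‖))))
          (trans (∑-- W _ _) (cong₂ _-_ (trans (∑-- W _ _) (cong (_- Z) (∑-power (suc (suc n))))) (∑-*ˡ W s _))))
        ss≡1 : s * s ≡ 1ℤ
        ss≡1 with σ-cases (suc k)
        ... | inj₁ e = cong₂ _*_ e e
        ... | inj₂ e = cong₂ _*_ e e
        1≤q : 1ℤ ≤ Q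
        1≤q = i<j⇒suc[i]≤j (≤∧≢⇒< 0≤q (q≢0 ∘ sym))
        8≤a : + 8 ≤ a
        8≤a = sq-cancel-≤ 0≤a (≤-trans (*-monoˡ {c = + 64} (+≤+ ℕ.z≤n) 1≤q) 64q≤aa)
        4Z≤A : + 4 * Z ≤ A
        4Z≤A = begin
          + 4 * Z                        ≤⟨ *-monoˡ {c = + 4} (+≤+ ℕ.z≤n) (power-sphere (suc n) 𝟘) ⟩
          + 4 * (+ 2 * a ^ suc n)        ≡⟨ arith (a ^ suc n) ⟩
          + 8 * a ^ suc n                ≤⟨ *-monoʳ (0≤a^ (suc n)) 8≤a ⟩
          A                              ∎
          where
          arith : ∀ x → + 4 * (+ 2 * x) ≡ + 8 * x
          arith = solve-∀
        4sX≤A : + 4 * (s * X) ≤ A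
        4sX≤A = sq-cancel-≤ (0≤a^ (suc (suc n))) (begin
          + 4 * (s * X) * (+ 4 * (s * X))                        ≡⟨ arith s X ⟩
          s * s * (+ 16 * (X * X))                               ≡⟨ trans (cong (_* (+ 16 * (X * X))) ss≡1) (*-identityˡ (+ 16 * (X * X))) ⟩
          + 16 * (X * X)                                         ≤⟨ *-monoˡ {c = + 16} (+≤+ ℕ.z≤n) (∑-power-η n) ⟩
          + 16 * (+ 4 * Q * (a ^ suc n * a ^ suc n))             ≡⟨ arith′ Q (a ^ suc n) ⟩
          + 64 * Q * (a ^ suc n * a ^ suc n)                     ≤⟨ *-monoʳ (*-nonneg (0≤a^ (suc n)) (0≤a^ (suc n))) 64q≤aa ⟩
          a * a * (a ^ suc n * a ^ suc n)                        ≡⟨ arith″ a (a ^ suc n) ⟩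
          A * A                                                  ∎)
          where
          arith : ∀ s x → + 4 * (s * x) * (+ 4 * (s * x)) ≡ s * s * (+ 16 * (x * x))
          arith = solve-∀
          arith′ : ∀ q b → + 16 * (+ 4 * q * (b * b)) ≡ + 64 * q * (b * b)
          arith′ = solve-∀
          arith″ : ∀ a b → a * a * (b * b) ≡ a * b * (a * b)
          arith″ = solve-∀

  -- 49 W² ≤ 35 W² for W = q e².
  deviation-contradiction : ∀ Q U a e Z τ G M → 0ℤ < Q → 0ℤ < e → 0ℤ ≤ U → 0ℤ ≤ Z → 0ℤ ≤ τ →
    G * e ≤ M → e ≤ + 4 * G →
    (Q * M - Z * (e * τ)) * (Q * M - Z * (e * τ)) ≤ Z * (+ 3 * (Q * U) * (e * τ * (e * τ)) + Q * U * (Q * U) * (e * τ)) →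
    Z ≤ Q * U → Z ≤ e * a → + 32 * (τ * U) ≤ e → ¬ a * U ≤ e
  deviation-contradiction Q U a e Z τ G M 0<Q 0<e 0≤U 0≤Z 0≤τ Ge≤M e≤4G deviation Z≤QU Z≤ea small aU≤e =
    contradiction (≤-<-trans 49WW≤35WW 35WW<49WW) (<-irrefl refl)
    where
    0≤Q = <⇒≤ 0<Q
    0≤e = <⇒≤ 0<e
    W = Q * (e * e)
    S = e * τ
    Y = Q * M - Z * S
    0≤S = *-nonneg 0≤e 0≤τ
    0≤QU = *-nonneg 0≤Q 0≤U
    *-pos : ∀ {x y} → 0ℤ < x → 0ℤ < y → 0ℤ < x * y
    *-pos {x} {y} 0<x 0<y = ≤-<-trans (≤-reflexive (sym (*-zeroʳ x))) (*-monoˡ-<-pos x {{positive 0<x}} 0<y)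
    0<W : 0ℤ < W
    0<W = *-pos 0<Q (*-pos 0<e 0<e)
    0≤W = <⇒≤ 0<W
    0≤WW = *-nonneg 0≤W 0≤W
    0≤7W : 0ℤ ≤ + 7 * W
    0≤7W = *-nonneg {+ 7} (+≤+ ℕ.z≤n) 0≤W
    open ≤-Reasoning
    QUS≤W : + 32 * (Q * U * S) ≤ W
    QUS≤W = begin
      + 32 * (Q * U * S)             ≡⟨ arith Q U e τ ⟩
      Q * (e * (+ 32 * (τ * U)))     ≤⟨ *-monoˡ 0≤Q (*-monoˡ 0≤e small) ⟩
      W                              ∎
      where
      arith : ∀ q u e t → + 32 * (q * u * (e * t)) ≡ q * (e * (+ 32 * (t * u)))
      arith = solve-∀
    ZS≤W : + 32 * (Z * S) ≤ W
    ZS≤W = ≤-trans (*-monoˡ {c = + 32} (+≤+ ℕ.z≤n) (*-monoʳ 0≤S Z≤QU)) QUS≤W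
    -- The second entry of the minimum is used only here; `aU≤e` is |A|² ≥ q raised to the power (d
    -- - 1)/2 and multiplied by |A|.
    ZQU≤W : Z * (Q * U) ≤ W
    ZQU≤W = begin
      Z * (Q * U)                    ≤⟨ *-monoʳ 0≤QU Z≤ea ⟩
      e * a * (Q * U)                ≡⟨ arith e a Q U ⟩
      Q * (e * (a * U))              ≤⟨ *-monoˡ 0≤Q (*-monoˡ 0≤e aU≤e) ⟩
      W                              ∎
      where
      arith : ∀ e a q u → e * a * (q * u) ≡ q * (e * (a * u))
      arith = solve-∀
    -- A quarter of all pairs (x, y) have x of good norm, so Q M is at least 8 W / 32, while the
    -- expected part Z S is at most W / 32.
    7W≤32Y : + 7 * W ≤ + 32 * Y
    7W≤32Y = begin
      + 7 * W                                        ≡⟨ arith₁ Q e ⟩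
      + 8 * Q * (e * e) - W                          ≤⟨ +-mono-≤ (*-monoˡ (*-nonneg {+ 8} (+≤+ ℕ.z≤n) 0≤Q) (*-monoʳ 0≤e e≤4G)) (neg-mono-≤ ZS≤W) ⟩
      + 8 * Q * (+ 4 * G * e) - + 32 * (Z * S)       ≡⟨ arith₂ Q G e (+ 32 * (Z * S)) ⟩
      + 32 * (Q * (G * e)) - + 32 * (Z * S)          ≤⟨ +-monoˡ-≤ (- (+ 32 * (Z * S))) (*-monoˡ {c = + 32} (+≤+ ℕ.z≤n) (*-monoˡ 0≤Q Ge≤M)) ⟩
      + 32 * (Q * M) - + 32 * (Z * S)                ≡⟨ arith₃ (Q * M) (Z * S) ⟩
      + 32 * Y                                       ∎
      where
      arith₁ : ∀ q e → + 7 * (q * (e * e)) ≡ + 8 * q * (e * e) - q * (e * e)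
      arith₁ = solve-∀
      arith₂ : ∀ q g e z → + 8 * q * (+ 4 * g * e) - z ≡ + 32 * (q * (g * e)) - z
      arith₂ = solve-∀
      arith₃ : ∀ x y → + 32 * x - + 32 * y ≡ + 32 * (x - y)
      arith₃ = solve-∀
    first : + 1024 * (Z * (Q * U * (S * S))) ≤ W * W
    first = begin
      + 1024 * (Z * (Q * U * (S * S)))               ≤⟨ *-monoˡ {c = + 1024} (+≤+ ℕ.z≤n) (*-monoʳ (*-nonneg 0≤QU (sq-nonneg S)) Z≤QU) ⟩
      + 1024 * (Q * U * (Q * U * (S * S)))           ≡⟨ arith (Q * U) S ⟩
      + 32 * (Q * U * S) * (+ 32 * (Q * U * S))      ≤⟨ *-mono (*-nonneg {+ 32} (+≤+ ℕ.z≤n) (*-nonneg 0≤QU 0≤S)) 0≤W QUS≤W QUS≤W ⟩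
      W * W                                          ∎
      where
      arith : ∀ x s → + 1024 * (x * (x * (s * s))) ≡ + 32 * (x * s) * (+ 32 * (x * s))
      arith = solve-∀
    second : + 1024 * (Z * (Q * U * (Q * U) * S)) ≤ + 32 * (W * W)
    second = begin
      + 1024 * (Z * (Q * U * (Q * U) * S))           ≡⟨ arith (Q * U) S Z ⟩
      + 32 * (Z * (Q * U) * (+ 32 * (Q * U * S)))    ≤⟨ *-monoˡ {c = + 32} (+≤+ ℕ.z≤n) (*-mono (*-nonneg 0≤Z 0≤QU) 0≤W ZQU≤W QUS≤W) ⟩
      + 32 * (W * W)                                 ∎
      where
      arith : ∀ x s z → + 1024 * (z * (x * x * s)) ≡ + 32 * (z * x * (+ 32 * (x * s)))
      arith = solve-∀
    -- With K in place of 32 the two coefficients are (K/4 - 1)² and K + 3; the constant only has to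
    -- make the former larger.
    49WW≤35WW : + 49 * (W * W) ≤ + 35 * (W * W)
    49WW≤35WW = begin
      + 49 * (W * W)                                 ≡⟨ arith₁ W ⟩
      + 7 * W * (+ 7 * W)                            ≤⟨ *-mono 0≤7W (≤-trans 0≤7W 7W≤32Y) 7W≤32Y 7W≤32Y ⟩
      + 32 * Y * (+ 32 * Y)                          ≡⟨ arith₂ Y ⟩
      + 1024 * (Y * Y)                               ≤⟨ *-monoˡ {c = + 1024} (+≤+ ℕ.z≤n) deviation ⟩
      + 1024 * (Z * (+ 3 * (Q * U) * (S * S) + Q * U * (Q * U) * S))
        ≡⟨ arith₃ Z (Q * U) S ⟩
      + 3 * (+ 1024 * (Z * (Q * U * (S * S)))) + + 1024 * (Z * (Q * U * (Q * U) * S))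
        ≤⟨ +-mono-≤ (*-monoˡ {c = + 3} (+≤+ ℕ.z≤n) first) second ⟩
      + 3 * (W * W) + + 32 * (W * W)                 ≡⟨ *-distribʳ-+ (W * W) (+ 3) (+ 32) ⟨
      + 35 * (W * W)                                 ∎
      where
      arith₁ : ∀ w → + 49 * (w * w) ≡ + 7 * w * (+ 7 * w)
      arith₁ = solve-∀
      arith₂ : ∀ y → + 32 * y * (+ 32 * y) ≡ + 1024 * (y * y)
      arith₂ = solve-∀
      arith₃ : ∀ z x s → + 1024 * (z * (+ 3 * x * (s * s) + x * x * s)) ≡ + 3 * (+ 1024 * (z * (x * (s * s)))) + + 1024 * (z * (x * x * s))
      arith₃ = solve-∀
    35WW<49WW : + 35 * (W * W) < + 49 * (W * W)
    35WW<49WW = *-monoʳ-<-pos (W * W) {{positive (*-pos 0<W 0<W)}} (+<+ (ℕ.m≤m+n 36 13))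

  -- Incidences coming from the sumset, and the contradiction.

  module Sumsets {q : ℕ} (K : FieldOnFin q) (q%4≡3 : q % 4 ≡ 3) where

    open Field K q%4≡3
    open Spheres K q%4≡3
    open Incidences K q%4≡3
    open Weights K q%4≡3
    open IntegerCoefficients commutativeRing using (solve; _:=_; _:+_; _:-_)

    module _ (α ζ θ : F → ℤ)
      (0≤α : ∀ x → 0ℤ ≤ α x) (α≤1 : ∀ x → α x ≤ 1ℤ) (α-idem : ∀ x → α x * α x ≡ α x)
      (0≤ζ : ∀ x → 0ℤ ≤ ζ x) (ζ≤1 : ∀ x → ζ x ≤ 1ℤ)
      (0≤θ : ∀ x → 0ℤ ≤ θ x) (θ≤1 : ∀ x → θ x ≤ 1ℤ)
      (sumset : ∀ x y → α x * α y ≤ ζ (x ⊹ y)) where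

      private
        a = ∑ᶠ α
        powerα : ∀ {n} → Vec F n → ℤ
        powerα = power α
        powerζ : ∀ {n} → Vec F n → ℤ
        powerζ = power ζ

      powerα-idem : ∀ {n} (v : Vec F n) → powerα v * powerα v ≡ powerα v
      powerα-idem [] = refl
      powerα-idem (x ∷ v) = trans (interchange (α x) (powerα v)) (cong₂ _*_ (α-idem x) (powerα-idem v))
        where
        interchange : ∀ a b → a * b * (a * b) ≡ a * a * (b * b)
        interchange = solve-∀

      power-sumset : ∀ {n} (z y : Vec F n) → powerα (z ⊟ᵛ y) * powerα y ≤ powerζ z
      power-sumset [] [] = ≤-refl
      power-sumset (z ∷ zs) (y ∷ ys) = begin
        α (z ⊟ y) * powerα (zs ⊟ᵛ ys) * (α y * powerα ys)        ≡⟨ interchange (α (z ⊟ y)) (powerα (zs ⊟ᵛ ys)) (α y) (powerα ys) ⟩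
        α (z ⊟ y) * α y * (powerα (zs ⊟ᵛ ys) * powerα ys)        ≤⟨ *-mono (*-nonneg (0≤α _) (0≤α y)) (0≤power ζ 0≤ζ ζ≤1 zs) (sumset (z ⊟ y) y) (power-sumset zs ys) ⟩
        ζ (z ⊟ y ⊹ y) * powerζ zs                                ≡⟨ cong (λ x → ζ x * powerζ zs) (solve 2 (λ z y → z :- y :+ y := z) refl z y) ⟩
        ζ z * powerζ zs                                          ∎
        where
        open ≤-Reasoning
        interchange : ∀ a b c d → a * b * (c * d) ≡ a * c * (b * d)
        interchange = solve-∀

      module _ (k : ℕ) (sums-of-squares : ∀ (v : Vec F (dim (suc k))) → powerα v ≤ θ ‖ v ‖) where

        private
          m = suc k
          V = vecs (dim m)
          e = a ^ dim m
          τ : F → ℤ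
          τ t = θ t * good m t
          0≤good : ∀ t → 0ℤ ≤ good m t
          0≤good t = ⟨⟩-nonneg (σ m * η t ℤ.≟ -1ℤ)
          0≤τ : ∀ t → 0ℤ ≤ τ t
          0≤τ t = *-nonneg (0≤θ t) (0≤good t)
          τ≤θ : ∀ t → τ t ≤ θ t
          τ≤θ t = ≤-trans (*-monoˡ (0≤θ t) (⟨⟩≤1 (σ m * η t ℤ.≟ -1ℤ))) (≤-reflexive (*-identityʳ (θ t)))
          τ-good : ∀ t → τ t ≡ 0ℤ ⊎ σ m * η t ≡ -1ℤ
          τ-good t with σ m * η t ℤ.≟ -1ℤ
          ... | yes p = inj₂ p
          ... | no _ = inj₁ (*-zeroʳ (θ t))
          G = ∑ V (λ v → powerα v * good m ‖ v ‖)
          N′ = incidences m powerα τ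
          M = ∑ V (λ z → powerζ z * N′ z)

        many-incidences : G * e ≤ M
        many-incidences = begin
          G * e                                                                            ≡⟨ cong (G *_) (∑-power α 0≤α α≤1 (dim m)) ⟨
          G * ∑ V powerα                                                                   ≡⟨ trans (∑-*-∑ V V _ powerα) (∑-swap V V _) ⟩
          ∑ V (λ y → ∑ V (λ x → powerα x * good′ ‖ x ‖ * powerα y))                         ≡⟨ (∑-cong V λ y → sym (∑ᵛ-translate y (λ x → powerα x * good′ ‖ x ‖ * powerα y))) ⟩
          ∑ V (λ y → ∑ V (λ z → powerα (z ⊟ᵛ y) * good′ ‖ z ⊟ᵛ y ‖ * powerα y))             ≤⟨ (∑-mono V λ y → ∑-mono V λ z → pointwise z y) ⟩
          ∑ V (λ y → ∑ V (λ z → powerζ z * (powerα y * τ ‖ z ⊟ᵛ y ‖)))                      ≡⟨ ∑-swap V V _ ⟩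
          ∑ V (λ z → ∑ V (λ y → powerζ z * (powerα y * τ ‖ z ⊟ᵛ y ‖)))                      ≡⟨ (∑-cong V λ z → trans (∑-*ˡ V (powerζ z) _) (cong (powerζ z *_) (sym (incidences-sum m powerα τ z)))) ⟩
          M                                                                                ∎
          where
          open ≤-Reasoning
          good′ = good m
          interchange : ∀ x g y → x * x * g * (y * y) ≡ x * y * (y * (x * g))
          interchange = solve-∀
          pointwise : ∀ z y → powerα (z ⊟ᵛ y) * good′ ‖ z ⊟ᵛ y ‖ * powerα y ≤ powerζ z * (powerα y * τ ‖ z ⊟ᵛ y ‖)
          pointwise z y = begin
            -- As α takes only the values 0 and 1, its powers may be squared: one copy of x and y
            -- places z in (A + A)ᵈ, the other pays for the weight of the sphere.
            px * g * py                        ≡⟨ cong₂ (λ s t → s * g * t) (powerα-idem (z ⊟ᵛ y)) (powerα-idem y) ⟨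
            px * px * g * (py * py)            ≡⟨ interchange px g py ⟩
            px * py * (py * (px * g))          ≤⟨ *-mono (*-nonneg (0≤p (z ⊟ᵛ y)) (0≤p y)) (*-nonneg (0≤p y) (0≤τ ‖ z ⊟ᵛ y ‖)) (power-sumset z y)
                                                    (*-monoˡ (0≤p y) (*-monoʳ (0≤good ‖ z ⊟ᵛ y ‖) (sums-of-squares (z ⊟ᵛ y)))) ⟩
            powerζ z * (py * τ ‖ z ⊟ᵛ y ‖)     ∎
            where
            px = powerα (z ⊟ᵛ y)
            py = powerα y
            g = good′ ‖ z ⊟ᵛ y ‖
            0≤p : ∀ (v : Vec F (dim m)) → 0ℤ ≤ powerα v
            0≤p = 0≤power α 0≤α α≤1

        -- Since d = 2m + 1, `Q * Q ^ m` is q^((d+1)/2) and `e * a` is |A|^(d+1): the d-th powers of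
        -- the two entries of the minimum in (1).
        not-both-small : + 64 * Q ≤ a * a → ∑ᶠ ζ ^ dim m ≤ Q * Q ^ m → ∑ᶠ ζ ^ dim m ≤ e * a → ¬ + 32 * (∑ᶠ θ * Q ^ m) ≤ e
        not-both-small 64q≤aa Z≤QU Z≤ea small = deviation-contradiction Q U a e Z (∑ᶠ τ) G M
          0<Q 0<e (q^-nonneg m) (≤-trans (∑-nonneg V (0≤power ζ 0≤ζ ζ≤1)) (≤-reflexive ∑powerζ)) (∑-nonneg Fs 0≤τ)
          many-incidences (many-good α 0≤α α≤1 k 64q≤aa) deviation Z≤QU Z≤ea
          (≤-trans (*-monoˡ {c = + 32} (+≤+ ℕ.z≤n) (*-monoʳ (q^-nonneg m) (∑-mono Fs τ≤θ))) small)
          (≤-trans (*-monoˡ 0≤a′ (Q^≤ m)) (≤-reflexive (sym (^-dim a m))))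
          where
          U = Q ^ m
          Z = ∑ᶠ ζ ^ dim m
          ∑powerζ : ∑ V powerζ ≡ Z
          ∑powerζ = ∑-power ζ 0≤ζ ζ≤1 (dim m)
          0≤a′ = 0≤a α 0≤α α≤1
          0<Q : 0ℤ < Q
          0<Q = ≤∧≢⇒< 0≤q (q≢0 ∘ sym)
          Q≤aa : Q ≤ a * a
          Q≤aa = ≤-trans (≤-trans (≤-reflexive (sym (*-identityˡ Q))) (*-monoʳ {1ℤ} {+ 64} 0≤q (+≤+ (ℕ.m≤m+n 1 63)))) 64q≤aa
          a≢0 : a ≢ 0ℤ
          a≢0 a≡0 = <-irrefl refl (<-≤-trans 0<Q (≤-trans Q≤aa (≤-reflexive (cong (λ x → x * x) a≡0))))
          0<a^ : ∀ n → 0ℤ < a ^ n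
          0<a^ zero = +<+ (ℕ.s≤s ℕ.z≤n)
          0<a^ (suc n) = ≤-<-trans (≤-reflexive (sym (*-zeroʳ a))) (*-monoˡ-<-pos a {{positive (≤∧≢⇒< 0≤a′ (a≢0 ∘ sym))}} (0<a^ n))
          0<e : 0ℤ < e
          0<e = 0<a^ (dim m)
          Q^≤ : ∀ n → Q ^ n ≤ a ^ n * a ^ n
          Q^≤ zero = ≤-refl
          Q^≤ (suc n) = ≤-trans (*-mono 0≤q (*-nonneg (0≤a^ α 0≤α α≤1 n) (0≤a^ α 0≤α α≤1 n)) Q≤aa (Q^≤ n)) (≤-reflexive (interchange a (a ^ n)))
            where
            interchange : ∀ a b → a * a * (b * b) ≡ a * b * (a * b)
            interchange = solve-∀
          totalWeight-power : totalWeight m powerα τ ≡ e * ∑ᶠ τ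
          totalWeight-power = trans (totalWeight-product m powerα τ) (cong (_* ∑ᶠ τ) (∑-power α 0≤α α≤1 (dim m)))
          deviation : (Q * M - Z * (e * ∑ᶠ τ)) * (Q * M - Z * (e * ∑ᶠ τ)) ≤ Z * (+ 3 * (Q * U) * (e * ∑ᶠ τ * (e * ∑ᶠ τ)) + Q * U * (Q * U) * (e * ∑ᶠ τ))
          deviation = subst₂ (λ z s → (Q * M - z * s) * (Q * M - z * s) ≤ z * (+ 3 * (Q * U) * (s * s) + Q * U * (Q * U) * s)) ∑powerζ totalWeight-power
            (incidence m powerα τ (0≤power α 0≤α α≤1) (power≤1 α 0≤α α≤1) 0≤τ (λ t → ≤-trans (τ≤θ t) (θ≤1 t)) τ-good powerζ (0≤power ζ 0≤ζ ζ≤1) (power≤1 ζ 0≤ζ ζ≤1))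

  -- From an abstract finite field and lists to `Fin q` and indicators.

  module Transport {q : ℕ} (F : FiniteField 0ℓ 0ℓ q) where

    private module F = FiniteField F
    open F using (Carrier; _≈_; 0#; 1#; card; _⊕_; squares; _-fold_)
    open Inverse F.enumeration using (to; from; to-cong; from-cong; strictlyInverseˡ; strictlyInverseʳ)

    rawRing : RawRing 0ℓ 0ℓ
    rawRing = record
      { Carrier = Fin q
      ; _≈_ = _≡_
      ; _+_ = λ x y → to (from x F.+ from y)
      ; _*_ = λ x y → to (from x F.* from y)
      ; -_ = λ x → to (F.- from x)
      ; 0# = to 0#
      ; 1# = to 1#
      }

    from-injective : ∀ {x y} → from x ≈ from y → x ≡ y
    from-injective {x} {y} e = trans (sym (strictlyInverseˡ x)) (trans (to-cong e) (strictlyInverseˡ y))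

    -- The ring axioms on `Fin q` are pulled back along the injection `from`. There equality is
    -- propositional, so elements can be rewritten freely and sums range over `allFin q`.
    from-isRingMonomorphism : IsRingMonomorphism rawRing F.rawRing from
    from-isRingMonomorphism = record
      { isRingHomomorphism = record
        { isSemiringHomomorphism = record
          { isNearSemiringHomomorphism = record
            { +-isMonoidHomomorphism = record
              { isMagmaHomomorphism = record
                { isRelHomomorphism = record { cong = from-cong }
                ; homo = λ x y → strictlyInverseʳ (from x F.+ from y)
                }
              ; ε-homo = strictlyInverseʳ 0#
              }
            ; *-homo = λ x y → strictlyInverseʳ (from x F.* from y)
            }
          ; 1#-homo = strictlyInverseʳ 1#
          }
        ; -‿homo = λ x → strictlyInverseʳ (F.- from x)
        }
      ; injective = from-injective
      }

    fieldOnFin : FieldOnFin q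
    fieldOnFin = record
      { isCommutativeRing = RingMonomorphism.isCommutativeRing from-isRingMonomorphism F.isCommutativeRing
      ; 𝟙≢𝟘 = λ e → F.1≉0 (F.trans (F.sym (strictlyInverseʳ 1#)) (F.trans (from-cong e) (strictlyInverseʳ 0#)))
      ; inverse = λ x x≢0 → let (y , yx≈1 , _) = F.≉0⇒inverse (λ x≈0 → x≢0 (trans (sym (strictlyInverseˡ x)) (to-cong x≈0))) in
          to y , to-cong (F.trans (F.*-congʳ (strictlyInverseʳ y)) yx≈1)
      }

    F-decSetoid : DecSetoid 0ℓ 0ℓ
    F-decSetoid = record { isDecEquivalence = record { isEquivalence = F.isEquivalence ; _≟_ = F._≟_ } }

    open DecSetoidMembership F-decSetoid using (_∈_; _∈?_)

    indicator : List Carrier → Fin q → ℤ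
    indicator L i = ⟨ from i ∈? L ⟩

    length-unique : ∀ L → UniqueSetoid.Unique F.setoid L → + length L ≡ ∑ᶠ (indicator L)
    length-unique [] _ = sym (∑-0 (allFin q))
    length-unique (x ∷ L) (x∉L AllPairs.∷ L!) = begin
      1ℤ + + length L                                         ≡⟨ cong₂ _+_ (∑ᶠ-unique (Fin._≟ to x) (to x) refl λ _ e → e) (sym (length-unique L L!)) ⟨
      ∑ᶠ (λ i → ⟨ i Fin.≟ to x ⟩) + ∑ᶠ (indicator L)          ≡⟨ ∑-+ (allFin q) _ _ ⟨
      ∑ᶠ (λ i → ⟨ i Fin.≟ to x ⟩ + indicator L i)             ≡⟨ ∑-cong (allFin q) split ⟩
      ∑ᶠ (indicator (x ∷ L))                                  ∎
      where
      open ≡-Reasoning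
      split : ∀ i → ⟨ i Fin.≟ to x ⟩ + indicator L i ≡ indicator (x ∷ L) i
      split i with i Fin.≟ to x
      ... | yes refl = trans (cong (_+_ 1ℤ) (⟨⟩-false (from (to x) ∈? L) λ x∈L → All[≉]⇒∉ F.setoid x∉L (∈-resp-≈ F.setoid (strictlyInverseʳ x) x∈L)))
              (sym (⟨⟩-true (from (to x) ∈? x ∷ L) (here (strictlyInverseʳ x))))
      ... | no i≢x = trans (+-identityˡ _) (⟨⟩-cong (from i ∈? L) (from i ∈? x ∷ L) there λ
              { (here e) → contradiction (trans (sym (strictlyInverseˡ i)) (to-cong e)) i≢x ; (there p) → p })

    card-indicator : ∀ L → + card L ≡ ∑ᶠ (indicator L)
    card-indicator L = trans (length-unique (deduplicate F._≟_ L) (deduplicate-! F-decSetoid L)) (∑-cong (allFin q) λ i →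
      ⟨⟩-cong (from i ∈? deduplicate F._≟_ L) (from i ∈? L) (∈-deduplicate⁻ F.setoid F._≟_ L) (∈-deduplicate⁺ F.setoid F._≟_ (λ e e′ → F.trans e′ (F.sym e))))

    indicator-⊕ : ∀ L L′ x y → indicator L x * indicator L′ y ≤ indicator (L ⊕ L′) (to (from x F.+ from y))
    indicator-⊕ L L′ x y = ⟨⟩-*-≤ (from x ∈? L) (from y ∈? L′) (from (to (from x F.+ from y)) ∈? L ⊕ L′) λ p p′ →
      ∈-resp-≈ F.setoid (F.sym (strictlyInverseʳ _)) (∈-cartesianProductWith⁺ F.setoid F.setoid F.setoid F.+-cong p p′)

    indicator-squares : ∀ L x → indicator L x ≤ indicator (squares L) (to (from x F.* from x))
    indicator-squares L x = ≤-trans (≤-reflexive (sym (⟨⟩-idem (from x ∈? L)))) (⟨⟩-*-≤ (from x ∈? L) (from x ∈? L) (from (to (from x F.* from x)) ∈? squares L) λ p _ →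
      ∈-resp-≈ F.setoid (F.sym (strictlyInverseʳ _)) (∈-map⁺ F.setoid F.setoid (λ e → F.*-cong e e) p))

    module _ (q%4≡3 : q ℕ.% 4 ≡ 3) where

      open Spheres fieldOnFin q%4≡3
      open Weights fieldOnFin q%4≡3
      open Sumsets fieldOnFin q%4≡3

      power-fold : ∀ A {n} (v : Vec (Fin q) n) → power (indicator A) v ≤ indicator (n -fold squares A) ‖ v ‖
      power-fold A [] = ≤-reflexive (sym (⟨⟩-true (from (to 0#) ∈? 0# ∷ []) (here (strictlyInverseʳ 0#))))
      power-fold A {suc n} (x ∷ v) = ≤-trans
        (*-mono (⟨⟩-nonneg (from x ∈? A)) (⟨⟩-nonneg (from ‖ v ‖ ∈? n -fold squares A)) (indicator-squares A x) (power-fold A v))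
        (indicator-⊕ (squares A) (n -fold squares A) (to (from x F.* from x)) ‖ v ‖)

      pos-^ : ∀ n j → + (n ℕ.^ j) ≡ (+ n) ^ j
      pos-^ n zero = refl
      pos-^ n (suc j) = trans (pos-* n (n ℕ.^ j)) (cong (+ n *_) (pos-^ n j))

      -- Alternative (1) is raised to the power 2d, which clears the fractional exponents. Both
      -- alternatives are decidable inequalities in ℕ, so it suffices to refute their joint failure.
      dichotomy : ∀ k A → 64 ℕ.* q ℕ.≤ card A ℕ.^ 2 →
        q ℕ.^ (dim (suc k) ℕ.+ 1) ℕ.⊓ card A ℕ.^ (2 ℕ.* (dim (suc k) ℕ.+ 1)) ℕ.≤ card (A ⊕ A) ℕ.^ (2 ℕ.* dim (suc k)) ⊎
        card A ℕ.^ dim (suc k) ℕ.≤ 32 ℕ.* (card (dim (suc k) -fold squares A) ℕ.* q ℕ.^ suc k)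
      dichotomy k A large with card A ℕ.^ dim (suc k) ℕ.≤? 32 ℕ.* (card (dim (suc k) -fold squares A) ℕ.* q ℕ.^ suc k)
      ... | yes p = inj₂ p
      ... | no few with q ℕ.^ (dim (suc k) ℕ.+ 1) ℕ.⊓ card A ℕ.^ (2 ℕ.* (dim (suc k) ℕ.+ 1)) ℕ.≤? card (A ⊕ A) ℕ.^ (2 ℕ.* dim (suc k))
      ...   | yes p = inj₁ p
      ...   | no small = contradiction few′ (not-both-small α ζ θ
                (λ i → ⟨⟩-nonneg (from i ∈? A)) (λ i → ⟨⟩≤1 (from i ∈? A)) (λ i → ⟨⟩-idem (from i ∈? A))
                (λ i → ⟨⟩-nonneg (from i ∈? A ⊕ A)) (λ i → ⟨⟩≤1 (from i ∈? A ⊕ A))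
                (λ i → ⟨⟩-nonneg (from i ∈? d -fold squares A)) (λ i → ⟨⟩≤1 (from i ∈? d -fold squares A))
                (indicator-⊕ A A) k (power-fold A) large′ Z≤QU Z≤ea)
        where
        open ≤-Reasoning
        d = dim (suc k)
        α = indicator A
        ζ = indicator (A ⊕ A)
        θ = indicator (d -fold squares A)
        a = card A
        z = card (A ⊕ A)
        t = card (d -fold squares A)
        U = Q ^ suc k
        large′ : + 64 * Q ≤ ∑ᶠ α * ∑ᶠ α
        large′ = begin
          + 64 * Q           ≡⟨ pos-* 64 q ⟨
          + (64 ℕ.* q)       ≤⟨ +≤+ large ⟩
          + (a ℕ.^ 2)        ≡⟨ trans (pos-^ a 2) (cong (+ a *_) (*-identityʳ (+ a))) ⟩
          + a * + a          ≡⟨ cong₂ _*_ (card-indicator A) (card-indicator A) ⟩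
          ∑ᶠ α * ∑ᶠ α        ∎
        few′ : + 32 * (∑ᶠ θ * U) ≤ ∑ᶠ α ^ d
        few′ = begin
          + 32 * (∑ᶠ θ * U)                    ≡⟨ cong (λ x → + 32 * (x * U)) (card-indicator (d -fold squares A)) ⟨
          + 32 * (+ t * U)                     ≡⟨ trans (pos-* 32 (t ℕ.* q ℕ.^ suc k)) (cong (+ 32 *_) (trans (pos-* t (q ℕ.^ suc k)) (cong (+ t *_) (pos-^ q (suc k))))) ⟨
          + (32 ℕ.* (t ℕ.* q ℕ.^ suc k))       ≤⟨ +≤+ (ℕ.<⇒≤ (ℕ.≰⇒> few)) ⟩
          + (a ℕ.^ d)                          ≡⟨ trans (pos-^ a d) (cong (_^ d) (card-indicator A)) ⟩
          ∑ᶠ α ^ d                             ∎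
        zz : ∑ᶠ ζ ^ d * ∑ᶠ ζ ^ d ≡ + (z ℕ.^ (2 ℕ.* d))
        zz = begin-equality
          ∑ᶠ ζ ^ d * ∑ᶠ ζ ^ d      ≡⟨ cong (λ x → x ^ d * x ^ d) (card-indicator (A ⊕ A)) ⟨
          (+ z) ^ d * (+ z) ^ d    ≡⟨ ^-distribˡ-+-* (+ z) d d ⟨
          (+ z) ^ (d ℕ.+ d)        ≡⟨ cong (λ j → (+ z) ^ (d ℕ.+ j)) (ℕ.+-identityʳ d) ⟨
          (+ z) ^ (2 ℕ.* d)        ≡⟨ pos-^ z (2 ℕ.* d) ⟨
          + (z ℕ.^ (2 ℕ.* d))      ∎
        0≤Z : 0ℤ ≤ ∑ᶠ α ^ d * ∑ᶠ α
        0≤Z = *-nonneg (0≤a^ α (λ i → ⟨⟩-nonneg (from i ∈? A)) (λ i → ⟨⟩≤1 (from i ∈? A)) d) (∑-nonneg (allFin q) λ i → ⟨⟩-nonneg (from i ∈? A))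
        below = ℕ.≰⇒> small
        -- The exponent d + 1 is even, so q^(d+1) is a perfect square and the doubled exponents can
        -- be halved again.
        Z≤QU : ∑ᶠ ζ ^ d ≤ Q * U
        Z≤QU = sq-cancel-≤ (*-nonneg 0≤q (q^-nonneg (suc k))) (begin
          ∑ᶠ ζ ^ d * ∑ᶠ ζ ^ d      ≡⟨ zz ⟩
          + (z ℕ.^ (2 ℕ.* d))      ≤⟨ +≤+ (ℕ.<⇒≤ (ℕ.<-≤-trans below (ℕ.m⊓n≤m _ _))) ⟩
          + (q ℕ.^ (d ℕ.+ 1))      ≡⟨ trans (cong (λ j → + (q ℕ.^ j)) (ℕ.+-comm d 1)) (pos-^ q (suc d)) ⟩
          Q * Q ^ d                ≡⟨ cong (Q *_) (^-dim Q (suc k)) ⟩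
          Q * (Q * (U * U))        ≡⟨ arith Q U ⟩
          Q * U * (Q * U)          ∎)
          where
          arith : ∀ q u → q * (q * (u * u)) ≡ q * u * (q * u)
          arith = solve-∀
        Z≤ea : ∑ᶠ ζ ^ d ≤ ∑ᶠ α ^ d * ∑ᶠ α
        Z≤ea = sq-cancel-≤ 0≤Z (begin
          ∑ᶠ ζ ^ d * ∑ᶠ ζ ^ d                          ≡⟨ zz ⟩
          + (z ℕ.^ (2 ℕ.* d))                          ≤⟨ +≤+ (ℕ.<⇒≤ (ℕ.<-≤-trans below (ℕ.m⊓n≤n _ _))) ⟩
          + (a ℕ.^ (2 ℕ.* (d ℕ.+ 1)))                  ≡⟨ pos-^ a (2 ℕ.* (d ℕ.+ 1)) ⟩
          (+ a) ^ (2 ℕ.* (d ℕ.+ 1))                    ≡⟨ cong (λ j → (+ a) ^ (d ℕ.+ 1 ℕ.+ j)) (ℕ.+-identityʳ (d ℕ.+ 1)) ⟩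
          (+ a) ^ (d ℕ.+ 1 ℕ.+ (d ℕ.+ 1))              ≡⟨ ^-distribˡ-+-* (+ a) (d ℕ.+ 1) (d ℕ.+ 1) ⟩
          (+ a) ^ (d ℕ.+ 1) * (+ a) ^ (d ℕ.+ 1)        ≡⟨ cong (λ x → x * x) (trans (^-distribˡ-+-* (+ a) d 1) (cong ((+ a) ^ d *_) (^-identityʳ (+ a)))) ⟩
          (+ a) ^ d * + a * ((+ a) ^ d * + a)          ≡⟨ cong (λ x → x ^ d * x * (x ^ d * x)) (card-indicator A) ⟩
          ∑ᶠ α ^ d * ∑ᶠ α * (∑ᶠ α ^ d * ∑ᶠ α)          ∎)

  -- Exponents and rational constants of the statement.

  odd⇒dim : ∀ d → 3 ℕ.≤ d → d % 2 ≡ 1 → ∃[ k ] d ≡ dim (suc k) × (d ℕ.∸ 1) / 2 ≡ suc k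
  odd⇒dim d 3≤d odd = halve (d / 2) 3≤d (trans (m≡m%n+[m/n]*n d 2) (cong (ℕ._+ d / 2 ℕ.* 2) odd))
    where
    dim-* : ∀ m → dim m ≡ suc (m ℕ.* 2)
    dim-* zero = refl
    dim-* (suc m) = cong (λ j → ℕ.suc (ℕ.suc j)) (dim-* m)
    halve : ∀ {d} m → 3 ℕ.≤ d → d ≡ suc (m ℕ.* 2) → ∃[ k ] d ≡ dim (suc k) × (d ℕ.∸ 1) / 2 ≡ suc k
    halve zero (ℕ.s≤s ()) refl
    halve (suc k) _ refl = k , sym (dim-* (suc k)) , ℕ.m*n/n≡m (suc k) 2

  sumset-or-squares : ∀ {q} d → q % 4 ≡ 3 → 3 ℕ.≤ d → d % 2 ≡ 1 → (F : FiniteField 0ℓ 0ℓ q) → let open FiniteField F in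
    ∀ A → 64 ℕ.* q ℕ.≤ card A ℕ.^ 2 →
    q ℕ.^ (d ℕ.+ 1) ℕ.⊓ card A ℕ.^ (2 ℕ.* (d ℕ.+ 1)) ℕ.≤ card (A ⊕ A) ℕ.^ (2 ℕ.* d) ⊎
    card A ℕ.^ d ℕ.≤ 32 ℕ.* (card (d -fold squares A) ℕ.* q ℕ.^ ((d ℕ.∸ 1) / 2))
  sumset-or-squares d q%4≡3 3≤d odd F A large with odd⇒dim d 3≤d odd
  ... | k , refl , half rewrite half = Transport.dichotomy F q%4≡3 k A large

  -- Division in ℚ normalises by a gcd, which is stuck on a variable n; the explicit fraction with
  -- denominator 1 lets products and inequalities compute.
  ⟦⟧-mkℚ : ∀ n → ⟦ n ⟧ ≡ ℚ.mkℚ (+ n) 0 (ℕ.sym (ℕ.1-coprimeTo n))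
  ⟦⟧-mkℚ n = ℚ.↥p/↧p≡p (ℚ.mkℚ (+ n) 0 (ℕ.sym (ℕ.1-coprimeTo n)))

  ⟦⟧-* : ∀ m n → ⟦ m ⟧ ℚ.* ⟦ n ⟧ ≡ ⟦ m ℕ.* n ⟧
  ⟦⟧-* m n = trans (cong₂ ℚ._*_ (⟦⟧-mkℚ m) (⟦⟧-mkℚ n)) (cong (λ i → i ℚ./ 1) (sym (pos-* m n)))

  ⟦⟧-mono : ∀ {m n} → m ℕ.≤ n → ⟦ m ⟧ ℚ.≤ ⟦ n ⟧
  ⟦⟧-mono {m} {n} m≤n = subst₂ ℚ._≤_ (sym (⟦⟧-mkℚ m)) (sym (⟦⟧-mkℚ n)) (ℚ.*≤* (*-monoʳ 0≤1 (+≤+ m≤n)))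

  ⟦⟧-cancel : ∀ {m n} → ⟦ m ⟧ ℚ.≤ ⟦ n ⟧ → m ℕ.≤ n
  ⟦⟧-cancel {m} {n} m≤n with ℚ.*≤* p ← subst₂ ℚ._≤_ (⟦⟧-mkℚ m) (⟦⟧-mkℚ n) m≤n = drop‿+≤+ (subst₂ _≤_ (*-identityʳ (+ m)) (*-identityʳ (+ n)) p)

  ⟦⟧-*-≤ : ∀ a b n {m} → ⟦ a ⟧ ℚ.* ⟦ b ⟧ ℚ.* ⟦ n ⟧ ℚ.≤ ⟦ m ⟧ → a ℕ.* b ℕ.* n ℕ.≤ m
  ⟦⟧-*-≤ a b n {m} le = ⟦⟧-cancel (subst (ℚ._≤ ⟦ m ⟧) (trans (cong (ℚ._* ⟦ n ⟧) (⟦⟧-* a b)) (⟦⟧-* (a ℕ.* b) n)) le)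

  ⟦⟧-≤-* : ∀ c n {m} → m ℕ.≤ c ℕ.* n → ⟦ m ⟧ ℚ.≤ ⟦ c ⟧ ℚ.* ⟦ n ⟧
  ⟦⟧-≤-* c n {m} le = subst (⟦ m ⟧ ℚ.≤_) (sym (⟦⟧-* c n)) (⟦⟧-mono le)

open import Level using (0ℓ)
open import Data.List.Base using (List)
open import Data.Nat.Base as ℕ using (ℕ; _∸_; _^_; _⊓_; _≤_; _/_; _%_)
open import Data.Nat.Primality using (Prime)
open import Data.Product.Base using (∃-syntax; _×_; _,_)
open import Data.Rational.Base as ℚ using (0ℚ)
open import Data.Sum.Base using (_⊎_; map₂)
open import Relation.Binary.PropositionalEquality using (_≡_; _≢_)

theorem1p10 : ∃[ c ] ∃[ C ] 0ℚ ℚ.< c × 0ℚ ℚ.< C ×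
    (∀ (q p k d : ℕ) → Prime p → p ≢ 2 → 1 ≤ k → q ≡ p ^ k → q % 4 ≡ 3 →
    3 ≤ d → d % 2 ≡ 1 →
    (F : FiniteField 0ℓ 0ℓ q) → let open FiniteField F in
    (A : List Carrier) →
    c ℚ.* c ℚ.* ⟦ q ⟧ ℚ.≤ ⟦ card A ^ 2 ⟧ →
    (q ^ (d ℕ.+ 1) ⊓ card A ^ (2 ℕ.* (d ℕ.+ 1)) ≤ card (A ⊕ A) ^ (2 ℕ.* d))
    ⊎
    (⟦ card A ^ d ⟧ ℚ.≤ C ℚ.* ⟦ card (d -fold squares A) ℕ.* q ^ ((d ∸ 1) / 2) ⟧))
-- c = 8 because c² = 64 is the constant of `many-good`; C = 32 is the constant of
-- `deviation-contradiction`.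
theorem1p10 = ⟦ 8 ⟧ , ⟦ 32 ⟧ , ℚ.positive⁻¹ ⟦ 8 ⟧ , ℚ.positive⁻¹ ⟦ 32 ⟧ , λ q _ _ d _ _ _ _ q%4≡3 3≤d odd F A large →
  let open FiniteField F in
  map₂ (⟦⟧-≤-* 32 (card (d -fold squares A) ℕ.* q ^ ((d ∸ 1) / 2))) (sumset-or-squares d q%4≡3 3≤d odd F A (⟦⟧-*-≤ 8 8 q large))
  where open Counting
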